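{- Let $P$ be a Cohen--Macaulay finite graded bounded poset of rank $r\ge1$. Then the $\chi$-Chow polynomial of $P$ is $\gamma$-positive: there are integers $\gamma_i\ge0$ with $\mathrm{H}_P(x)=\sum_{i=0}^{\lfloor(r-1)/2\rfloor}\gamma_i\,x^i(1+x)^{r-1-2i}$.
   Context: For a finite graded bounded poset $P$ with rank function $\rho$ ($\rho_{st}=\rho(t)-\rho(s)$, rank $r=\rho(\widehat1)$), the characteristic function is $\chi_{st}(x)=\sum_{s\le w\le t}\mu_{sw}x^{\rho_{wt}}$ (Möbius function $\mu$), an element of the incidence algebra (maps $[s,t]\mapsto a_{st}(x)\in\mathbb{Z}[x]$ with product $(ab)_{st}=\sum_{s\le w\le t}a_{sw}b_{wt}$). For $s<t$, $\chi_{st}$ is divisible by $x-1$; let $\overline{\chi}_{st}=\chi_{st}/(x-1)$ for $s<t$ and $\overline{\chi}_{ss}=-1$. The $\chi$-Chow function is $\mathrm{H}=-(\overline{\chi})^{ -1}$ and $\mathrm{H}_P=\mathrm{H}_{\widehat0\widehat1}$. $P$ is Cohen--Macaulay (over $\mathbb{Q}$) if for every $s<t$ the order complex of the open interval $(s,t)=\{w:s<w<t\}$ has rational reduced homology $\widetilde H_i=0$ for all $i\ne\rho_{st}-2$. -}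

module Defs where

open import Data.Nat as ℕ using (ℕ; zero; suc; _∸_; ⌊_/2⌋)
open import Data.Integer as ℤ using (ℤ)
open import Data.Rational as ℚ using (ℚ)
open import Data.Bool using (Bool; true; false; if_then_else_; _∧_; not; T)
open import Data.Fin as Fin using (Fin; toℕ)
open import Data.List as List using (List; []; _∷_; map; foldr; concatMap; allFin; replicate)
open import Data.Vec as Vec using (Vec; []; _∷_; removeAt)
open import Data.Vec.Properties using (≡-dec)
open import Data.Product using (Σ; ∃; ∃-syntax; _×_; _,_)
open import Data.Unit using (⊤)
open import Relation.Nullary using (¬_)
open import Relation.Nullary.Decidable using (⌊_⌋)
open import Relation.Binary.PropositionalEquality using (_≡_; _≢_)

-- Polynomials in ℤ[x] as coefficient lists (lowest degree first).
-- Two lists denote the same polynomial iff all coefficients agree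
-- (trailing zeros are irrelevant).

Poly : Set
Poly = List ℤ

coeff : Poly → ℕ → ℤ
coeff []       _       = ℤ.0ℤ
coeff (a ∷ _)  zero    = a
coeff (_ ∷ p)  (suc k) = coeff p k

infixl 6 _+ₚ_
infixl 7 _*ₚ_

_+ₚ_ : Poly → Poly → Poly
[]      +ₚ q       = q
(a ∷ p) +ₚ []      = a ∷ p
(a ∷ p) +ₚ (b ∷ q) = (a ℤ.+ b) ∷ (p +ₚ q)

scaleₚ : ℤ → Poly → Poly
scaleₚ c = map (c ℤ.*_)

negₚ : Poly → Poly
negₚ = scaleₚ (ℤ.- ℤ.1ℤ)

_*ₚ_ : Poly → Poly → Poly
[]      *ₚ q = []
(a ∷ p) *ₚ q = scaleₚ a q +ₚ (ℤ.0ℤ ∷ (p *ₚ q))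

constₚ : ℤ → Poly
constₚ c = c ∷ []

monoₚ : ℕ → Poly
monoₚ k = replicate k ℤ.0ℤ List.++ (ℤ.1ℤ ∷ [])

powₚ : Poly → ℕ → Poly
powₚ p zero    = constₚ ℤ.1ℤ
powₚ p (suc k) = p *ₚ powₚ p k

sumₚ : List Poly → Poly
sumₚ = foldr _+ₚ_ []

-- Quotient by (x - 1): if p = Σ aᵢ xⁱ = (x-1) q then
-- qᵢ = -(a₀ + … + aᵢ).  (Exact whenever x - 1 divides p.)
divX-1 : Poly → Poly
divX-1 = go ℤ.0ℤ
  where
  go : ℤ → Poly → Poly
  go acc []      = []
  go acc (a ∷ p) = (ℤ.- (acc ℤ.+ a)) ∷ go (acc ℤ.+ a) p

record GradedBoundedPoset (n : ℕ) : Set where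
  field
    le       : Fin n → Fin n → Bool
    le-refl  : ∀ a → T (le a a)
    le-antisym : ∀ a b → T (le a b) → T (le b a) → a ≡ b
    le-trans : ∀ a b c → T (le a b) → T (le b c) → T (le a c)
    bot      : Fin n
    top      : Fin n
    bot-le   : ∀ a → T (le bot a)
    le-top   : ∀ a → T (le a top)
    ρ        : Fin n → ℕ
  eqb : Fin n → Fin n → Bool
  eqb a b = ⌊ a Fin.≟ b ⌋
  lt : Fin n → Fin n → Bool
  lt a b = le a b ∧ not (eqb a b)
  Covers : Fin n → Fin n → Set
  Covers a b = T (lt a b) × (∀ c → ¬ (T (lt a c) × T (lt c b)))
  field
    ρ-bot    : ρ bot ≡ 0
    ρ-cover  : ∀ a b → Covers a b → ρ b ≡ suc (ρ a)

module _ {n : ℕ} (P : GradedBoundedPoset n) where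
  open GradedBoundedPoset P

  rank : ℕ
  rank = ρ top

  sumℤ-over : (Fin n → Bool) → (Fin n → ℤ) → ℤ
  sumℤ-over pr f = foldr (λ w acc → if pr w then f w ℤ.+ acc else acc) ℤ.0ℤ (allFin n)

  sumₚ-over : (Fin n → Bool) → (Fin n → Poly) → Poly
  sumₚ-over pr f = sumₚ (map f (List.filterᵇ pr (allFin n)))

  -- Möbius function: μ_ss = 1, μ_st = - Σ_{s ≤ w < t} μ_sw (s < t), 0 otherwise.
  -- Defined with fuel; fuel n suffices since chains have < n strict steps.
  μF : ℕ → Fin n → Fin n → ℤ
  μF fuel s t with eqb s t | le s t
  μF fuel     s t | true  | _     = ℤ.1ℤ
  μF fuel     s t | false | false = ℤ.0ℤ
  μF zero     s t | false | true  = ℤ.0ℤ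
  μF (suc k)  s t | false | true  =
    ℤ.- sumℤ-over (λ w → le s w ∧ lt w t) (λ w → μF k s w)

  μ : Fin n → Fin n → ℤ
  μ = μF n

  χ : Fin n → Fin n → Poly
  χ s t = sumₚ-over (λ w → le s w ∧ le w t)
                    (λ w → scaleₚ (μ s w) (monoₚ (ρ t ∸ ρ w)))

  χ̄ : Fin n → Fin n → Poly
  χ̄ s t = if eqb s t then constₚ (ℤ.- ℤ.1ℤ) else divX-1 (χ s t)

  -- inverse of χ̄ in the incidence algebra:
  -- I_ss = χ̄_ss⁻¹ = -1 and, for s < t, Σ_{s≤w≤t} I_sw χ̄_wt = 0, i.e.
  -- I_st = - χ̄_tt⁻¹ Σ_{s≤w<t} I_sw χ̄_wt = Σ_{s≤w<t} I_sw χ̄_wt.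
  χ̄invF : ℕ → Fin n → Fin n → Poly
  χ̄invF fuel s t with eqb s t | le s t
  χ̄invF fuel    s t | true  | _     = constₚ (ℤ.- ℤ.1ℤ)
  χ̄invF fuel    s t | false | false = []
  χ̄invF zero    s t | false | true  = []
  χ̄invF (suc k) s t | false | true  =
    sumₚ-over (λ w → le s w ∧ lt w t) (λ w → χ̄invF k s w *ₚ χ̄ w t)

  χ̄inv : Fin n → Fin n → Poly
  χ̄inv = χ̄invF n

  H : Fin n → Fin n → Poly
  H s t = negₚ (χ̄inv s t)

  chowPoly : Poly
  chowPoly = H bot top

  -- Reduced rational homology of the order complex of the open
  -- interval (s,t).  A simplex with j vertices (dimension j-1) is
  -- encoded as the unique strictly increasing vector w₁ < … < w_j of
  -- elements of (s,t); j = 0 is the empty simplex (augmented complex).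
  -- A chain in C_{j-1} is a function Vec (Fin n) j → ℚ (only its values
  -- on valid simplices matter).

  inOpen : Fin n → Fin n → Fin n → Bool
  inOpen s t w = lt s w ∧ lt w t

  increasing : ∀ {j} → Vec (Fin n) j → Bool
  increasing []           = true
  increasing (a ∷ [])     = true
  increasing (a ∷ b ∷ v)  = lt a b ∧ increasing (b ∷ v)

  allIn : Fin n → Fin n → ∀ {j} → Vec (Fin n) j → Bool
  allIn s t []      = true
  allIn s t (a ∷ v) = inOpen s t a ∧ allIn s t v

  simplex : Fin n → Fin n → ∀ {j} → Vec (Fin n) j → Bool
  simplex s t v = allIn s t v ∧ increasing v

  allVecs : (j : ℕ) → List (Vec (Fin n) j)
  allVecs zero    = [] ∷ []
  allVecs (suc j) = concatMap (λ v → map (_∷ v) (allFin n)) (allVecs j)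

  sumℚ : List ℚ → ℚ
  sumℚ = foldr ℚ._+_ ℚ.0ℚ

  sgn : ℕ → ℚ
  sgn zero    = ℚ.1ℚ
  sgn (suc k) = ℚ.- sgn k

  eqVec : ∀ {j} → Vec (Fin n) j → Vec (Fin n) j → Bool
  eqVec u v = ⌊ ≡-dec Fin._≟_ u v ⌋

  ∂ : Fin n → Fin n → (j : ℕ) → (Vec (Fin n) (suc j) → ℚ) → Vec (Fin n) j → ℚ
  ∂ s t j c σ = sumℚ (map (λ τ →
      if simplex s t τ
      then sumℚ (map (λ k → if eqVec (removeAt τ k) σ
                             then sgn (toℕ k) ℚ.* c τ else ℚ.0ℚ)
                     (allFin (suc j)))
      else ℚ.0ℚ) (allVecs (suc j)))

  Cycle : Fin n → Fin n → (j : ℕ) → (Vec (Fin n) j → ℚ) → Set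
  Cycle s t zero    c = ⊤
  Cycle s t (suc j) c = ∀ σ → T (simplex s t σ) → ∂ s t j c σ ≡ ℚ.0ℚ

  Boundary : Fin n → Fin n → (j : ℕ) → (Vec (Fin n) j → ℚ) → Set
  Boundary s t j c =
    ∃[ d ] (∀ τ → T (simplex s t τ) → ∂ s t j d τ ≡ c τ)

  -- H̃_{j-1}(Δ(s,t); ℚ) = 0
  ReducedHomologyVanishes : Fin n → Fin n → ℕ → Set
  ReducedHomologyVanishes s t j =
    ∀ c → Cycle s t j c → Boundary s t j c

  -- Cohen–Macaulay over ℚ: for all s < t, H̃_i = 0 for i ≠ ρ_st - 2,
  -- i.e. with j = i + 1 (j ≥ 0 ↔ i ≥ -1): j ≠ ρ_st - 1.
  CohenMacaulay : Set
  CohenMacaulay = ∀ s t → T (lt s t) → ∀ (j : ℕ) →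
    j ≢ (ρ t ∸ ρ s) ∸ 1 → ReducedHomologyVanishes s t j

gammaExpansion : ℕ → (ℕ → ℕ) → Poly
gammaExpansion r γ =
  sumₚ (map (λ i → scaleₚ (ℤ.+ γ i)
                     (monoₚ i *ₚ powₚ (ℤ.1ℤ ∷ ℤ.1ℤ ∷ []) (r ∸ 1 ∸ 2 ℕ.* i)))
            (List.upTo (suc ⌊ r ∸ 1 /2⌋)))

-- Write ζ, μ for the zeta and Möbius elements and ζʳᵉᵛ for x^ρ.  From χ = μ ζʳᵉᵛ and the definition
-- of H one gets H μ (ζʳᵉᵛ - x ζ) = 1 - x.  Hence J = H μ is inverse to 1 - M, where
-- M(s,t) = x + ... + x^(ρ(t)-ρ(s)-1) for s < t, and H(s,t) = 1 + Σ_{s<w≤t} M(s,w) H(w,t).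
-- Summing this recursion rank by rank and passing from flag f- to flag h-numbers β gives
--   H_P = Σ_S β(S) x^|S| (1+x)^(r-1-2|S|)
-- over the sets S ⊆ {2, ..., r-1} without consecutive elements: reading ranks upwards, an isolated
-- unselected rank is a tile of weight 1 + x, and a pair (unselected, selected) is one of weight x.
--
-- It remains to see β(S) ≥ 0.  The complex of the rank-selected poset is acyclic below its top degree
-- |S|: start from all ranks and delete the unwanted levels from the bottom up.  At level i a filling
-- is pushed off each deleted x by filling its link, the join of (0,x), already selected, and (x,1),
-- still complete.  Acyclicity yields a linear contracting homotopy h below the top degree, so
-- β(S) = ± Euler characteristic is the trace of the idempotent 1 - h ∂ in the top degree, and a
-- rational idempotent has nonnegative trace, namely that of an orthogonal projection.

{-# OPTIONS --safe #-}
module Submission where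

open import Algebra using (CommutativeRing; IsCommutativeRing)
import Algebra.Solver.Ring
import Algebra.Solver.Ring.AlmostCommutativeRing as ACR
import Algebra.Properties.Ring
import Algebra.Properties.Semiring.Mult
import Algebra.Properties.Semiring.Mult.TCOptimised
import Relation.Binary.Reasoning.Setoid
open import Data.Nat as ℕ using (ℕ; zero; suc; _∸_; _≤_; _<_; z≤n; s≤s; ⌊_/2⌋; _≡ᵇ_; _<ᵇ_; _≤ᵇ_)
import Data.Nat.Properties as ℕₚ
open import Data.Integer as ℤ using (ℤ)
import Data.Integer.Properties as ℤₚ
open import Data.Bool using (Bool; true; false; if_then_else_; _∧_; not; T; T?)
open import Data.Fin as Fin using (Fin; toℕ)
import Data.Fin.Properties as Finₚ
open import Data.List using (List; []; _∷_; _++_; map; foldr; concatMap; allFin; length; upTo)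
import Data.List.Properties as Listₚ
open import Data.List.Relation.Unary.All using (All; []; _∷_)
open import Data.Maybe using (Maybe; just; nothing)
open import Data.Product using (∃-syntax; _×_; _,_; proj₁; proj₂)
open import Data.Sum using (_⊎_; inj₁; inj₂)
open import Data.Unit using (⊤; tt)
open import Data.Empty using (⊥; ⊥-elim)
open import Function using (_∘_; id)
open import Relation.Nullary using (¬_; Dec; yes; no)
open import Relation.Nullary.Decidable using (⌊_⌋; toWitness; fromWitness)
open import Relation.Binary.PropositionalEquality using (_≡_; _≢_; refl; sym; trans; cong; cong₂; subst; module ≡-Reasoning)
import Data.List.Relation.Unary.All as All
import Data.List.Relation.Unary.All.Properties as Allₚ
open import Data.Bool.ListAction using (all)
open import Data.List.Membership.Propositional using (_∈_)
open import Data.List.Relation.Unary.Any using (here; there)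
import Level
open import Defs
open import Data.Vec as Vec using (Vec; []; _∷_; removeAt; toList; fromList)
import Data.Vec.Properties as Vecₚ
open import Data.Rational as ℚ using (ℚ; 0ℚ; 1ℚ)
import Data.Rational.Properties as ℚₚ
open import Data.List.Membership.Propositional.Properties using (∈-allFin)
open import Relation.Binary.Definitions using (tri<; tri≈; tri>)
import Data.List as List

-- Cohen-Macaulayness speaks of full intervals only, while the expansion needs rank-selected ones.
-- This dictates an induction over all intervals `(bot , t)` at once: the lower half of a link is an
-- instance with a smaller upper end. Contracting homotopies stand in for homology groups because,
-- given as matrices, they solve the filling problem in a join by a formula and turn the Euler
-- characteristic into a trace; no dimensions or bases of subspaces are needed. The definition of H
-- reads the poset from the bottom, flag numbers read it towards the top. The two meet in one
-- pairing: `J` solves the recursion for 1 - M from the left, an explicit vector `v` solves it from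
-- the right. The weights 1 + x and x come from the recurrence q(d+2) = (1 + x) q(d+1) - x q(d) for
-- q(d) = 1 + ... + x^(d-1). Its negative term joins with the inclusion-exclusion in the flag
-- h-numbers, so that no sign survives. Flag numbers occur in three rings: in ℚ for the trace, in ℤ
-- for the sign, in ℤ[x] for the Chow polynomial. Hence they are defined over any commutative ring
-- and compared through the map from ℤ.

-- Integer coefficients in a commutative ring

module ℤ-Solver {c ℓ} (R : CommutativeRing c ℓ) where
  open CommutativeRing R renaming (refl to ≈-refl; sym to ≈-sym; trans to ≈-trans)
  open Algebra.Properties.Ring ring using (-‿distribˡ-*; -‿distribʳ-*; -‿+-comm; -‿involutive; -0#≈0#)
  open Algebra.Properties.Semiring.Mult semiring using (×-homo-+; ×1-homo-*) renaming (_×_ to _×ᵤ_)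
  open Algebra.Properties.Semiring.Mult.TCOptimised semiring using (×ᵤ≈×) renaming (_×_ to _×′_)
  open Relation.Binary.Reasoning.Setoid setoid

  fromℤᵤ : ℤ → Carrier
  fromℤᵤ (ℤ.+ n) = n ×ᵤ 1#
  fromℤᵤ (ℤ.-[1+ n ]) = - (suc n ×ᵤ 1#)

  -- Unlike fromℤᵤ, sends 1 to 1# definitionally, so solver constants match goals.
  fromℤ : ℤ → Carrier
  fromℤ (ℤ.+ n) = n ×′ 1#
  fromℤ (ℤ.-[1+ n ]) = - (suc n ×′ 1#)

  ᵤ≈ : ∀ i → fromℤ i ≈ fromℤᵤ i
  ᵤ≈ (ℤ.+ n) = ≈-sym (×ᵤ≈× n 1#)
  ᵤ≈ ℤ.-[1+ n ] = -‿cong (≈-sym (×ᵤ≈× (suc n) 1#))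

  ⊖-homo : ∀ m n → fromℤᵤ (m ℤ.⊖ n) ≈ m ×ᵤ 1# + - (n ×ᵤ 1#)
  ⊖-homo zero zero = ≈-sym (-‿inverseʳ 0#)
  ⊖-homo zero (suc n) = ≈-sym (+-identityˡ _)
  ⊖-homo (suc m) zero = ≈-sym (≈-trans (+-congˡ -0#≈0#) (+-identityʳ _))
  ⊖-homo (suc m) (suc n) rewrite ℤₚ.[1+m]⊖[1+n]≡m⊖n m n = begin
    fromℤᵤ (m ℤ.⊖ n) ≈⟨ ⊖-homo m n ⟩
    M + - N ≈⟨ +-congˡ (≈-sym (+-identityˡ _)) ⟩
    M + (0# + - N) ≈⟨ +-congˡ (+-congʳ (≈-sym (-‿inverseʳ 1#))) ⟩
    M + ((1# + - 1#) + - N) ≈⟨ +-congˡ (+-assoc _ _ _) ⟩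
    M + (1# + (- 1# + - N)) ≈⟨ ≈-sym (+-assoc _ _ _) ⟩
    (M + 1#) + (- 1# + - N) ≈⟨ +-cong (+-comm _ _) (-‿+-comm _ _) ⟩
    (1# + M) + - (1# + N) ∎
    where M = m ×ᵤ 1#
          N = n ×ᵤ 1#

  +-homoᵤ : ∀ i j → fromℤᵤ (i ℤ.+ j) ≈ fromℤᵤ i + fromℤᵤ j
  +-homoᵤ (ℤ.+ m) (ℤ.+ n) = ×-homo-+ 1# m n
  +-homoᵤ (ℤ.+ m) ℤ.-[1+ n ] = ⊖-homo m (suc n)
  +-homoᵤ ℤ.-[1+ m ] (ℤ.+ n) = ≈-trans (⊖-homo n (suc m)) (+-comm _ _)
  +-homoᵤ ℤ.-[1+ m ] ℤ.-[1+ n ] = begin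
    - (suc (suc (m ℕ.+ n)) ×ᵤ 1#) ≡⟨ cong (λ k → - (suc k ×ᵤ 1#)) (sym (ℕₚ.+-suc m n)) ⟩
    - ((suc m ℕ.+ suc n) ×ᵤ 1#) ≈⟨ -‿cong (×-homo-+ 1# (suc m) (suc n)) ⟩
    - (suc m ×ᵤ 1# + suc n ×ᵤ 1#) ≈⟨ ≈-sym (-‿+-comm _ _) ⟩
    - (suc m ×ᵤ 1#) + - (suc n ×ᵤ 1#) ∎

  -homoᵤ : ∀ i → fromℤᵤ (ℤ.- i) ≈ - fromℤᵤ i
  -homoᵤ (ℤ.+ zero) = ≈-sym -0#≈0#
  -homoᵤ (ℤ.+ suc n) = ≈-refl
  -homoᵤ ℤ.-[1+ n ] = ≈-sym (-‿involutive _)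

  pos-*-homo : ∀ m j → fromℤᵤ (ℤ.+ m ℤ.* j) ≈ m ×ᵤ 1# * fromℤᵤ j
  pos-*-homo m (ℤ.+ n) rewrite sym (ℤₚ.pos-* m n) = ×1-homo-* m n
  pos-*-homo m ℤ.-[1+ n ] = begin
    fromℤᵤ (ℤ.+ m ℤ.* ℤ.- (ℤ.+ suc n)) ≡⟨ cong fromℤᵤ (sym (ℤₚ.neg-distribʳ-* (ℤ.+ m) (ℤ.+ suc n))) ⟩
    (fromℤᵤ (ℤ.- (ℤ.+ m ℤ.* (ℤ.+ suc n)))) ≈⟨ -homoᵤ (ℤ.+ m ℤ.* (ℤ.+ suc n)) ⟩
    - fromℤᵤ (ℤ.+ m ℤ.* (ℤ.+ suc n)) ≈⟨ -‿cong (pos-*-homo m (ℤ.+ suc n)) ⟩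
    - (m ×ᵤ 1# * suc n ×ᵤ 1#) ≈⟨ -‿distribʳ-* _ _ ⟩
    m ×ᵤ 1# * - (suc n ×ᵤ 1#) ∎

  *-homoᵤ : ∀ i j → fromℤᵤ (i ℤ.* j) ≈ fromℤᵤ i * fromℤᵤ j
  *-homoᵤ (ℤ.+ m) j = pos-*-homo m j
  *-homoᵤ ℤ.-[1+ m ] j = begin
    fromℤᵤ (ℤ.- (ℤ.+ suc m) ℤ.* j) ≡⟨ cong fromℤᵤ (sym (ℤₚ.neg-distribˡ-* (ℤ.+ suc m) j)) ⟩
    fromℤᵤ (ℤ.- (ℤ.+ suc m ℤ.* j)) ≈⟨ -homoᵤ (ℤ.+ suc m ℤ.* j) ⟩
    - fromℤᵤ (ℤ.+ suc m ℤ.* j) ≈⟨ -‿cong (pos-*-homo (suc m) j) ⟩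
    - (suc m ×ᵤ 1# * fromℤᵤ j) ≈⟨ -‿distribˡ-* _ _ ⟩
    - (suc m ×ᵤ 1#) * fromℤᵤ j ∎

  morphism : CommutativeRing.rawRing ℤₚ.+-*-commutativeRing ACR.-Raw-AlmostCommutative⟶ ACR.fromCommutativeRing R
  morphism = record
    { ⟦_⟧ = fromℤ
    ; +-homo = λ i j → ≈-trans (ᵤ≈ (i ℤ.+ j)) (≈-trans (+-homoᵤ i j) (≈-sym (+-cong (ᵤ≈ i) (ᵤ≈ j))))
    ; *-homo = λ i j → ≈-trans (ᵤ≈ (i ℤ.* j)) (≈-trans (*-homoᵤ i j) (≈-sym (*-cong (ᵤ≈ i) (ᵤ≈ j))))
    ; -‿homo = λ i → ≈-trans (ᵤ≈ (ℤ.- i)) (≈-trans (-homoᵤ i) (≈-sym (-‿cong (ᵤ≈ i))))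
    ; 0-homo = ≈-refl
    ; 1-homo = ≈-refl
    }

  weak≟ : ∀ i j → Maybe (fromℤ i ≈ fromℤ j)
  weak≟ i j with i ℤ.≟ j
  ... | yes refl = just ≈-refl
  ... | no _ = nothing

  open ACR._-Raw-AlmostCommutative⟶_ morphism public
    using () renaming (+-homo to fromℤ-+; -‿homo to fromℤ-neg)

  open Algebra.Solver.Ring (CommutativeRing.rawRing ℤₚ.+-*-commutativeRing) (ACR.fromCommutativeRing R) morphism weak≟ public
    using (solve; _:=_; _:+_; _:*_; _:-_; :-_; con)

-- Finite sums with Boolean guards

module Sums {c ℓ} (R : CommutativeRing c ℓ) where
  open CommutativeRing R renaming (refl to ≈-refl; sym to ≈-sym; trans to ≈-trans)
  open Relation.Binary.Reasoning.Setoid setoid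
  open Algebra.Properties.Ring ring using (-0#≈0#)
  open ℤ-Solver R

  infixr 6 _⊳_
  -- Restricting a sum by a guard, instead of filtering its index list, lets double sums over
  -- dependent ranges be exchanged by `∑-swap`; only the guards then have to be compared.
  _⊳_ : Bool → Carrier → Carrier
  b ⊳ a = if b then a else 0#

  ⊳-cong : ∀ b {x y} → (T b → x ≈ y) → b ⊳ x ≈ b ⊳ y
  ⊳-cong true e = e tt
  ⊳-cong false e = ≈-refl

  ⊳-zero : ∀ b {x} → (T b → x ≈ 0#) → b ⊳ x ≈ 0#
  ⊳-zero true e = e tt
  ⊳-zero false e = ≈-refl

  ⊳-+ : ∀ b x y → b ⊳ (x + y) ≈ (b ⊳ x) + (b ⊳ y)
  ⊳-+ true x y = ≈-refl
  ⊳-+ false x y = ≈-sym (+-identityˡ 0#)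

  ⊳-* : ∀ b a x → a * (b ⊳ x) ≈ b ⊳ (a * x)
  ⊳-* true a x = ≈-refl
  ⊳-* false a x = zeroʳ a

  ⊳-*ʳ : ∀ b a x → (b ⊳ x) * a ≈ b ⊳ (x * a)
  ⊳-*ʳ true a x = ≈-refl
  ⊳-*ʳ false a x = zeroˡ a

  ⊳-∧ : ∀ b d x → b ⊳ d ⊳ x ≈ (b ∧ d) ⊳ x
  ⊳-∧ true d x = ≈-refl
  ⊳-∧ false d x = ≈-refl

  -- The form in which index sets are split, for instance by rank: the third guard is the disjoint
  -- union of the first two.
  ⊳-exclusive : ∀ {b₁ b₂ b₃} x → (T b₁ → T b₃) → (T b₂ → T b₃) → (T b₃ → T b₁ ⊎ T b₂) → (T b₁ → T b₂ → ⊥) →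
    (b₁ ⊳ x) + (b₂ ⊳ x) ≈ b₃ ⊳ x
  ⊳-exclusive {true} {true} x _ _ _ d = ⊥-elim (d tt tt)
  ⊳-exclusive {true} {false} {true} x _ _ _ _ = +-identityʳ x
  ⊳-exclusive {true} {false} {false} x i _ _ _ = ⊥-elim (i tt)
  ⊳-exclusive {false} {true} {true} x _ _ _ _ = +-identityˡ x
  ⊳-exclusive {false} {true} {false} x _ i _ _ = ⊥-elim (i tt)
  ⊳-exclusive {false} {false} {true} x _ _ i _ with i tt
  ... | inj₁ ()
  ... | inj₂ ()
  ⊳-exclusive {false} {false} {false} x _ _ _ _ = +-identityˡ 0#

  module _ {i} {I : Set i} where
    ∑ : List I → (I → Carrier) → Carrier
    ∑ [] f = 0#
    ∑ (x ∷ xs) f = f x + ∑ xs f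

    ∑-congᴬ : ∀ {p} {P : I → Set p} {xs} → All P xs → {f g : I → Carrier} → (∀ x → P x → f x ≈ g x) → ∑ xs f ≈ ∑ xs g
    ∑-congᴬ [] e = ≈-refl
    ∑-congᴬ (p ∷ ps) e = +-cong (e _ p) (∑-congᴬ ps e)

    ∑-cong : ∀ xs {f g : I → Carrier} → (∀ x → f x ≈ g x) → ∑ xs f ≈ ∑ xs g
    ∑-cong [] e = ≈-refl
    ∑-cong (x ∷ xs) e = +-cong (e x) (∑-cong xs e)

    ∑-zero : ∀ xs → ∑ xs (λ _ → 0#) ≈ 0#
    ∑-zero [] = ≈-refl
    ∑-zero (x ∷ xs) = ≈-trans (+-identityˡ _) (∑-zero xs)

    ∑-+ : ∀ xs f g → ∑ xs (λ x → f x + g x) ≈ ∑ xs f + ∑ xs g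
    ∑-+ [] f g = ≈-sym (+-identityˡ 0#)
    ∑-+ (x ∷ xs) f g = ≈-trans (+-congˡ (∑-+ xs f g))
      (solve 4 (λ a b p q → (a :+ b) :+ (p :+ q) := (a :+ p) :+ (b :+ q)) ≈-refl (f x) (g x) (∑ xs f) (∑ xs g))

    ∑-*ˡ : ∀ xs a f → ∑ xs (λ x → a * f x) ≈ a * ∑ xs f
    ∑-*ˡ [] a f = ≈-sym (zeroʳ a)
    ∑-*ˡ (x ∷ xs) a f = ≈-trans (+-congˡ (∑-*ˡ xs a f)) (≈-sym (distribˡ a _ _))

    ∑-*ʳ : ∀ xs a f → ∑ xs (λ x → f x * a) ≈ ∑ xs f * a
    ∑-*ʳ [] a f = ≈-sym (zeroˡ a)
    ∑-*ʳ (x ∷ xs) a f = ≈-trans (+-congˡ (∑-*ʳ xs a f)) (≈-sym (distribʳ a _ _))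

    ∑-neg : ∀ xs f → ∑ xs (λ x → - f x) ≈ - ∑ xs f
    ∑-neg [] f = ≈-sym -0#≈0#
    ∑-neg (x ∷ xs) f = ≈-trans (+-congˡ (∑-neg xs f))
      (solve 2 (λ a b → :- a :+ :- b := :- (a :+ b)) ≈-refl (f x) (∑ xs f))

    ∑-++ : ∀ xs ys f → ∑ (xs ++ ys) f ≈ ∑ xs f + ∑ ys f
    ∑-++ [] ys f = ≈-sym (+-identityˡ _)
    ∑-++ (x ∷ xs) ys f = ≈-trans (+-congˡ (∑-++ xs ys f)) (≈-sym (+-assoc _ _ _))

    ∑-⊳ : ∀ xs b f → ∑ xs (λ x → b ⊳ f x) ≈ b ⊳ ∑ xs f
    ∑-⊳ xs true f = ≈-refl
    ∑-⊳ xs false f = ∑-zero xs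

  module _ {i j} {I : Set i} {J : Set j} where
    ∑-swap : ∀ (xs : List I) (ys : List J) (f : I → J → Carrier) → ∑ xs (λ x → ∑ ys (f x)) ≈ ∑ ys (λ y → ∑ xs (λ x → f x y))
    ∑-swap [] ys f = ≈-sym (∑-zero ys)
    ∑-swap (x ∷ xs) ys f = ≈-trans (+-congˡ (∑-swap xs ys f)) (≈-sym (∑-+ ys (f x) _))

    ∑-map : ∀ (xs : List I) (g : I → J) (f : J → Carrier) → ∑ (map g xs) f ≈ ∑ xs (f ∘ g)
    ∑-map [] g f = ≈-refl
    ∑-map (x ∷ xs) g f = +-congˡ (∑-map xs g f)

    ∑-concatMap : ∀ (xs : List I) (g : I → List J) (f : J → Carrier) → ∑ (concatMap g xs) f ≈ ∑ xs (λ x → ∑ (g x) f)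
    ∑-concatMap [] g f = ≈-refl
    ∑-concatMap (x ∷ xs) g f = ≈-trans (∑-++ (g x) (concatMap g xs) f) (+-congˡ (∑-concatMap xs g f))

  ∑-allFin-suc : ∀ n (f : Fin (suc n) → Carrier) → ∑ (allFin (suc n)) f ≈ f Fin.zero + ∑ (allFin n) (f ∘ Fin.suc)
  ∑-allFin-suc n f = +-congˡ (≈-trans (reflexive (cong (λ xs → ∑ xs f) (sym (Listₚ.map-tabulate id Fin.suc))))
                                      (∑-map (allFin n) Fin.suc f))

  ∑-pick : ∀ {n} (a : Fin n) (f : Fin n → Carrier) → ∑ (allFin n) (λ x → ⌊ x Fin.≟ a ⌋ ⊳ f x) ≈ f a
  ∑-pick {suc n} Fin.zero f = begin
    ∑ (allFin (suc n)) (λ x → ⌊ x Fin.≟ Fin.zero ⌋ ⊳ f x) ≈⟨ ∑-allFin-suc n _ ⟩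
    f Fin.zero + ∑ (allFin n) (λ x → 0#) ≈⟨ +-congˡ (∑-zero (allFin n)) ⟩
    f Fin.zero + 0# ≈⟨ +-identityʳ _ ⟩
    f Fin.zero ∎
  ∑-pick {suc n} (Fin.suc a) f = begin
    ∑ (allFin (suc n)) (λ x → ⌊ x Fin.≟ Fin.suc a ⌋ ⊳ f x) ≈⟨ ∑-allFin-suc n _ ⟩
    0# + ∑ (allFin n) (λ x → ⌊ Fin.suc x Fin.≟ Fin.suc a ⌋ ⊳ f (Fin.suc x)) ≈⟨ +-identityˡ _ ⟩
    ∑ (allFin n) (λ x → ⌊ Fin.suc x Fin.≟ Fin.suc a ⌋ ⊳ f (Fin.suc x)) ≈⟨ ∑-cong (allFin n) (λ x → reflexive (cong (_⊳ f (Fin.suc x)) (suc-≟ x a))) ⟩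
    ∑ (allFin n) (λ x → ⌊ x Fin.≟ a ⌋ ⊳ f (Fin.suc x)) ≈⟨ ∑-pick a (f ∘ Fin.suc) ⟩
    f (Fin.suc a) ∎
    where
    suc-≟ : ∀ {n} (x a : Fin n) → ⌊ Fin.suc x Fin.≟ Fin.suc a ⌋ ≡ ⌊ x Fin.≟ a ⌋
    suc-≟ x a with x Fin.≟ a
    ... | yes refl = refl
    ... | no _ = refl

-- Boolean predicates and chains of a finite strict order

T-∧⁻ : ∀ {a b} → T (a ∧ b) → T a × T b
T-∧⁻ {true} {true} _ = tt , tt

T-∧⁺ : ∀ {a b} → T a → T b → T (a ∧ b)
T-∧⁺ {true} {true} _ _ = tt

T-ext : ∀ {a b} → (T a → T b) → (T b → T a) → a ≡ b
T-ext {true} {true} f g = refl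
T-ext {true} {false} f g = ⊥-elim (f tt)
T-ext {false} {true} f g = ⊥-elim (g tt)
T-ext {false} {false} f g = refl

-- Chains of a finite strict order with vertices in A between s and t are lists; a chain group
-- element is a function on lists of which only the values on Valid lists matter.
module Chains {k} (lt : Fin k → Fin k → Bool) where

  between : (Fin k → Bool) → Fin k → Fin k → Fin k → Bool
  between A s t x = lt s x ∧ lt x t ∧ A x

  -- The lower end is the last index because it moves along the list while `t` stays fixed: the tail
  -- of a chain is a chain of the interval above its head.
  Valid : (Fin k → Bool) → Fin k → Fin k → List (Fin k) → Set
  Valid A t s [] = ⊤
  Valid A t s (a ∷ σ) = T (between A s t a) × Valid A t a σ

  chains : (Fin k → Bool) → Fin k → ℕ → Fin k → List (List (Fin k))
  chains A t zero s = [] ∷ []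
  chains A t (suc j) s =
    concatMap (λ x → if between A s t x then map (x ∷_) (chains A t j x) else []) (allFin k)

  -- Soundness of the enumeration; that every valid chain occurs with multiplicity one is expressed
  -- through sums in `δ-expand`.
  chains-valid : ∀ A t j s → All (λ σ → Valid A t s σ × length σ ≡ j) (chains A t j s)
  chains-valid A t zero s = (tt , refl) ∷ []
  chains-valid A t (suc j) s = go (allFin k)
    where
    step : ∀ x b → (T b → T (between A s t x)) →
           All (λ σ → Valid A t s σ × length σ ≡ suc j) (if b then map (x ∷_) (chains A t j x) else [])
    step x true p = Allₚ.map⁺ (All.map (λ (v , e) → (p tt , v) , cong suc e) (chains-valid A t j x))
    step x false p = []
    go : ∀ xs → All (λ σ → Valid A t s σ × length σ ≡ suc j)
                  (concatMap (λ x → if between A s t x then map (x ∷_) (chains A t j x) else []) xs)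
    go [] = []
    go (x ∷ xs) = Allₚ.++⁺ (step x (between A s t x) id) (go xs)

  Transitive : Set
  Transitive = ∀ {a b c} → T (lt a b) → T (lt b c) → T (lt a c)

-- The chain complex of a selected set of elements

module ChainComplex {r} {R : Set r} {plus times : R → R → R} {neg : R → R} {0# 1# : R}
    (isCommutativeRing : IsCommutativeRing _≡_ plus times neg 0# 1#)
    {k} (lt : Fin k → Fin k → Bool) (lt-trans : Chains.Transitive lt) where

  ring : CommutativeRing _ _
  ring = record { isCommutativeRing = isCommutativeRing }
  open CommutativeRing ring using (_+_; _*_; -_; _-_; +-identityʳ; zeroʳ; -‿inverseʳ; *-identityʳ)
  open Sums ring
  open ℤ-Solver ring
  open Chains lt public
  open ≡-Reasoning

  Chain : Set
  Chain = List (Fin k)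

  S : (Fin k → Bool) → Fin k → Fin k → (Fin k → R) → R
  S A s t f = ∑ (allFin k) (λ x → between A s t x ⊳ f x)

  -- The simplicial boundary on coefficients: D c σ is the signed sum of c over the chains obtained
  -- by inserting one vertex into σ.
  D : (Fin k → Bool) → Fin k → Fin k → (Chain → R) → Chain → R
  D A t s c [] = S A s t (λ x → c (x ∷ []))
  D A t s c (a ∷ σ) = S A s a (λ x → c (x ∷ a ∷ σ)) - D A t a (λ σ′ → c (a ∷ σ′)) σ

  δ : Chain → Chain → R
  δ [] [] = 1#
  δ [] (_ ∷ _) = 0#
  δ (_ ∷ _) [] = 0#
  δ (x ∷ τ) (a ∷ σ) = ⌊ x Fin.≟ a ⌋ ⊳ δ τ σ

  module _ {A : Fin k → Bool} where

    S-cong : ∀ {s t f g} → (∀ x → T (between A s t x) → f x ≡ g x) → S A s t f ≡ S A s t g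
    S-cong {s} {t} e = ∑-cong (allFin k) (λ x → ⊳-cong (between A s t x) (e x))

    S-zero : ∀ {s t f} → (∀ x → T (between A s t x) → f x ≡ 0#) → S A s t f ≡ 0#
    S-zero {s} {t} e = trans (∑-cong (allFin k) (λ x → ⊳-zero (between A s t x) (e x))) (∑-zero (allFin k))

    S-+ : ∀ {s t} f g → S A s t (λ x → f x + g x) ≡ S A s t f + S A s t g
    S-+ {s} {t} f g = trans (∑-cong (allFin k) (λ x → ⊳-+ (between A s t x) (f x) (g x))) (∑-+ (allFin k) _ _)

    S-* : ∀ {s t} a f → S A s t (λ x → a * f x) ≡ a * S A s t f
    S-* {s} {t} a f = trans (∑-cong (allFin k) (λ x → sym (⊳-* (between A s t x) a (f x)))) (∑-*ˡ (allFin k) a _)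

    neg-as-* : ∀ x → - x ≡ (- 1#) * x
    neg-as-* = solve 1 (λ x → :- x := (:- con ℤ.1ℤ) :* x) refl

    S-neg : ∀ {s t} f → S A s t (λ x → - f x) ≡ - S A s t f
    S-neg f = trans (S-cong (λ x _ → neg-as-* (f x))) (trans (S-* (- 1#) f) (sym (neg-as-* _)))

    S-- : ∀ {s t} f g → S A s t (λ x → f x - g x) ≡ S A s t f - S A s t g
    S-- f g = trans (S-+ f _) (cong (S A _ _ f +_) (S-neg g))

    ∑-chains : ∀ {t} j s f → ∑ (chains A t (suc j) s) f ≡ S A s t (λ x → ∑ (chains A t j x) (λ σ → f (x ∷ σ)))
    ∑-chains {t} j s f = trans (∑-concatMap (allFin k) _ f) (∑-cong (allFin k) (λ x → guard x (between A s t x)))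
      where
      guard : ∀ x b → ∑ (if b then map (x ∷_) (chains A t j x) else []) f ≡ b ⊳ ∑ (chains A t j x) (λ σ → f (x ∷ σ))
      guard x true = ∑-map (chains A t j x) (x ∷_) f
      guard x false = refl

    ∑-chains-cong : ∀ {t} j s {f g} → (∀ σ → Valid A t s σ → length σ ≡ j → f σ ≡ g σ) →
                    ∑ (chains A t j s) f ≡ ∑ (chains A t j s) g
    ∑-chains-cong {t} j s e = ∑-congᴬ (chains-valid A t j s) (λ σ (v , l) → e σ v l)

    ∑-chains-zero : ∀ {t} j s {f} → (∀ σ → Valid A t s σ → length σ ≡ j → f σ ≡ 0#) →
                    ∑ (chains A t j s) f ≡ 0#
    ∑-chains-zero {t} j s e = trans (∑-chains-cong j s e) (∑-zero (chains A t j s))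

    module _ {t : Fin k} where

      D-cong : ∀ {s c c′} σ → Valid A t s σ →
               (∀ τ → Valid A t s τ → length τ ≡ suc (length σ) → c τ ≡ c′ τ) → D A t s c σ ≡ D A t s c′ σ
      D-cong [] v e = S-cong (λ x p → e (x ∷ []) (p , tt) refl)
      D-cong {s} (a ∷ σ) (p , v) e = cong₂ _-_
        (S-cong (λ x q → let (sx , q′) = T-∧⁻ {lt s x} q ; (xa , Ax) = T-∧⁻ {lt x a} q′
                             (_ , p′) = T-∧⁻ {lt s a} p ; (at , Aa) = T-∧⁻ {lt a t} p′ in
                  e (x ∷ a ∷ σ) (T-∧⁺ sx (T-∧⁺ (lt-trans xa at) Ax) , T-∧⁺ xa (T-∧⁺ at Aa) , v) refl))
        (D-cong σ v (λ τ w l → e (a ∷ τ) (p , w) (cong suc l)))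

      D-ext : ∀ {s c c′} σ → (∀ τ → c τ ≡ c′ τ) → D A t s c σ ≡ D A t s c′ σ
      D-ext [] e = S-cong (λ x _ → e _)
      D-ext (a ∷ σ) e = cong₂ _-_ (S-cong (λ x _ → e _)) (D-ext σ (λ τ → e (a ∷ τ)))

      D-* : ∀ {s} a c σ → D A t s (λ τ → a * c τ) σ ≡ a * D A t s c σ
      D-* a c [] = S-* a _
      D-* {s} a c (x ∷ σ) = trans (cong₂ _-_ (S-* a _) (D-* a _ σ))
        (solve 3 (λ a p q → a :* p :- a :* q := a :* (p :- q)) refl a _ _)

      D-+ : ∀ {s} c c′ σ → D A t s (λ τ → c τ + c′ τ) σ ≡ D A t s c σ + D A t s c′ σ
      D-+ c c′ [] = S-+ _ _
      D-+ {s} c c′ (x ∷ σ) = trans (cong₂ _-_ (S-+ _ _) (D-+ _ _ σ))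
        (solve 4 (λ p q p′ q′ → (p :+ p′) :- (q :+ q′) := (p :- q) :+ (p′ :- q′)) refl _ _ _ _)

      D-neg : ∀ {s} c σ → D A t s (λ τ → - c τ) σ ≡ - D A t s c σ
      D-neg c σ = trans (D-ext σ (λ τ → neg-as-* (c τ))) (trans (D-* (- 1#) c σ) (sym (neg-as-* _)))

      D-- : ∀ {s} c c′ σ → D A t s (λ τ → c τ - c′ τ) σ ≡ D A t s c σ - D A t s c′ σ
      D-- c c′ σ = trans (D-+ c _ σ) (cong (D A t _ c σ +_) (D-neg c′ σ))

      D-0 : ∀ {s} σ → D A t s (λ τ → 0#) σ ≡ 0#
      D-0 [] = S-zero (λ _ _ → refl)
      D-0 (a ∷ σ) = trans (cong₂ _-_ (S-zero (λ _ _ → refl)) (D-0 σ)) (-‿inverseʳ 0#)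

      D-zero : ∀ {s c} σ → Valid A t s σ →
               (∀ τ → Valid A t s τ → length τ ≡ suc (length σ) → c τ ≡ 0#) → D A t s c σ ≡ 0#
      D-zero σ v e = trans (D-cong σ v e) (D-0 σ)

      D-∑ : ∀ {i} {I : Set i} {s} (xs : List I) (f : I → Chain → R) σ →
            D A t s (λ τ → ∑ xs (λ i → f i τ)) σ ≡ ∑ xs (λ i → D A t s (f i) σ)
      D-∑ [] f σ = D-0 σ
      D-∑ (i ∷ xs) f σ = trans (D-+ (f i) _ σ) (cong (D A t _ (f i) σ +_) (D-∑ xs f σ))

      D-∑* : ∀ {i} {I : Set i} {s} (xs : List I) (a : I → R) (f : I → Chain → R) σ →
             D A t s (λ τ → ∑ xs (λ i → a i * f i τ)) σ ≡ ∑ xs (λ i → a i * D A t s (f i) σ)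
      D-∑* xs a f σ = trans (D-∑ xs _ σ) (∑-cong xs (λ i → D-* (a i) (f i) σ))

      D-S : ∀ {s u v} (f : Fin k → Chain → R) σ →
            D A t s (λ τ → S A u v (λ x → f x τ)) σ ≡ S A u v (λ x → D A t s (f x) σ)
      D-S {s} {u} {v} f σ = trans (D-∑ (allFin k) _ σ) (∑-cong (allFin k) (λ x → guard x (between A u v x)))
        where
        guard : ∀ x b → D A t s (λ τ → b ⊳ f x τ) σ ≡ b ⊳ D A t s (f x) σ
        guard x true = refl
        guard x false = D-0 σ

    -- Both sides run over s < y < x < t with `x` and `y` in `A`; transitivity supplies the
    -- comparisons that each nesting leaves implicit.
    S-swap : ∀ s t (g : Fin k → Fin k → R) →
             S A s t (λ x → S A s x (λ y → g y x)) ≡ S A s t (λ y → S A y t (λ x → g y x))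
    S-swap s t g = begin
      S A s t (λ x → S A s x (λ y → g y x))
        ≡⟨ ∑-cong (allFin k) (λ x → trans (sym (∑-⊳ (allFin k) (between A s t x) _)) (∑-cong (allFin k) (λ y → ⊳-∧ (between A s t x) _ _))) ⟩
      ∑ (allFin k) (λ x → ∑ (allFin k) (λ y → (between A s t x ∧ between A s x y) ⊳ g y x))
        ≡⟨ ∑-swap (allFin k) (allFin k) _ ⟩
      ∑ (allFin k) (λ y → ∑ (allFin k) (λ x → (between A s t x ∧ between A s x y) ⊳ g y x))
        ≡⟨ ∑-cong (allFin k) (λ y → ∑-cong (allFin k) (λ x → cong (_⊳ g y x) (T-ext (to x y) (from x y)))) ⟩
      ∑ (allFin k) (λ y → ∑ (allFin k) (λ x → (between A s t y ∧ between A y t x) ⊳ g y x))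
        ≡⟨ ∑-cong (allFin k) (λ y → trans (∑-cong (allFin k) (λ x → sym (⊳-∧ (between A s t y) _ _))) (∑-⊳ (allFin k) (between A s t y) _)) ⟩
      S A s t (λ y → S A y t (λ x → g y x)) ∎
      where
      to : ∀ x y → T (between A s t x ∧ between A s x y) → T (between A s t y ∧ between A y t x)
      to x y p = let (p₁ , p₂) = T-∧⁻ {between A s t x} p
                     (sx , p₃) = T-∧⁻ {lt s x} p₁ ; (xt , Ax) = T-∧⁻ {lt x t} p₃
                     (sy , p₄) = T-∧⁻ {lt s y} p₂ ; (yx , Ay) = T-∧⁻ {lt y x} p₄
                 in T-∧⁺ (T-∧⁺ sy (T-∧⁺ (lt-trans yx xt) Ay)) (T-∧⁺ yx (T-∧⁺ xt Ax))
      from : ∀ x y → T (between A s t y ∧ between A y t x) → T (between A s t x ∧ between A s x y)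
      from x y p = let (p₁ , p₂) = T-∧⁻ {between A s t y} p
                       (sy , p₃) = T-∧⁻ {lt s y} p₁ ; (yt , Ay) = T-∧⁻ {lt y t} p₃
                       (yx , p₄) = T-∧⁻ {lt y x} p₂ ; (xt , Ax) = T-∧⁻ {lt x t} p₄
                   in T-∧⁺ (T-∧⁺ (lt-trans sy yx) (T-∧⁺ xt Ax)) (T-∧⁺ sy (T-∧⁺ yx Ay))

    -- Two new vertices can enter in either order, with opposite signs. Relative to the head `a`,
    -- `P` collects the pairs lying below it and `Q` the pairs with one vertex on each side; pairs
    -- above it cancel by induction.
    D² : ∀ {t} s c σ → D A t s (D A t s c) σ ≡ 0#
    D² {t} s c [] = begin
      S A s t (λ x → S A s x (λ y → c (y ∷ x ∷ [])) - S A x t (λ y → c (x ∷ y ∷ [])))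
        ≡⟨ S-- _ _ ⟩
      S A s t (λ x → S A s x (λ y → c (y ∷ x ∷ []))) - S A s t (λ x → S A x t (λ y → c (x ∷ y ∷ [])))
        ≡⟨ cong (_- S A s t (λ x → S A x t (λ y → c (x ∷ y ∷ [])))) (S-swap s t (λ y x → c (y ∷ x ∷ []))) ⟩
      _ ≡⟨ -‿inverseʳ _ ⟩
      0# ∎
    D² {t} s c (a ∷ σ) = begin
      S A s a (λ x → S A s x (λ y → c (y ∷ x ∷ a ∷ σ)) - (S A x a (λ y → c (x ∷ y ∷ a ∷ σ)) - D A t a (λ τ → c (x ∷ a ∷ τ)) σ))
        - D A t a (λ τ → S A s a (λ x → c (x ∷ a ∷ τ)) - D A t a (λ τ → c (a ∷ τ)) τ) σ
        ≡⟨ cong₂ _-_ (trans (S-- _ _) (cong₂ _-_ (S-swap s a (λ y x → c (y ∷ x ∷ a ∷ σ))) (S-- _ _)))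
                     (trans (D-- _ _ σ) (cong₂ _-_ (D-S _ σ) (D² a (λ τ → c (a ∷ τ)) σ))) ⟩
      (P - (P - Q)) - (Q - 0#)
        ≡⟨ solve 2 (λ p q → (p :- (p :- q)) :- (q :- con (ℤ.0ℤ)) := con ℤ.0ℤ) refl P Q ⟩
      0# ∎
      where
      P = S A s a (λ y → S A y a (λ x → c (y ∷ x ∷ a ∷ σ)))
      Q = S A s a (λ x → D A t a (λ τ → c (x ∷ a ∷ τ)) σ)

    -- Every chain group element is the combination of the basis chains `δ τ` with its own values as
    -- coefficients. All later extensions by linearity rest on this.
    δ-expand : ∀ {t} s c σ → Valid A t s σ → ∑ (chains A t (length σ) s) (λ τ → c τ * δ τ σ) ≡ c σ
    δ-expand s c [] v = trans (+-identityʳ _) (*-identityʳ _)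
    δ-expand {t} s c (a ∷ σ) (p , v) = begin
      ∑ (chains A t (suc (length σ)) s) (λ τ → c τ * δ τ (a ∷ σ)) ≡⟨ ∑-chains (length σ) s _ ⟩
      S A s t (λ x → ∑ (chains A t (length σ) x) (λ τ → c (x ∷ τ) * (⌊ x Fin.≟ a ⌋ ⊳ δ τ σ)))
        ≡⟨ ∑-cong (allFin k) (λ x → reduce x) ⟩
      ∑ (allFin k) (λ x → ⌊ x Fin.≟ a ⌋ ⊳ ∑ (chains A t (length σ) x) (λ τ → c (x ∷ τ) * δ τ σ)) ≡⟨ ∑-pick a _ ⟩
      ∑ (chains A t (length σ) a) (λ τ → c (a ∷ τ) * δ τ σ) ≡⟨ δ-expand a (λ τ → c (a ∷ τ)) σ v ⟩
      c (a ∷ σ) ∎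
      where
      guard : ∀ b → T b → ∀ x → b ⊳ x ≡ x
      guard true _ x = refl
      reduce : ∀ x → between A s t x ⊳ ∑ (chains A t (length σ) x) (λ τ → c (x ∷ τ) * (⌊ x Fin.≟ a ⌋ ⊳ δ τ σ))
                   ≡ ⌊ x Fin.≟ a ⌋ ⊳ ∑ (chains A t (length σ) x) (λ τ → c (x ∷ τ) * δ τ σ)
      reduce x with x Fin.≟ a
      ... | yes refl = guard _ p _
      ... | no _ = ⊳-zero (between A s t x) (λ _ → trans (∑-cong (chains A t (length σ) x) (λ τ → zeroʳ _)) (∑-zero (chains A t (length σ) x)))

-- Acyclicity and contracting homotopies

module Acyclicity {r} {R : Set r} {plus times : R → R → R} {neg : R → R} {0# 1# : R}
    (isCommutativeRing : IsCommutativeRing _≡_ plus times neg 0# 1#)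
    {k} (lt : Fin k → Fin k → Bool) (lt-trans : Chains.Transitive lt) where

  open ChainComplex isCommutativeRing lt lt-trans
  open CommutativeRing ring using (_+_; _*_; -_; _-_; +-identityʳ; zeroˡ; zeroʳ; -‿inverseʳ; *-assoc; *-comm)
  open Sums ring
  open ℤ-Solver ring
  open ≡-Reasoning

  -- Degrees count vertices, one more than the dimension. For `j` = 0 the cycle condition is
  -- vacuous, and filling means exactness of the augmented complex at the empty chain.
  Vanishing : (Fin k → Bool) → Fin k → Fin k → ℕ → Set r
  Vanishing A s t p = ∀ j → j < p → ∀ c →
    (∀ σ → Valid A t s σ → suc (length σ) ≡ j → D A t s c σ ≡ 0#) →
    ∃[ d ] (∀ σ → Valid A t s σ → length σ ≡ j → D A t s d σ ≡ c σ)

  -- The operator raising degree by one whose matrix is b.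
  h : (Fin k → Bool) → Fin k → Fin k → (Chain → Chain → R) → (Chain → R) → Chain → R
  h A t s b c [] = 0#
  h A t s b c (a ∷ σ) = ∑ (chains A t (length σ) s) (λ τ → c τ * b τ (a ∷ σ))

  IsHomotopy : (Fin k → Bool) → Fin k → Fin k → ℕ → (Chain → Chain → R) → Set r
  IsHomotopy A s t p b = ∀ c σ → Valid A t s σ → length σ < p →
    D A t s (h A t s b c) σ + h A t s b (D A t s c) σ ≡ c σ

  module _ {A : Fin k → Bool} {s t : Fin k} where

    h-cong : ∀ {b c c′} σ → (∀ τ → Valid A t s τ → suc (length τ) ≡ length σ → c τ ≡ c′ τ) →
             h A t s b c σ ≡ h A t s b c′ σ
    h-cong [] e = refl
    h-cong {b} (a ∷ σ) e = ∑-chains-cong (length σ) s (λ τ v l → cong (_* b τ (a ∷ σ)) (e τ v (cong suc l)))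

    h-zero : ∀ {b c} σ → (∀ τ → Valid A t s τ → suc (length τ) ≡ length σ → c τ ≡ 0#) →
             h A t s b c σ ≡ 0#
    h-zero [] e = refl
    h-zero {b} (a ∷ σ) e = ∑-chains-zero (length σ) s
      (λ τ v l → trans (cong (_* b τ (a ∷ σ)) (e τ v (cong suc l))) (zeroˡ _))

    h-∑* : ∀ {b} {i} {I : Set i} (xs : List I) (a : I → R) (f : I → Chain → R) σ →
           h A t s b (λ τ → ∑ xs (λ i → a i * f i τ)) σ ≡ ∑ xs (λ i → a i * h A t s b (f i) σ)
    h-∑* xs a f [] = sym (trans (∑-cong xs (λ i → zeroʳ _)) (∑-zero xs))
    h-∑* {b} xs a f (x ∷ σ) = begin
      ∑ ts (λ τ → ∑ xs (λ i → a i * f i τ) * b τ (x ∷ σ))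
        ≡⟨ ∑-cong ts (λ τ → trans (sym (∑-*ʳ xs _ _)) (∑-cong xs (λ i → *-assoc _ _ _))) ⟩
      ∑ ts (λ τ → ∑ xs (λ i → a i * (f i τ * b τ (x ∷ σ)))) ≡⟨ ∑-swap ts xs _ ⟩
      ∑ xs (λ i → ∑ ts (λ τ → a i * (f i τ * b τ (x ∷ σ)))) ≡⟨ ∑-cong xs (λ i → ∑-*ˡ ts _ _) ⟩
      ∑ xs (λ i → a i * ∑ ts (λ τ → f i τ * b τ (x ∷ σ))) ∎
      where ts = chains A t (length σ) s

    h-* : ∀ {b} a c σ → h A t s b (λ τ → a * c τ) σ ≡ a * h A t s b c σ
    h-* a c [] = sym (zeroʳ a)
    h-* a c (x ∷ σ) = trans (∑-cong ts (λ τ → *-assoc _ _ _)) (∑-*ˡ ts a _)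
      where ts = chains A t (length σ) s

    -- The operators act on different arguments of `l`, so only finite sums are exchanged. No sign
    -- appears here; the signs of the join live in `Dⱼ`.
    D-h-comm : ∀ {b A′ s′ t′} (l : Chain → Chain → R) σ ρ →
               D A′ t′ s′ (λ ρ′ → h A t s b (λ τ → l τ ρ′) σ) ρ ≡ h A t s b (λ τ → D A′ t′ s′ (l τ) ρ) σ
    D-h-comm l [] ρ = D-0 ρ
    D-h-comm {b} {A′} {s′} {t′} l (a ∷ σ) ρ = begin
      D A′ t′ s′ (λ ρ′ → ∑ ts (λ τ → l τ ρ′ * b τ (a ∷ σ))) ρ ≡⟨ D-ext ρ (λ ρ′ → ∑-cong ts (λ τ → *-comm _ _)) ⟩
      D A′ t′ s′ (λ ρ′ → ∑ ts (λ τ → b τ (a ∷ σ) * l τ ρ′)) ρ ≡⟨ D-∑* ts _ l ρ ⟩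
      ∑ ts (λ τ → b τ (a ∷ σ) * D A′ t′ s′ (l τ) ρ) ≡⟨ ∑-cong ts (λ τ → *-comm _ _) ⟩
      ∑ ts (λ τ → D A′ t′ s′ (l τ) ρ * b τ (a ∷ σ)) ∎
      where ts = chains A t (length σ) s

    -- The matrix of 1 - h ∂, as the image of the basis chain `τ` evaluated at `σ`: what a homotopy
    -- misses in the first degree it does not reach.
    defect : (Chain → Chain → R) → Chain → Chain → R
    defect b τ σ = δ τ σ - h A t s b (D A t s (δ τ)) σ

    -- The homotopy identity, applied to the boundary of `τ` one degree lower, gives ∂ h ∂ = ∂ - h ∂
    -- ∂ = ∂.
    defect-cycle : ∀ {p b} → IsHomotopy A s t p b → ∀ τ σ → Valid A t s σ → suc (length σ) ≡ p →
                   D A t s (defect b τ) σ ≡ 0#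
    defect-cycle {b = b} H τ σ v refl = begin
      Dₛ (defect b τ) σ ≡⟨ D-- _ _ σ ⟩
      Dₛ (δ τ) σ - X ≡⟨ cong (_- X) (sym (H (Dₛ (δ τ)) σ v ℕₚ.≤-refl)) ⟩
      (X + h A t s b (Dₛ (Dₛ (δ τ))) σ) - X
        ≡⟨ cong (λ z → (X + z) - X) (h-zero σ (λ τ′ _ _ → D² s (δ τ) τ′)) ⟩
      (X + 0#) - X ≡⟨ trans (cong (_- X) (+-identityʳ _)) (-‿inverseʳ _) ⟩
      0# ∎
      where
      Dₛ = D A t s
      X = Dₛ (h A t s b (Dₛ (δ τ))) σ

    hD-expand : ∀ b c σ → Valid A t s σ →
      ∑ (chains A t (length σ) s) (λ τ → c τ * h A t s b (D A t s (δ τ)) σ) ≡ h A t s b (D A t s c) σ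
    hD-expand b c σ v = begin
      ∑ ts (λ τ → c τ * h A t s b (D A t s (δ τ)) σ) ≡⟨ sym (h-∑* ts c _ σ) ⟩
      h A t s b (λ τ′ → ∑ ts (λ τ → c τ * D A t s (δ τ) τ′)) σ
        ≡⟨ h-cong σ (λ τ′ w e → trans (sym (D-∑* ts c δ τ′))
             (D-cong τ′ w (λ τ″ w′ e′ → trans (cong (λ m → ∑ (chains A t m s) (λ τ → c τ * δ τ τ″)) (sym (trans e′ e))) (δ-expand s c τ″ w′)))) ⟩
      h A t s b (D A t s c) σ ∎
      where ts = chains A t (length σ) s

    defect-expand : ∀ b c σ → Valid A t s σ →
      ∑ (chains A t (length σ) s) (λ τ → c τ * defect b τ σ) ≡ c σ - h A t s b (D A t s c) σ
    defect-expand b c σ v = begin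
      ∑ ts (λ τ → c τ * defect b τ σ)
        ≡⟨ ∑-cong ts (λ τ → solve 3 (λ x y z → x :* (y :- z) := x :* y :+ :- (x :* z)) refl (c τ) (δ τ σ) _) ⟩
      ∑ ts (λ τ → c τ * δ τ σ + - (c τ * h A t s b (D A t s (δ τ)) σ)) ≡⟨ ∑-+ ts _ _ ⟩
      ∑ ts (λ τ → c τ * δ τ σ) + ∑ ts (λ τ → - (c τ * h A t s b (D A t s (δ τ)) σ))
        ≡⟨ cong₂ _+_ (δ-expand s c σ v) (trans (∑-neg ts _) (cong -_ (hD-expand b c σ v))) ⟩
      c σ - h A t s b (D A t s c) σ ∎
      where ts = chains A t (length σ) s

    -- Filling the basis chains one degree at a time and extending linearly.
    vanishing⇒homotopy : ∀ p → Vanishing A s t p → ∃[ b ] IsHomotopy A s t p b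
    vanishing⇒homotopy zero van = (λ _ _ → 0#) , λ _ _ _ ()
    vanishing⇒homotopy (suc p) van with vanishing⇒homotopy p (λ j j<p → van j (ℕₚ.m<n⇒m<1+n j<p))
    ... | b , H = b′ , H′
      where
      Dₛ = D A t s

      fill : ∀ τ → ∃[ d ] (∀ σ → Valid A t s σ → length σ ≡ p → Dₛ d σ ≡ defect b τ σ)
      fill τ = van p ℕₚ.≤-refl (defect b τ) (defect-cycle H τ)

      choose : ∀ {q} → Dec q → Chain → Chain → R
      choose {q} (yes _) τ = proj₁ (fill τ)
      choose (no _) τ = b τ

      -- Only the images of chains with exactly `p` vertices change, so the values of `h` on chains
      -- with at most `p` vertices survive.
      b′ : Chain → Chain → R
      b′ τ = choose (length τ ℕ.≟ p) τ

      b′-top : ∀ τ → length τ ≡ p → b′ τ ≡ proj₁ (fill τ)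
      b′-top τ e with length τ ℕ.≟ p
      ... | yes _ = refl
      ... | no ne = ⊥-elim (ne e)

      b′-below : ∀ τ → length τ < p → b′ τ ≡ b τ
      b′-below τ l with length τ ℕ.≟ p
      ... | yes e = ⊥-elim (ℕₚ.<⇒≢ l e)
      ... | no _ = refl

      h-below : ∀ c σ → length σ ≤ p → h A t s b′ c σ ≡ h A t s b c σ
      h-below c [] l = refl
      h-below c (a ∷ σ) l = ∑-chains-cong (length σ) s
        (λ τ _ e → cong (λ f → c τ * f (a ∷ σ)) (b′-below τ (subst (_< p) (sym e) l)))

      h-top : ∀ c σ → length σ ≡ suc p → h A t s b′ c σ ≡ ∑ (chains A t p s) (λ τ → c τ * proj₁ (fill τ) σ)
      h-top c (a ∷ σ) refl = ∑-chains-cong (length σ) s (λ τ _ e → cong (λ f → c τ * f (a ∷ σ)) (b′-top τ e))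

      -- The boundary of the combined fillings is the combined defect c - h ∂ c, which is what the
      -- second summand completes to `c`.
      top : ∀ c σ → Valid A t s σ → length σ ≡ p → Dₛ (h A t s b′ c) σ + h A t s b′ (Dₛ c) σ ≡ c σ
      top c σ v refl = begin
        Dₛ (h A t s b′ c) σ + h A t s b′ (Dₛ c) σ
          ≡⟨ cong₂ _+_ (D-cong σ v (λ τ _ e → h-top c τ e)) (h-below (Dₛ c) σ ℕₚ.≤-refl) ⟩
        Dₛ (λ τ′ → ∑ ts (λ τ → c τ * proj₁ (fill τ) τ′)) σ + h A t s b (Dₛ c) σ
          ≡⟨ cong (_+ h A t s b (Dₛ c) σ) (D-∑* ts c _ σ) ⟩
        ∑ ts (λ τ → c τ * Dₛ (proj₁ (fill τ)) σ) + h A t s b (Dₛ c) σ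
          ≡⟨ cong (_+ h A t s b (Dₛ c) σ) (∑-cong ts (λ τ → cong (c τ *_) (proj₂ (fill τ) σ v refl))) ⟩
        ∑ ts (λ τ → c τ * defect b τ σ) + h A t s b (Dₛ c) σ
          ≡⟨ cong (_+ h A t s b (Dₛ c) σ) (defect-expand b c σ v) ⟩
        (c σ - h A t s b (Dₛ c) σ) + h A t s b (Dₛ c) σ ≡⟨ solve 2 (λ x y → (x :+ :- y) :+ y := x) refl (c σ) _ ⟩
        c σ ∎
        where ts = chains A t (length σ) s

      H′ : ∀ c σ → Valid A t s σ → length σ < suc p → Dₛ (h A t s b′ c) σ + h A t s b′ (Dₛ c) σ ≡ c σ
      H′ c σ v l with length σ ℕ.≟ p
      ... | yes e = top c σ v e
      ... | no ne = trans (cong₂ _+_ (D-cong σ v (λ τ _ e → h-below c τ (subst (_≤ p) (sym e) l′))) (h-below (Dₛ c) σ (ℕₚ.<⇒≤ l′)))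
                          (H c σ v l′)
        where l′ = ℕₚ.≤∧≢⇒< (ℕ.s≤s⁻¹ l) ne

-- Acyclicity of joins

module Join {r} {R : Set r} {plus times : R → R → R} {neg : R → R} {0# 1# : R}
    (isCommutativeRing : IsCommutativeRing _≡_ plus times neg 0# 1#)
    {k} (lt : Fin k → Fin k → Bool) (lt-trans : Chains.Transitive lt) where

  open ChainComplex isCommutativeRing lt lt-trans
  open Acyclicity isCommutativeRing lt lt-trans
  open CommutativeRing ring using (_+_; _*_; -_; _-_; +-identityˡ; -‿inverseʳ; *-assoc; *-identityˡ)
  open Sums ring
  open ℤ-Solver ring
  open ≡-Reasoning

  sign : ℕ → R
  sign zero = 1#
  sign (suc j) = - sign j

  sign² : ∀ j → sign j * sign j ≡ 1#
  sign² zero = *-identityˡ 1#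
  sign² (suc j) = trans (solve 1 (λ x → (:- x) :* (:- x) := x :* x) refl (sign j)) (sign² j)

  D-D-comm : ∀ {A s t s′ t′} (l : Chain → Chain → R) τ ρ →
             D A t s (λ τ′ → D A t′ s′ (l τ′) ρ) τ ≡ D A t′ s′ (λ ρ′ → D A t s (λ τ′ → l τ′ ρ′) τ) ρ
  D-D-comm l [] ρ = sym (D-S _ ρ)
  D-D-comm l (a ∷ τ) ρ = sym (trans (D-- _ _ ρ) (cong₂ _-_ (D-S _ ρ) (sym (D-D-comm (λ τ′ → l (a ∷ τ′)) τ ρ))))

  -- `D` at `τ` evaluates its argument on chains with one more vertex, so the degree sign comes out
  -- reversed.
  D-sign : ∀ {A s t} (f : Chain → R) τ → Valid A t s τ →
          D A t s (λ τ′ → sign (length τ′) * f τ′) τ ≡ - (sign (length τ) * D A t s f τ)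
  D-sign f τ v = begin
    _ ≡⟨ D-cong τ v (λ τ′ _ e → cong (λ m → sign m * f τ′) e) ⟩
    _ ≡⟨ D-* (- sign (length τ)) f τ ⟩
    _ ≡⟨ solve 2 (λ x y → (:- x) :* y := :- (x :* y)) refl (sign (length τ)) _ ⟩
    _ ∎

  module _ (A : Fin k → Bool) (s x t : Fin k) where

    -- The differential of the join of (s , x) and (x , t), on functions of pairs of chains.
    Dⱼ : (Chain → Chain → R) → Chain → Chain → R
    Dⱼ l τ ρ = D A x s (λ τ′ → l τ′ ρ) τ - sign (length τ) * D A t x (l τ) ρ

    private
      D₁ D₂ : (Chain → R) → Chain → R
      D₁ = D A x s
      D₂ = D A t x

    Dⱼ-- : ∀ l m τ ρ → Dⱼ (λ τ ρ → l τ ρ - m τ ρ) τ ρ ≡ Dⱼ l τ ρ - Dⱼ m τ ρ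
    Dⱼ-- l m τ ρ = trans (cong₂ (λ y z → y - sign (length τ) * z) (D-- _ _ τ) (D-- _ _ ρ))
      (solve 5 (λ a b g c d → (a :- b) :- g :* (c :- d) := (a :- g :* c) :- (b :- g :* d)) refl _ _ (sign (length τ)) _ _)

    Dⱼ-+ : ∀ l m τ ρ → Dⱼ (λ τ ρ → l τ ρ + m τ ρ) τ ρ ≡ Dⱼ l τ ρ + Dⱼ m τ ρ
    Dⱼ-+ l m τ ρ = trans (cong₂ (λ y z → y - sign (length τ) * z) (D-+ _ _ τ) (D-+ _ _ ρ))
      (solve 5 (λ a b g c d → (a :+ b) :- g :* (c :+ d) := (a :- g :* c) :+ (b :- g :* d)) refl _ _ (sign (length τ)) _ _)

    -- The mixed terms, in which each factor receives a vertex, cancel because `D-sign` reverses the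
    -- sign of one of them.
    Dⱼ² : ∀ l τ ρ → Valid A x s τ → Dⱼ (Dⱼ l) τ ρ ≡ 0#
    Dⱼ² l τ ρ v = begin
      D₁ (λ τ′ → D₁ (λ τ″ → l τ″ ρ) τ′ - sign (length τ′) * D₂ (l τ′) ρ) τ
        - g * D₂ (λ ρ′ → D₁ (λ τ′ → l τ′ ρ′) τ - g * D₂ (l τ) ρ′) ρ
        ≡⟨ cong₂ (λ y z → y - g * z)
             (trans (D-- _ _ τ) (cong₂ _-_ (D² s _ τ) (D-sign (λ τ′ → D₂ (l τ′) ρ) τ v)))
             (trans (D-- _ _ ρ) (cong₂ _-_ (sym (D-D-comm l τ ρ)) (trans (D-* g _ ρ) (cong (g *_) (D² x _ ρ))))) ⟩
      (0# - - (g * X)) - g * (X - g * 0#)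
        ≡⟨ solve 2 (λ g x → (con ℤ.0ℤ :- :- (g :* x)) :- g :* (x :- g :* con ℤ.0ℤ) := con ℤ.0ℤ) refl g X ⟩
      0# ∎
      where
      g = sign (length τ)
      X = D₁ (λ τ′ → D₂ (l τ′) ρ) τ

    -- First h₁ is applied; what remains is supported on chains with at least p vertices below x,
    -- hence with fewer than q above x, where h₂ finishes the job.
    join-vanishing : ∀ {p q} → ∃[ b ] IsHomotopy A s x p b → ∃[ b ] IsHomotopy A x t q b →
      ∀ j → j < p ℕ.+ q → ∀ l →
      (∀ τ ρ → Valid A x s τ → Valid A t x ρ → suc (length τ ℕ.+ length ρ) ≡ j → Dⱼ l τ ρ ≡ 0#) →
      ∃[ w ] (∀ τ ρ → Valid A x s τ → Valid A t x ρ → length τ ℕ.+ length ρ ≡ j → Dⱼ w τ ρ ≡ l τ ρ)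
    join-vanishing {p} {q} (b₁ , H₁) (b₂ , H₂) j j<p+q l cycle = (λ τ ρ → u τ ρ + v τ ρ) , filled
      where
      h₁ = h A x s b₁
      h₂ = h A t x b₂
      u l′ v : Chain → Chain → R
      u τ ρ = h₁ (λ τ′ → l τ′ ρ) τ
      l′ τ ρ = l τ ρ - Dⱼ u τ ρ
      -- This factor undoes the coefficient of the second differential in `Dⱼ`, as signs square to
      -- 1.
      v τ ρ = - (sign (length τ) * h₂ (l′ τ) ρ)

      -- The cycle condition trades `D₁ l` for `D₂ l` up to sign, and `h₁` commutes with `D₂`. Hence
      -- `Dⱼ u` equals `D₁ h₁ + h₁ D₁` applied to `l`, which is `l` as long as the first chain is
      -- short.
      h₁-cycle : ∀ τ ρ → Valid A t x ρ → length τ ℕ.+ length ρ ≡ j →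
        h₁ (D₁ (λ τ″ → l τ″ ρ)) τ ≡ - (sign (length τ) * D₂ (u τ) ρ)
      h₁-cycle τ ρ w e = begin
        h₁ (D₁ (λ τ″ → l τ″ ρ)) τ ≡⟨ h-cong τ (λ τ′ v′ e′ → lemma τ′ v′ e′) ⟩
        h₁ (λ τ′ → (- sign (length τ)) * D₂ (l τ′) ρ) τ ≡⟨ h-* _ _ τ ⟩
        (- sign (length τ)) * h₁ (λ τ′ → D₂ (l τ′) ρ) τ ≡⟨ cong (- sign (length τ) *_) (sym (D-h-comm l τ ρ)) ⟩
        (- sign (length τ)) * D₂ (u τ) ρ ≡⟨ solve 2 (λ x y → (:- x) :* y := :- (x :* y)) refl (sign (length τ)) _ ⟩
        - (sign (length τ) * D₂ (u τ) ρ) ∎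
        where
        lemma : ∀ τ′ → Valid A x s τ′ → suc (length τ′) ≡ length τ →
                D₁ (λ τ″ → l τ″ ρ) τ′ ≡ (- sign (length τ)) * D₂ (l τ′) ρ
        lemma τ′ v′ e′ rewrite sym e′ = begin
          D₁ (λ τ″ → l τ″ ρ) τ′ ≡⟨ solve 2 (λ a b → a := (a :- b) :+ b) refl _ (sign (length τ′) * D₂ (l τ′) ρ) ⟩
          Dⱼ l τ′ ρ + sign (length τ′) * D₂ (l τ′) ρ ≡⟨ cong (_+ sign (length τ′) * D₂ (l τ′) ρ) (cycle τ′ ρ v′ w e) ⟩
          0# + sign (length τ′) * D₂ (l τ′) ρ ≡⟨ solve 2 (λ x y → con ℤ.0ℤ :+ x :* y := (:- (:- x)) :* y) refl (sign (length τ′)) _ ⟩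
          (- (- sign (length τ′))) * D₂ (l τ′) ρ ∎

      l′-low : ∀ τ ρ → Valid A x s τ → Valid A t x ρ → length τ ℕ.+ length ρ ≡ j → length τ < p → l′ τ ρ ≡ 0#
      l′-low τ ρ v w e lo = begin
        l τ ρ - (D₁ (h₁ (λ τ′ → l τ′ ρ)) τ - sign (length τ) * D₂ (u τ) ρ)
          ≡⟨ cong (λ z → l τ ρ - (D₁ (h₁ (λ τ′ → l τ′ ρ)) τ + z)) (sym (h₁-cycle τ ρ w e)) ⟩
        l τ ρ - (D₁ (h₁ (λ τ′ → l τ′ ρ)) τ + h₁ (D₁ (λ τ′ → l τ′ ρ)) τ) ≡⟨ cong (λ z → l τ ρ - z) (H₁ _ τ v lo) ⟩
        l τ ρ - l τ ρ ≡⟨ -‿inverseʳ _ ⟩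
        0# ∎

      l′-cycle : ∀ τ ρ → Valid A x s τ → Valid A t x ρ → suc (length τ ℕ.+ length ρ) ≡ j →
                 D₁ (λ τ′ → l′ τ′ ρ) τ ≡ sign (length τ) * D₂ (l′ τ) ρ
      l′-cycle τ ρ v w e = begin
        D₁ (λ τ′ → l′ τ′ ρ) τ ≡⟨ solve 2 (λ a b → a := (a :- b) :+ b) refl _ (sign (length τ) * D₂ (l′ τ) ρ) ⟩
        Dⱼ l′ τ ρ + sign (length τ) * D₂ (l′ τ) ρ
          ≡⟨ cong (_+ sign (length τ) * D₂ (l′ τ) ρ) (trans (Dⱼ-- l (Dⱼ u) τ ρ)
               (trans (cong₂ _-_ (cycle τ ρ v w e) (Dⱼ² u τ ρ v)) (-‿inverseʳ 0#))) ⟩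
        0# + sign (length τ) * D₂ (l′ τ) ρ ≡⟨ +-identityˡ _ ⟩
        sign (length τ) * D₂ (l′ τ) ρ ∎

      h₂D₂ : ∀ τ ρ → Valid A x s τ → Valid A t x ρ → length τ ℕ.+ length ρ ≡ j →
             D₁ (λ τ′ → v τ′ ρ) τ ≡ h₂ (D₂ (l′ τ)) ρ
      h₂D₂ τ ρ vτ w e = begin
        D₁ (λ τ′ → - (sign (length τ′) * h₂ (l′ τ′) ρ)) τ ≡⟨ trans (D-neg _ τ) (cong -_ (D-sign _ τ vτ)) ⟩
        - (- (g * D₁ (λ τ′ → h₂ (l′ τ′) ρ) τ)) ≡⟨ solve 1 (λ x → :- (:- x) := x) refl _ ⟩
        g * D₁ (λ τ′ → h₂ (l′ τ′) ρ) τ ≡⟨ cong (g *_) (D-h-comm (λ ρ′ τ′ → l′ τ′ ρ′) ρ τ) ⟩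
        g * h₂ (λ ρ′ → D₁ (λ τ′ → l′ τ′ ρ′) τ) ρ
          ≡⟨ cong (g *_) (h-cong ρ (λ ρ′ w′ e′ → l′-cycle τ ρ′ vτ w′ (trans (sym (ℕₚ.+-suc (length τ) (length ρ′))) (trans (cong (length τ ℕ.+_) e′) e)))) ⟩
        g * h₂ (λ ρ′ → g * D₂ (l′ τ) ρ′) ρ ≡⟨ cong (g *_) (h-* g _ ρ) ⟩
        g * (g * h₂ (D₂ (l′ τ)) ρ) ≡⟨ trans (sym (*-assoc g g _)) (trans (cong (_* h₂ (D₂ (l′ τ)) ρ) (sign² (length τ))) (*-identityˡ _)) ⟩
        h₂ (D₂ (l′ τ)) ρ ∎
        where g = sign (length τ)

      D₂h₂ : ∀ τ ρ → - (sign (length τ) * D₂ (v τ) ρ) ≡ D₂ (h₂ (l′ τ)) ρ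
      D₂h₂ τ ρ = begin
        - (g * D₂ (λ ρ′ → - (g * h₂ (l′ τ) ρ′)) ρ) ≡⟨ cong (λ z → - (g * z)) (trans (D-neg _ ρ) (cong -_ (D-* g _ ρ))) ⟩
        - (g * - (g * D₂ (h₂ (l′ τ)) ρ)) ≡⟨ solve 2 (λ g x → :- (g :* :- (g :* x)) := (g :* g) :* x) refl g _ ⟩
        (g * g) * D₂ (h₂ (l′ τ)) ρ ≡⟨ trans (cong (_* D₂ (h₂ (l′ τ)) ρ) (sign² (length τ))) (*-identityˡ _) ⟩
        D₂ (h₂ (l′ τ)) ρ ∎
        where g = sign (length τ)

      remainder : ∀ τ ρ → Valid A x s τ → Valid A t x ρ → length τ ℕ.+ length ρ ≡ j →
                  D₂ (h₂ (l′ τ)) ρ + h₂ (D₂ (l′ τ)) ρ ≡ l′ τ ρ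
      remainder τ ρ vτ w e with length τ ℕ.<? p
      ... | no hi = H₂ (l′ τ) ρ w (ℕₚ.+-cancelˡ-< p _ _ (ℕₚ.≤-<-trans (ℕₚ.+-monoˡ-≤ (length ρ) (ℕₚ.≮⇒≥ hi)) (subst (_< p ℕ.+ q) (sym e) j<p+q)))
      -- For this `τ` the remainder `l′ τ` vanishes on all chains as long as `ρ`, and both
      -- composites evaluate it only there.
      ... | yes lo = begin
        D₂ (h₂ (l′ τ)) ρ + h₂ (D₂ (l′ τ)) ρ
          ≡⟨ cong₂ _+_ (D-zero ρ w (λ ρ′ _ e₁ → h-zero ρ′ (λ ρ″ w″ e₂ → zero″ ρ″ w″ (ℕₚ.suc-injective (trans e₂ e₁)))))
                       (h-zero ρ (λ ρ′ w′ e₁ → D-zero ρ′ w′ (λ ρ″ w″ e₂ → zero″ ρ″ w″ (trans e₂ e₁)))) ⟩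
        0# + 0# ≡⟨ +-identityˡ 0# ⟩
        0# ≡⟨ sym (l′-low τ ρ vτ w e lo) ⟩
        l′ τ ρ ∎
        where
        zero″ : ∀ ρ″ → Valid A t x ρ″ → length ρ″ ≡ length ρ → l′ τ ρ″ ≡ 0#
        zero″ ρ″ w″ e″ = l′-low τ ρ″ vτ w″ (trans (cong (length τ ℕ.+_) e″) e) lo

      filled : ∀ τ ρ → Valid A x s τ → Valid A t x ρ → length τ ℕ.+ length ρ ≡ j →
               Dⱼ (λ τ ρ → u τ ρ + v τ ρ) τ ρ ≡ l τ ρ
      filled τ ρ vτ w e = begin
        Dⱼ (λ τ ρ → u τ ρ + v τ ρ) τ ρ ≡⟨ Dⱼ-+ u v τ ρ ⟩
        Dⱼ u τ ρ + Dⱼ v τ ρ ≡⟨ cong (Dⱼ u τ ρ +_) (trans (cong₂ _+_ (h₂D₂ τ ρ vτ w e) (D₂h₂ τ ρ)) (trans (CommutativeRing.+-comm ring _ _) (remainder τ ρ vτ w e))) ⟩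
        Dⱼ u τ ρ + (l τ ρ - Dⱼ u τ ρ) ≡⟨ solve 2 (λ a b → b :+ (a :- b) := a) refl _ _ ⟩
        l τ ρ ∎

-- Deleting an antichain

module RankSelection {r} {R : Set r} {plus times : R → R → R} {neg : R → R} {0# 1# : R}
    (isCommutativeRing : IsCommutativeRing _≡_ plus times neg 0# 1#)
    {k} (lt : Fin k → Fin k → Bool) (lt-trans : Chains.Transitive lt) where

  open ChainComplex isCommutativeRing lt lt-trans
  open Acyclicity isCommutativeRing lt lt-trans
  open Join isCommutativeRing lt lt-trans
  open CommutativeRing ring using (_+_; _*_; -_; _-_; +-identityʳ; -‿inverseʳ; *-comm; *-identityˡ)
  open Sums ring
  open ℤ-Solver ring
  open ≡-Reasoning

  ⊳-agree : ∀ {b b′ y} → (T b → T b′ ⊎ y ≡ 0#) → (T b′ → T b) → b ⊳ y ≡ b′ ⊳ y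
  ⊳-agree {true} {true} f g = refl
  ⊳-agree {false} {false} f g = refl
  ⊳-agree {false} {true} f g = ⊥-elim (g tt)
  ⊳-agree {true} {false} f g with f tt
  ... | inj₂ e = e

  between⁻ : ∀ A {s t x} → T (between A s t x) → T (lt s x) × T (lt x t) × T (A x)
  between⁻ A {s} {t} {x} p = let (a , q) = T-∧⁻ {lt s x} p ; (b , c) = T-∧⁻ {lt x t} q in a , b , c

  between⁺ : ∀ A {s t x} → T (lt s x) → T (lt x t) → T (A x) → T (between A s t x)
  between⁺ A a b c = T-∧⁺ a (T-∧⁺ b c)

  module _ {A A′ : Fin k → Bool} where

    Valid-mono : ∀ {s t} → (∀ x → T (lt s x) → T (lt x t) → T (A x) → T (A′ x)) → ∀ σ → Valid A t s σ → Valid A′ t s σ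
    Valid-mono e [] v = tt
    Valid-mono {s} {t} e (a ∷ σ) (p , v) = let (sa , at , Aa) = between⁻ A {s} {t} {a} p in
      between⁺ A′ sa at (e a sa at Aa) , Valid-mono (λ x ax → e x (lt-trans sa ax)) σ v

    Agree : Fin k → Fin k → Set
    Agree s t = ∀ x → T (lt s x) → T (lt x t) → A x ≡ A′ x

    S-agree : ∀ {s t} → Agree s t → ∀ f → S A s t f ≡ S A′ s t f
    S-agree {s} {t} e f = ∑-cong (allFin k) (λ x → cong (_⊳ f x) (T-ext
      (λ p → let (a , b , c) = between⁻ A {s} {t} {x} p in between⁺ A′ a b (subst T (e x a b) c))
      (λ p → let (a , b , c) = between⁻ A′ {s} {t} {x} p in between⁺ A a b (subst T (sym (e x a b)) c))))

    D-agree : ∀ {s t} → Agree s t → ∀ c σ → Valid A t s σ → D A t s c σ ≡ D A′ t s c σ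
    D-agree e c [] v = S-agree e _
    D-agree {s} {t} e c (a ∷ σ) (p , v) = let (sa , at , _) = between⁻ A {s} {t} {a} p in
      cong₂ _-_ (S-agree (λ x sx xa → e x sx (lt-trans xa at)) _) (D-agree (λ x ax → e x (lt-trans sa ax)) _ σ v)

  Vanishing-agree : ∀ {A A′ s t p} → Agree {A} {A′} s t → Vanishing A s t p → Vanishing A′ s t p
  Vanishing-agree {A} {A′} e van j j<p c cycle =
    let (d , Hd) = van j j<p c (λ σ v l → trans (D-agree e c σ v) (cycle σ (forth σ v) l)) in
    d , λ σ v l → trans (sym (D-agree e d σ (back σ v))) (Hd σ (back σ v) l)
    where
    forth = Valid-mono {A} {A′} (λ x a b → subst T (e x a b))
    back = Valid-mono {A′} {A} (λ x a b → subst T (sym (e x a b)))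

  Vanishing-≤ : ∀ {A s t p q} → q ≤ p → Vanishing A s t p → Vanishing A s t q
  Vanishing-≤ q≤p van j j<q = van j (ℕₚ.<-≤-trans j<q q≤p)

  -- A vertex is inserted either below or above `x`; in the second case it passes `length τ`
  -- vertices and `x` itself, whence the sign. This identifies the link of `x` with a join and
  -- matches `Dⱼ`.
  D-split : ∀ {A s t x} c τ ρ → D A t s c (τ ++ x ∷ ρ) ≡
    D A x s (λ τ′ → c (τ′ ++ x ∷ ρ)) τ - sign (length τ) * D A t x (λ ρ′ → c (τ ++ x ∷ ρ′)) ρ
  D-split {A} {s} {t} {x} c [] ρ = cong (λ z → S A s x (λ y → c (y ∷ x ∷ ρ)) - z) (sym (*-identityˡ _))
  D-split {A} {s} {t} {x} c (a ∷ τ) ρ = trans (cong (λ z → S A s a (λ y → c (y ∷ a ∷ τ ++ x ∷ ρ)) - z) (D-split (λ σ → c (a ∷ σ)) τ ρ))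
    (solve 4 (λ p q g y → p :- (q :- g :* y) := (p :- q) :- (:- g) :* y) refl _ _ (sign (length τ)) _)

  Valid-++ : ∀ {A s t x} τ ρ → Valid A x s τ → T (lt s x) → T (lt x t) → T (A x) → Valid A t x ρ → Valid A t s (τ ++ x ∷ ρ)
  Valid-++ {A} [] ρ v sx xt Ax w = between⁺ A sx xt Ax , w
  Valid-++ {A} {s} {t} {x} (a ∷ τ) ρ (p , v) sx xt Ax w = let (sa , ax , Aa) = between⁻ A {s} {x} {a} p in
    between⁺ A sa (lt-trans ax xt) Aa , Valid-++ τ ρ v ax xt Ax w

  length-++-∷ : ∀ (τ : Chain) {x} ρ → length (τ ++ x ∷ ρ) ≡ suc (length τ ℕ.+ length ρ)
  length-++-∷ τ ρ = trans (Listₚ.length-++ τ) (ℕₚ.+-suc _ _)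

  -- Deleting an antichain B from A leaves K.
  module _ (A K B : Fin k → Bool)
    (K⊆A : ∀ x → T (K x) → T (A x)) (B⊆A : ∀ x → T (B x) → T (A x))
    (cover : ∀ x → T (A x) → T (K x) ⊎ T (B x)) (disjoint : ∀ x → T (K x) → T (B x) → ⊥)
    (antichain : ∀ x y → T (B x) → T (B y) → T (lt x y) → ⊥) where

    private
      -- A chain meets the antichain at most once, so on either side of `x` the sets `A` and `K`
      -- select the same elements and links may be computed in `K`.
      agree-below : ∀ x s → T (B x) → Agree {A} {K} s x
      agree-below x s Bx y _ yx = T-ext (λ Ay → case y yx (cover y Ay)) (K⊆A y)
        where
        case : ∀ y → T (lt y x) → T (K y) ⊎ T (B y) → T (K y)
        case y yx (inj₁ Ky) = Ky
        case y yx (inj₂ By) = ⊥-elim (antichain y x By Bx yx)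

      agree-above : ∀ x t → T (B x) → Agree {A} {K} x t
      agree-above x t Bx y xy _ = T-ext (λ Ay → case (cover y Ay)) (K⊆A y)
        where
        case : T (K y) ⊎ T (B y) → T (K y)
        case (inj₁ Ky) = Ky
        case (inj₂ By) = ⊥-elim (antichain x y Bx By xy)

      K⇒A : ∀ {s t} σ → Valid K t s σ → Valid A t s σ
      K⇒A = Valid-mono (λ x _ _ → K⊆A x)

      locate : ∀ {t} s σ → Valid A t s σ →
        Valid K t s σ ⊎ (∃[ τ ] ∃[ x ] ∃[ ρ ] (σ ≡ τ ++ x ∷ ρ × T (B x)))
      locate s [] v = inj₁ tt
      locate {t} s (a ∷ σ) (p , v) with between⁻ A {s} {t} {a} p
      ... | sa , at , Aa with cover a Aa | locate a σ v
      ... | inj₂ Ba | _ = inj₂ ([] , a , σ , refl , Ba)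
      ... | inj₁ Ka | inj₁ w = inj₁ (between⁺ K sa at Ka , w)
      ... | inj₁ Ka | inj₂ (τ , x , ρ , e , Bx) = inj₂ (a ∷ τ , x , ρ , cong (a ∷_) e , Bx)

      -- The two boundaries differ exactly by the insertions of a vertex of `B`, where `y` is
      -- assumed to vanish.
      D-restrict : ∀ {t} s σ y → Valid K t s σ →
        (∀ τ x ρ → Valid K x s τ → T (B x) → T (lt s x) → T (lt x t) → Valid K t x ρ →
          length τ ℕ.+ length ρ ≡ length σ → y (τ ++ x ∷ ρ) ≡ 0#) →
        D A t s y σ ≡ D K t s y σ
      S-restrict : ∀ s t f → (∀ x → T (B x) → T (lt s x) → T (lt x t) → f x ≡ 0#) → S A s t f ≡ S K s t f
      S-restrict s t f e = ∑-cong (allFin k) (λ x → ⊳-agree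
          (λ p → let (a , b , c) = between⁻ A {s} {t} {x} p in case x a b (cover x c))
          (λ p → let (a , b , c) = between⁻ K {s} {t} {x} p in between⁺ A a b (K⊆A x c)))
        where
        case : ∀ x → T (lt s x) → T (lt x t) → T (K x) ⊎ T (B x) → T (between K s t x) ⊎ f x ≡ 0#
        case x a b (inj₁ Kx) = inj₁ (between⁺ K a b Kx)
        case x a b (inj₂ Bx) = inj₂ (e x Bx a b)
      D-restrict s [] y v e = S-restrict _ _ _ (λ x Bx sx xt → e [] x [] tt Bx sx xt tt refl)
      D-restrict {t} s (a ∷ σ) y (p , v) e = let (sa , at , Ka) = between⁻ K {s} {t} {a} p in cong₂ _-_
        (S-restrict _ _ _ (λ x Bx sx xa → e [] x (a ∷ σ) tt Bx sx (lt-trans xa at) (between⁺ K xa at Ka , v) refl))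
        (D-restrict a σ (λ σ′ → y (a ∷ σ′)) v
          (λ τ x ρ w Bx ax xt w′ l → e (a ∷ τ) x ρ (between⁺ K sa ax Ka , w) Bx (lt-trans sa ax) xt w′ (cong suc l)))

      -- Glues functions on the links into one chain group element: the first vertex in `B` selects
      -- the link, and chains avoiding `B` get 0.
      extend : (Fin k → Chain → Chain → R) → Chain → R
      extend W [] = 0#
      extend W (a ∷ σ) = if B a then W a [] σ else extend (λ x τ ρ → W x (a ∷ τ) ρ) σ

      if-T : ∀ {b} {y z : R} → T b → (if b then y else z) ≡ y
      if-T {true} _ = refl

      if-F : ∀ {b} {y z : R} → (T b → ⊥) → (if b then y else z) ≡ z
      if-F {false} _ = refl
      if-F {true} n = ⊥-elim (n tt)

      extend-at : ∀ {x} s W τ ρ → Valid K x s τ → T (B x) → extend W (τ ++ x ∷ ρ) ≡ W x τ ρ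
      extend-at s W [] ρ v Bx = if-T Bx
      extend-at {x} s W (a ∷ τ) ρ (p , v) Bx = let (_ , _ , Ka) = between⁻ K {s} {x} {a} p in
        trans (if-F (disjoint a Ka)) (extend-at a _ τ ρ v Bx)

      all-K : ∀ {t} s σ → Valid K t s σ → T (all K σ)
      all-K s [] v = tt
      all-K {t} s (a ∷ σ) (p , v) = T-∧⁺ (proj₂ (proj₂ (between⁻ K {s} {t} {a} p))) (all-K a σ v)

      not-all-K : ∀ τ x ρ → T (B x) → T (all K (τ ++ x ∷ ρ)) → ⊥
      not-all-K [] x ρ Bx q = disjoint x (proj₁ (T-∧⁻ {K x} q)) Bx
      not-all-K (a ∷ τ) x ρ Bx q = not-all-K τ x ρ Bx (proj₂ (T-∧⁻ {K a} q))

    -- A filling in A of a cycle of K is corrected, at each x in B, by a filling of its link at x.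
    removal : ∀ s t N → Vanishing A s t N →
      (∀ x → T (B x) → T (lt s x) → T (lt x t) → ∃[ p ] ∃[ q ] (Vanishing K s x p × Vanishing K x t q × N ≤ p ℕ.+ q)) →
      Vanishing K s t N
    removal s t N vanA link j j<N c cycle = y′ , filled
      where
      -- `c` extended by zero to the chains that meet `B`, so that it can be filled in `A`.
      z : Chain → R
      z σ = all K σ ⊳ c σ

      z-K : ∀ σ → Valid K t s σ → z σ ≡ c σ
      z-K σ v = if-T (all-K s σ v)

      z-B : ∀ τ x ρ → T (B x) → z (τ ++ x ∷ ρ) ≡ 0#
      z-B τ x ρ Bx = if-F (not-all-K τ x ρ Bx)

      z-cycle : ∀ σ → Valid A t s σ → suc (length σ) ≡ j → D A t s z σ ≡ 0#
      z-cycle σ v e with locate s σ v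
      ... | inj₁ w = trans (D-restrict s σ z w (λ τ x ρ _ Bx _ _ _ _ → z-B τ x ρ Bx))
                    (trans (D-cong σ w (λ σ′ w′ _ → z-K σ′ w′)) (cycle σ w e))
      -- Every chain obtained by an insertion still passes through `x`, so all terms vanish
      -- separately.
      ... | inj₂ (τ , x , ρ , refl , Bx) = trans (D-split z τ ρ) (trans
              (cong₂ (λ m n → m - sign (length τ) * n)
                (trans (D-ext τ (λ τ′ → z-B τ′ x ρ Bx)) (D-0 τ)) (trans (D-ext ρ (λ ρ′ → z-B τ x ρ′ Bx)) (D-0 ρ)))
              (solve 1 (λ g → con ℤ.0ℤ :- g :* con ℤ.0ℤ := con ℤ.0ℤ) refl (sign (length τ))))

      y : Chain → R
      y = proj₁ (vanA j j<N z z-cycle)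

      Dy : ∀ σ → Valid A t s σ → length σ ≡ j → D A t s y σ ≡ z σ
      Dy = proj₂ (vanA j j<N z z-cycle)

      split-at : ∀ x f τ ρ → T (B x) → Valid K x s τ → Valid K t x ρ →
        D A t s f (τ ++ x ∷ ρ) ≡ Dⱼ K s x t (λ τ′ ρ′ → f (τ′ ++ x ∷ ρ′)) τ ρ
      split-at x f τ ρ Bx v w = trans (D-split f τ ρ) (cong₂ (λ m n → m - sign (length τ) * n)
        (D-agree (agree-below x s Bx) _ τ (K⇒A τ v)) (D-agree (agree-above x t Bx) _ ρ (K⇒A ρ w)))

      link-filling : ∀ x → T (B x) → T (lt s x) → T (lt x t) → ∃[ w ] (∀ τ ρ → Valid K x s τ → Valid K t x ρ →
        length τ ℕ.+ length ρ ≡ j → Dⱼ K s x t w τ ρ ≡ y (τ ++ x ∷ ρ))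
      link-filling x Bx sx xt with link x Bx sx xt
      ... | p , q , van₁ , van₂ , N≤p+q =
        join-vanishing K s x t (vanishing⇒homotopy p van₁) (vanishing⇒homotopy q van₂) j (ℕₚ.<-≤-trans j<N N≤p+q)
          (λ τ ρ → y (τ ++ x ∷ ρ)) link-cycle
        where
        -- On the link of `x` the differential of `y` is that of the whole complex at chains through
        -- `x`, where `D y = z` is 0.
        link-cycle : ∀ τ ρ → Valid K x s τ → Valid K t x ρ → suc (length τ ℕ.+ length ρ) ≡ j →
          Dⱼ K s x t (λ τ ρ → y (τ ++ x ∷ ρ)) τ ρ ≡ 0#
        link-cycle τ ρ v w e = trans (sym (split-at x y τ ρ Bx v w))
          (trans (Dy _ (Valid-++ τ ρ (K⇒A τ v) sx xt (B⊆A x Bx) (K⇒A ρ w)) (trans (length-++-∷ τ ρ) e)) (z-B τ x ρ Bx))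

      -- The chosen link fillings, made total by 0 at elements that are not deleted vertices of the
      -- interval.
      W : Fin k → Chain → Chain → R
      W x with T? (B x) | T? (lt s x) | T? (lt x t)
      ... | yes Bx | yes sx | yes xt = proj₁ (link-filling x Bx sx xt)
      ... | _ | _ | _ = λ _ _ → 0#

      W-fills : ∀ x → T (B x) → T (lt s x) → T (lt x t) → ∀ τ ρ → Valid K x s τ → Valid K t x ρ →
        length τ ℕ.+ length ρ ≡ j → Dⱼ K s x t (W x) τ ρ ≡ y (τ ++ x ∷ ρ)
      W-fills x Bx sx xt with T? (B x) | T? (lt s x) | T? (lt x t)
      ... | yes Bx′ | yes sx′ | yes xt′ = proj₂ (link-filling x Bx′ sx′ xt′)
      ... | no n | _ | _ = ⊥-elim (n Bx)
      ... | yes _ | no n | _ = ⊥-elim (n sx)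
      ... | yes _ | yes _ | no n = ⊥-elim (n xt)

      -- Subtracting a boundary keeps the boundary of `y`, and this one cancels `y` on all chains
      -- through `B`.
      y′ : Chain → R
      y′ σ = y σ - D A t s (extend W) σ

      y′-B : ∀ τ x ρ → Valid K x s τ → T (B x) → T (lt s x) → T (lt x t) → Valid K t x ρ →
        length τ ℕ.+ length ρ ≡ j → y′ (τ ++ x ∷ ρ) ≡ 0#
      y′-B τ x ρ v Bx sx xt w e = trans (cong (λ m → y (τ ++ x ∷ ρ) - m) (begin
        D A t s (extend W) (τ ++ x ∷ ρ) ≡⟨ split-at x (extend W) τ ρ Bx v w ⟩
        Dⱼ K s x t (λ τ′ ρ′ → extend W (τ′ ++ x ∷ ρ′)) τ ρ
          ≡⟨ cong₂ (λ m n → m - sign (length τ) * n) (D-cong τ v (λ τ′ v′ _ → extend-at s W τ′ ρ v′ Bx))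
                                                    (D-cong ρ w (λ ρ′ _ _ → extend-at s W τ ρ′ v Bx)) ⟩
        Dⱼ K s x t (W x) τ ρ ≡⟨ W-fills x Bx sx xt τ ρ v w e ⟩
        y (τ ++ x ∷ ρ) ∎)) (-‿inverseʳ _)

      filled : ∀ σ → Valid K t s σ → length σ ≡ j → D K t s y′ σ ≡ c σ
      filled σ v e = begin
        D K t s y′ σ ≡⟨ sym (D-restrict s σ y′ v (λ τ x ρ v′ Bx sx xt w l → y′-B τ x ρ v′ Bx sx xt w (trans l e))) ⟩
        D A t s y′ σ ≡⟨ D-- _ _ σ ⟩
        D A t s y σ - D A t s (D A t s (extend W)) σ ≡⟨ cong₂ _-_ (Dy σ (K⇒A σ v) e) (D² s _ σ) ⟩
        z σ - 0# ≡⟨ solve 1 (λ a → a :- con ℤ.0ℤ := a) refl _ ⟩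
        z σ ≡⟨ z-K σ v ⟩
        c σ ∎

  -- Euler characteristics as traces

  module EulerCharacteristic (A : Fin k → Bool) (s t : Fin k) where

    count : ℕ → R
    count j = ∑ (chains A t j s) (λ _ → 1#)

    -- The negative of the reduced Euler characteristic, truncated to chains with at most the given
    -- number of vertices: the empty chain counts positively.
    alternating : ℕ → R
    alternating zero = count 0
    alternating (suc j) = alternating j + sign (suc j) * count (suc j)

    module _ {N b} (H : IsHomotopy A s t N b) where

      private
        u : ℕ → R
        u j = ∑ (chains A t j s) (λ σ → h A t s b (D A t s (δ σ)) σ)

        δ-diag : ∀ σ → δ σ σ ≡ 1#
        δ-diag [] = refl
        δ-diag (x ∷ σ) with x Fin.≟ x
        ... | yes _ = δ-diag σ
        ... | no n = ⊥-elim (n refl)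

        -- Cyclicity of the trace: ∂ h in degree `j` and h ∂ in degree `suc j` have the same trace.
        trace-swap : ∀ j → ∑ (chains A t j s) (λ σ → D A t s (h A t s b (δ σ)) σ) ≡ u (suc j)
        trace-swap j = begin
          ∑ cs (λ σ → D A t s (h A t s b (δ σ)) σ)
            ≡⟨ ∑-chains-cong j s (λ σ v e → trans (D-cong σ v (λ τ w l → hδ σ τ v e (trans l (cong suc e)))) (Db σ v e)) ⟩
          ∑ cs (λ σ → ∑ cs′ (λ τ → b σ τ * D A t s (δ τ) σ)) ≡⟨ ∑-swap cs cs′ _ ⟩
          ∑ cs′ (λ τ → ∑ cs (λ σ → b σ τ * D A t s (δ τ) σ)) ≡⟨ ∑-chains-cong (suc j) s (λ τ _ l → hD τ l) ⟩
          u (suc j) ∎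
          where
          cs = chains A t j s
          cs′ = chains A t (suc j) s
          hδ : ∀ σ τ → Valid A t s σ → length σ ≡ j → length τ ≡ suc j → h A t s b (δ σ) τ ≡ b σ τ
          hδ σ (a ∷ τ) v refl l = trans (cong (λ m → ∑ (chains A t m s) (λ τ′ → δ σ τ′ * b τ′ (a ∷ τ))) (ℕₚ.suc-injective l))
            (trans (∑-cong (chains A t (length σ) s) (λ τ′ → trans (cong (_* b τ′ (a ∷ τ)) (δ-sym σ τ′)) (*-comm _ _)))
                   (δ-expand s (λ τ′ → b τ′ (a ∷ τ)) σ v))
            where
            ≟-sym : ∀ (x y : Fin k) → ⌊ x Fin.≟ y ⌋ ≡ ⌊ y Fin.≟ x ⌋
            ≟-sym x y with x Fin.≟ y | y Fin.≟ x
            ... | yes _ | yes _ = refl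
            ... | no _ | no _ = refl
            ... | yes e | no n = ⊥-elim (n (sym e))
            ... | no n | yes e = ⊥-elim (n (sym e))
            δ-sym : ∀ σ τ → δ σ τ ≡ δ τ σ
            δ-sym [] [] = refl
            δ-sym [] (_ ∷ _) = refl
            δ-sym (_ ∷ _) [] = refl
            δ-sym (x ∷ σ) (y ∷ τ) = cong₂ _⊳_ (≟-sym x y) (δ-sym σ τ)
          Db : ∀ σ → Valid A t s σ → length σ ≡ j → D A t s (b σ) σ ≡ ∑ cs′ (λ τ → b σ τ * D A t s (δ τ) σ)
          Db σ v refl = trans (D-cong σ v (λ τ w l → sym (trans (cong (λ m → ∑ (chains A t m s) (λ τ′ → b σ τ′ * δ τ′ τ)) (sym l)) (δ-expand s (b σ) τ w))))
            (D-∑* cs′ (b σ) δ σ)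
          hD : ∀ τ → length τ ≡ suc j → ∑ cs (λ σ → b σ τ * D A t s (δ τ) σ) ≡ h A t s b (D A t s (δ τ)) τ
          hD (a ∷ τ) refl = ∑-cong cs (λ σ → *-comm _ _)

        count-split : ∀ j → j < N → count j ≡ u (suc j) + u j
        count-split j j<N = begin
          count j ≡⟨ ∑-chains-cong j s (λ σ v e → trans (sym (δ-diag σ)) (sym (H (δ σ) σ v (subst (_< N) (sym e) j<N)))) ⟩
          ∑ (chains A t j s) (λ σ → D A t s (h A t s b (δ σ)) σ + h A t s b (D A t s (δ σ)) σ) ≡⟨ ∑-+ (chains A t j s) _ _ ⟩
          ∑ (chains A t j s) (λ σ → D A t s (h A t s b (δ σ)) σ) + u j ≡⟨ cong (_+ u j) (trace-swap j) ⟩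
          u (suc j) + u j ∎

        u₀ : u 0 ≡ 0#
        u₀ = +-identityʳ 0#

        -- Taking traces in ∂ h + h ∂ = 1 writes each count as two consecutive values of `u`, so the
        -- alternating sum telescopes.
        alternating-below : ∀ j → j < N → alternating j ≡ sign j * u (suc j)
        alternating-below zero l = trans (count-split 0 l) (trans (cong (u 1 +_) u₀) (trans (+-identityʳ _) (sym (*-identityˡ _))))
        alternating-below (suc j) l = begin
          alternating j + - sign j * count (suc j) ≡⟨ cong₂ (λ m n → m + - sign j * n) (alternating-below j (ℕₚ.<-trans (ℕₚ.n<1+n j) l)) (count-split (suc j) l) ⟩
          sign j * u (suc j) + - sign j * (u (suc (suc j)) + u (suc j))
            ≡⟨ solve 3 (λ g x y → g :* x :+ (:- g) :* (y :+ x) := (:- g) :* y) refl (sign j) _ _ ⟩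
          - sign j * u (suc (suc j)) ∎

      -- The transpose of `defect`, with the row index first. On chains with `N` vertices it
      -- projects onto the cycles, since h ∂ kills those.
      projection : Chain → Chain → R
      projection σ τ = defect {A} {s} {t} b τ σ

      -- Squaring 1 - h ∂ leaves the error h ∂ (1 - h ∂), and the image of 1 - h ∂ consists of
      -- cycles by `defect-cycle`.
      projection-idempotent : ∀ σ τ → Valid A t s σ → length σ ≡ N →
        ∑ (chains A t N s) (λ υ → projection σ υ * projection υ τ) ≡ projection σ τ
      projection-idempotent σ τ v refl = begin
        ∑ cs (λ υ → defect {A} {s} {t} b υ σ * defect {A} {s} {t} b τ υ) ≡⟨ ∑-cong cs (λ υ → *-comm _ _) ⟩
        ∑ cs (λ υ → defect {A} {s} {t} b τ υ * defect {A} {s} {t} b υ σ) ≡⟨ defect-expand b (defect {A} {s} {t} b τ) σ v ⟩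
        defect {A} {s} {t} b τ σ - h A t s b (D A t s (defect {A} {s} {t} b τ)) σ
          ≡⟨ cong (λ m → defect {A} {s} {t} b τ σ - m) (h-zero σ (λ σ′ v′ e → defect-cycle H τ σ′ v′ e)) ⟩
        defect {A} {s} {t} b τ σ - 0# ≡⟨ solve 1 (λ a → a :- con ℤ.0ℤ := a) refl _ ⟩
        defect {A} {s} {t} b τ σ ∎
        where cs = chains A t (length σ) s

      -- The homotopy identity stops before degree `N`, so after telescoping that degree contributes
      -- the trace of 1 - h ∂ instead of cancelling.
      alternating-trace : alternating N ≡ sign N * ∑ (chains A t N s) (λ σ → projection σ σ)
      alternating-trace = trans (lemma N (λ j → alternating-below j)) (cong (sign N *_) (begin
        count N - u N ≡⟨ cong (λ m → count N + m) (sym (∑-neg cs _)) ⟩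
        count N + ∑ cs (λ σ → - h A t s b (D A t s (δ σ)) σ) ≡⟨ sym (∑-+ cs _ _) ⟩
        ∑ cs (λ σ → 1# + - h A t s b (D A t s (δ σ)) σ) ≡⟨ ∑-cong cs (λ σ → cong (λ m → m - h A t s b (D A t s (δ σ)) σ) (sym (δ-diag σ))) ⟩
        ∑ cs (λ σ → projection σ σ) ∎))
        where
        cs = chains A t N s
        lemma : ∀ M → (∀ j → j < M → alternating j ≡ sign j * u (suc j)) → alternating M ≡ sign M * (count M - u M)
        lemma zero _ = begin
          count 0 ≡⟨ solve 1 (λ a → a := con ℤ.1ℤ :* (a :- con ℤ.0ℤ)) refl _ ⟩
          1# * (count 0 - 0#) ≡⟨ cong (λ m → 1# * (count 0 - m)) (sym u₀) ⟩
          1# * (count 0 - u 0) ∎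
        lemma (suc M) below = begin
          alternating M + - sign M * count (suc M) ≡⟨ cong (_+ - sign M * count (suc M)) (below M ℕₚ.≤-refl) ⟩
          sign M * u (suc M) + - sign M * count (suc M) ≡⟨ solve 3 (λ g x y → g :* x :+ (:- g) :* y := (:- g) :* (y :- x)) refl (sign M) _ _ ⟩
          - sign M * (count (suc M) - u (suc M)) ∎

-- Traces of idempotent matrices

module IdempotentTrace {r} {R : Set r} {plus times : R → R → R} {neg : R → R} {0# 1# : R}
    (isCommutativeRing : IsCommutativeRing _≡_ plus times neg 0# 1#)
    (_≟0 : ∀ x → Dec (x ≡ 0#)) (inverse : ∀ x → x ≢ 0# → ∃[ y ] times x y ≡ 1#)
    (Nonneg : R → Set) (nonneg-0 : Nonneg 0#) (nonneg-+ : ∀ {x y} → Nonneg x → Nonneg y → Nonneg (plus x y))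
    (nonneg-² : ∀ x → Nonneg (times x x))
    (nonneg-+-zero : ∀ {x y} → Nonneg x → Nonneg y → plus x y ≡ 0# → x ≡ 0# × y ≡ 0#)
    (²-zero : ∀ x → times x x ≡ 0# → x ≡ 0#) where

  ring : CommutativeRing _ _
  ring = record { isCommutativeRing = isCommutativeRing }
  open CommutativeRing ring using (_+_; _*_; -_; _-_; +-identityʳ; zeroˡ; zeroʳ; -‿inverseʳ; *-assoc; *-comm; *-identityˡ)
  open Sums ring
  open ℤ-Solver ring
  open ≡-Reasoning

  module _ {i} {I : Set i} (xs : List I) where

    ∈-self : All (_∈ xs) xs
    ∈-self = All.tabulate id

    dot : (I → R) → (I → R) → R
    dot a b = ∑ xs (λ k → a k * b k)

    dot-comm : ∀ a b → dot a b ≡ dot b a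
    dot-comm a b = ∑-cong xs (λ k → *-comm _ _)

    dot-cong : ∀ {a a′ b b′} → (∀ k → k ∈ xs → a k ≡ a′ k) → (∀ k → k ∈ xs → b k ≡ b′ k) → dot a b ≡ dot a′ b′
    dot-cong e f = ∑-congᴬ ∈-self (λ k k∈ → cong₂ _*_ (e k k∈) (f k k∈))

    dot-congʳ : ∀ {a b b′} → (∀ k → k ∈ xs → b k ≡ b′ k) → dot a b ≡ dot a b′
    dot-congʳ = dot-cong (λ _ _ → refl)

    dot-- : ∀ a b b′ → dot a (λ k → b k - b′ k) ≡ dot a b - dot a b′
    dot-- a b b′ = trans (∑-cong xs (λ k → solve 3 (λ x y z → x :* (y :- z) := x :* y :+ :- (x :* z)) refl (a k) _ _))
      (trans (∑-+ xs _ _) (cong (dot a b +_) (∑-neg xs _)))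

    dot-+* : ∀ a b c d → dot a (λ k → b k + c * d k) ≡ dot a b + c * dot a d
    dot-+* a b c d = trans (∑-cong xs (λ k → solve 4 (λ x y z w → x :* (y :+ z :* w) := x :* y :+ z :* (x :* w)) refl (a k) (b k) c (d k)))
      (trans (∑-+ xs _ _) (cong (dot a b +_) (∑-*ˡ xs c _)))

    dot-adjoint : ∀ (E : I → I → R) → (∀ k l → E k l ≡ E l k) → ∀ a b → dot (λ k → dot (E k) a) b ≡ dot a (λ k → dot (E k) b)
    dot-adjoint E E-sym a b = begin
      ∑ xs (λ k → ∑ xs (λ l → E k l * a l) * b k) ≡⟨ ∑-cong xs (λ k → sym (∑-*ʳ xs _ _)) ⟩
      ∑ xs (λ k → ∑ xs (λ l → E k l * a l * b k)) ≡⟨ ∑-swap xs xs _ ⟩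
      ∑ xs (λ l → ∑ xs (λ k → E k l * a l * b k)) ≡⟨ ∑-cong xs (λ l → ∑-cong xs (λ k →
        trans (cong (λ m → m * a l * b k) (E-sym k l)) (solve 3 (λ x y z → x :* y :* z := y :* (x :* z)) refl _ _ _))) ⟩
      ∑ xs (λ l → ∑ xs (λ k → a l * (E l k * b k))) ≡⟨ ∑-cong xs (λ l → ∑-*ˡ xs _ _) ⟩
      ∑ xs (λ l → a l * dot (E l) b) ∎

    ∑-nonneg : ∀ ys {f : I → R} → (∀ k → Nonneg (f k)) → Nonneg (∑ ys f)
    ∑-nonneg [] n = nonneg-0
    ∑-nonneg (y ∷ ys) n = nonneg-+ (n y) (∑-nonneg ys n)

    dot-definite : ∀ a → dot a a ≡ 0# → ∀ k → k ∈ xs → a k ≡ 0#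
    dot-definite a = go xs
      where
      go : ∀ ys → ∑ ys (λ k → a k * a k) ≡ 0# → ∀ k → k ∈ ys → a k ≡ 0#
      go (y ∷ ys) e k k∈ with nonneg-+-zero (nonneg-² (a y)) (∑-nonneg ys (λ k → nonneg-² (a k))) e | k∈
      ... | e₁ , _ | here refl = ²-zero _ e₁
      ... | _ , e₂ | there k∈′ = go ys e₂ k k∈′

    module _ (p : I → I → R) (idempotent : ∀ k l → k ∈ xs → dot (p k) (λ m → p m l) ≡ p k l) where

      -- The orthogonal projection E onto the span of the columns ys of p.
      record ColumnProjection (ys : List I) : Set (r Level.⊔ i) where
        field
          E : I → I → R
          E-sym : ∀ k l → E k l ≡ E l k
          E-idem : ∀ k l → dot (E k) (λ m → E m l) ≡ E k l
          E-range : ∀ k l → k ∈ xs → dot (p k) (λ m → E m l) ≡ E k l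
          E-fixes : All (λ y → ∀ k → k ∈ xs → dot (E k) (λ m → p m y) ≡ p k y) ys

      columnProjection : ∀ ys → ColumnProjection ys
      columnProjection [] = record
        { E = λ _ _ → 0# ; E-sym = λ _ _ → refl
        ; E-idem = λ _ _ → trans (∑-cong xs (λ _ → zeroˡ _)) (∑-zero xs)
        ; E-range = λ _ _ _ → trans (∑-cong xs (λ _ → zeroʳ _)) (∑-zero xs) ; E-fixes = [] }
      columnProjection (y ∷ ys) = extend (dot u u ≟0)
        where
        open ColumnProjection (columnProjection ys)
        v u : I → R
        v k = p k y
        u k = v k - dot (E k) v

        EE : ∀ (a : I → R) k → dot (E k) (λ m → dot (E m) a) ≡ dot (E k) a
        EE a k = trans (sym (dot-adjoint E E-sym (E k) a))
          (dot-cong (λ m _ → trans (dot-comm _ _) (trans (dot-congʳ (λ l _ → E-sym m l)) (E-idem k m))) (λ _ _ → refl))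

        Eu : ∀ k → dot (E k) u ≡ 0#
        Eu k = trans (dot-- (E k) v _) (trans (cong (λ m → dot (E k) v - m) (EE v k)) (-‿inverseʳ _))

        u⊥ : ∀ {z} → (∀ k → k ∈ xs → dot (E k) (λ m → p m z) ≡ p k z) → dot u (λ m → p m z) ≡ 0#
        u⊥ {z} fix = begin
          dot u w ≡⟨ trans (dot-comm u w) (dot-- w v _) ⟩
          dot w v - dot w (λ k → dot (E k) v) ≡⟨ cong (λ m → dot w v - m) (trans (sym (dot-adjoint E E-sym w v)) (dot-cong fix (λ _ _ → refl))) ⟩
          dot w v - dot w v ≡⟨ -‿inverseʳ _ ⟩
          0# ∎
          where w = λ m → p m z

        uv : dot u v ≡ dot u u
        uv = begin
          dot u v ≡⟨ solve 2 (λ a b → a := (a :- b) :+ b) refl (dot u v) (dot u (λ k → dot (E k) v)) ⟩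
          (dot u v - dot u (λ k → dot (E k) v)) + dot u (λ k → dot (E k) v)
            ≡⟨ cong₂ _+_ (sym (dot-- u v _)) (trans (sym (dot-adjoint E E-sym u v)) (trans (dot-cong (λ k _ → Eu k) (λ _ _ → refl))
                 (trans (∑-cong xs (λ _ → zeroˡ _)) (∑-zero xs)))) ⟩
          dot u u + 0# ≡⟨ +-identityʳ _ ⟩
          dot u u ∎

        -- `v` is a column of `p` and `E-range` puts the columns of `E` into its range, so the
        -- residual `u` lies there too.
        pu : ∀ k → k ∈ xs → dot (p k) u ≡ u k
        pu k k∈ = trans (dot-- (p k) v _) (cong₂ _-_ (idempotent k y k∈) (begin
          ∑ xs (λ m → p k m * ∑ xs (λ l → E m l * v l)) ≡⟨ ∑-cong xs (λ m → trans (sym (∑-*ˡ xs _ _)) (∑-cong xs (λ l → sym (*-assoc _ _ _)))) ⟩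
          ∑ xs (λ m → ∑ xs (λ l → p k m * E m l * v l)) ≡⟨ ∑-swap xs xs _ ⟩
          ∑ xs (λ l → ∑ xs (λ m → p k m * E m l * v l)) ≡⟨ ∑-cong xs (λ l → trans (∑-*ʳ xs _ _) (cong (_* v l) (E-range k l k∈))) ⟩
          dot (E k) v ∎))

        extend : Dec (dot u u ≡ 0#) → ColumnProjection (y ∷ ys)
        -- By definiteness `u` vanishes on `xs`: the new column already lies in the range of `E`.
        extend (yes uu≡0) = record { E = E ; E-sym = E-sym ; E-idem = E-idem ; E-range = E-range
          ; E-fixes = (λ k k∈ → trans (solve 2 (λ a b → a := b :- (b :- a)) refl _ (v k))
              (trans (cong (λ m → v k - m) (dot-definite u uu≡0 k k∈)) (solve 1 (λ a → a :- con ℤ.0ℤ := a) refl _))) ∷ E-fixes }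
        -- Gram-Schmidt: `u` is the part of the new column orthogonal to the range of `E`, so the
        -- rank-one projection along `u`, normalised by `c` = 1 / (u · u), can be added without
        -- cross terms.
        extend (no uu≢0) = record { E = E′
          ; E-sym = λ k l → cong₂ _+_ (E-sym k l) (cong (c *_) (*-comm _ _))
          ; E-idem = λ k l → trans (E′-dot k _) (trans (cong₂ (λ m n → m + c * u k * n)
                (trans (E′-column (E k) l) (cong₂ (λ m n → m + c * u l * n) (E-idem k l) (Eu k)))
                (trans (E′-column u l) (cong (_+ c * u l * dot u u) (u-E l))))
              (trans (solve 5 (λ e c a b d → (e :+ c :* b :* con ℤ.0ℤ) :+ c :* a :* (con ℤ.0ℤ :+ c :* b :* d) := e :+ (d :* c) :* (c :* (a :* b)))
                  refl (E k l) c (u k) (u l) (dot u u))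
                (cong (E k l +_) (trans (cong (_* (c * (u k * u l))) uuc) (*-identityˡ _)))))
          ; E-range = λ k l k∈ → trans (E′-column (p k) l) (trans (cong₂ (λ m n → m + c * u l * n) (E-range k l k∈) (pu k k∈))
              (solve 4 (λ e c a b → e :+ c :* b :* a := e :+ c :* (a :* b)) refl _ c (u k) (u l)))
          ; E-fixes = (λ k k∈ → trans (E′-dot k v) (trans (cong (λ m → dot (E k) v + c * u k * m) uv)
                (trans (solve 4 (λ e c a d → e :+ c :* a :* d := e :+ (d :* c) :* a) refl _ c (u k) (dot u u))
                  (trans (cong (λ m → dot (E k) v + m * u k) uuc) (solve 2 (λ e b → e :+ con ℤ.1ℤ :* (b :- e) := b) refl _ _)))))
              ∷ All.map (λ {z} fix k k∈ → trans (E′-dot k _) (trans (cong₂ (λ m n → m + c * u k * n) (fix k k∈) (u⊥ fix))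
                  (trans (cong (p k z +_) (zeroʳ _)) (+-identityʳ _)))) E-fixes }
          where
          c = proj₁ (inverse (dot u u) uu≢0)
          uuc : dot u u * c ≡ 1#
          uuc = proj₂ (inverse (dot u u) uu≢0)
          E′ : I → I → R
          E′ k l = E k l + c * (u k * u l)
          E′-dot : ∀ k a → dot (E′ k) a ≡ dot (E k) a + c * u k * dot u a
          E′-dot k a = trans (dot-comm _ a) (trans (dot-congʳ (λ l _ → cong (E k l +_) (sym (*-assoc c (u k) (u l)))))
            (trans (dot-+* a (E k) (c * u k) u) (cong₂ (λ m n → m + c * u k * n) (dot-comm a _) (dot-comm a u))))
          E′-column : ∀ a l → dot a (λ m → E′ m l) ≡ dot a (λ m → E m l) + c * u l * dot a u
          E′-column a l = trans (dot-congʳ (λ m _ → cong (E m l +_) (solve 3 (λ c a b → c :* (a :* b) := c :* b :* a) refl c (u m) (u l))))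
            (dot-+* a (λ m → E m l) (c * u l) u)
          u-E : ∀ l → dot u (λ m → E m l) ≡ 0#
          u-E l = trans (dot-congʳ (λ m _ → E-sym m l)) (trans (dot-comm _ _) (Eu l))

      -- tr p = tr (E p) = tr (p E) = tr E, and tr E is the sum of the squares of the entries of E.
      trace-nonneg : Nonneg (∑ xs (λ k → p k k))
      trace-nonneg = subst Nonneg (sym (begin
        ∑ xs (λ k → p k k) ≡⟨ ∑-congᴬ ∈-self (λ k k∈ → sym (All.lookup E-fixes k∈ k k∈)) ⟩
        ∑ xs (λ k → ∑ xs (λ m → E k m * p m k)) ≡⟨ ∑-swap xs xs _ ⟩
        ∑ xs (λ m → ∑ xs (λ k → E k m * p m k)) ≡⟨ ∑-congᴬ ∈-self (λ m m∈ → trans (∑-cong xs (λ _ → *-comm _ _)) (E-range m m m∈)) ⟩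
        ∑ xs (λ m → E m m) ≡⟨ ∑-cong xs (λ m → sym (E-idem m m)) ⟩
        ∑ xs (λ m → ∑ xs (λ k → E m k * E k m)) ≡⟨ ∑-cong xs (λ m → ∑-cong xs (λ k → cong (E m k *_) (E-sym k m))) ⟩
        ∑ xs (λ m → ∑ xs (λ k → E m k * E m k)) ∎))
        (∑-nonneg xs (λ m → ∑-nonneg xs (λ k → nonneg-² (E m k))))
        where open ColumnProjection (columnProjection xs)

-- The strict order and the homology of intervals

module PosetOrder {n} (P : GradedBoundedPoset n) where
  open GradedBoundedPoset P

  T-not : ∀ {b} → T (not b) → T b → ⊥
  T-not {true} ()
  T-not {false} _ ()

  T-not⁺ : ∀ {b} → (T b → ⊥) → T (not b)
  T-not⁺ {true} f = f tt
  T-not⁺ {false} f = tt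

  eqb⁻ : ∀ {a b} → T (eqb a b) → a ≡ b
  eqb⁻ {a} {b} p = toWitness {a? = a Fin.≟ b} p

  eqb⁺ : ∀ {a b} → a ≡ b → T (eqb a b)
  eqb⁺ {a} {b} e = fromWitness {a? = a Fin.≟ b} e

  lt⁻ : ∀ {a b} → T (lt a b) → T (le a b) × a ≢ b
  lt⁻ {a} {b} p = let (x , y) = T-∧⁻ {le a b} p in x , λ e → T-not y (eqb⁺ e)

  lt⁺ : ∀ {a b} → T (le a b) → a ≢ b → T (lt a b)
  lt⁺ l ne = T-∧⁺ l (T-not⁺ (λ e → ne (eqb⁻ e)))

  lt-irrefl : ∀ {a} → T (lt a a) → ⊥
  lt-irrefl p = proj₂ (lt⁻ p) refl

  le-lt-trans : ∀ {a b c} → T (le a b) → T (lt b c) → T (lt a c)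
  le-lt-trans {a} {b} {c} ab bc = let (x , ne) = lt⁻ bc in
    lt⁺ (le-trans a b c ab x) (λ { refl → ne (le-antisym b c x ab) })

  lt-le-trans : ∀ {a b c} → T (lt a b) → T (le b c) → T (lt a c)
  lt-le-trans {a} {b} {c} ab bc = let (x , ne) = lt⁻ ab in
    lt⁺ (le-trans a b c x bc) (λ { refl → ne (le-antisym a b x bc) })

  lt-trans : ∀ {a b c} → T (lt a b) → T (lt b c) → T (lt a c)
  lt-trans ab bc = lt-le-trans ab (proj₁ (lt⁻ bc))

module HomologyOfIntervals {n} (P : GradedBoundedPoset n) where
  open GradedBoundedPoset P
  open PosetOrder P
  open ChainComplex ℚₚ.+-*-isCommutativeRing lt lt-trans
  open Sums ring
  open ≡-Reasoning

  everything : Fin n → Bool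
  everything _ = true

  sumℚ-map : ∀ {a} {A : Set a} (xs : List A) f → sumℚ P (map f xs) ≡ ∑ xs f
  sumℚ-map [] f = refl
  sumℚ-map (x ∷ xs) f = cong (f x ℚ.+_) (sumℚ-map xs f)

  ∑-allVecs-suc : ∀ j (f : Vec (Fin n) (suc j) → ℚ) →
    ∑ (allVecs P (suc j)) f ≡ ∑ (allVecs P j) (λ v → ∑ (allFin n) (λ x → f (x ∷ v)))
  ∑-allVecs-suc j f = trans (∑-concatMap (allVecs P j) _ f) (∑-cong (allVecs P j) (λ v → ∑-map (allFin n) (_∷ v) f))

  eqVec-∷ : ∀ {j} x a (v σ : Vec (Fin n) j) → eqVec P (x ∷ v) (a ∷ σ) ≡ ⌊ x Fin.≟ a ⌋ ∧ eqVec P v σ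
  eqVec-∷ x a v σ = T-ext
    (λ p → let e = toWitness {a? = Vecₚ.≡-dec Fin._≟_ (x ∷ v) (a ∷ σ)} p in
       T-∧⁺ (eqb⁺ (Vecₚ.∷-injectiveˡ e)) (fromWitness {a? = Vecₚ.≡-dec Fin._≟_ v σ} (Vecₚ.∷-injectiveʳ e)))
    (λ p → let (e , f) = T-∧⁻ {eqb x a} p in
       fromWitness {a? = Vecₚ.≡-dec Fin._≟_ (x ∷ v) (a ∷ σ)} (cong₂ _∷_ (eqb⁻ e) (toWitness {a? = Vecₚ.≡-dec Fin._≟_ v σ} f)))

  ∑-eqVec : ∀ {j} x a (v σ : Vec (Fin n) j) y → eqVec P (x ∷ v) (a ∷ σ) ⊳ y ≡ ⌊ x Fin.≟ a ⌋ ⊳ eqVec P v σ ⊳ y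
  ∑-eqVec x a v σ y = trans (cong (_⊳ y) (eqVec-∷ x a v σ)) (sym (⊳-∧ (eqb x a) _ y))

  ∑-pick-vec : ∀ {j} (σ : Vec (Fin n) j) (f : Vec (Fin n) j → ℚ) → ∑ (allVecs P j) (λ v → eqVec P v σ ⊳ f v) ≡ f σ
  ∑-pick-vec [] f = ℚₚ.+-identityʳ _
  ∑-pick-vec {suc j} (a ∷ σ) f = begin
    ∑ (allVecs P (suc j)) (λ v → eqVec P v (a ∷ σ) ⊳ f v) ≡⟨ ∑-allVecs-suc j _ ⟩
    ∑ (allVecs P j) (λ v → ∑ (allFin n) (λ x → eqVec P (x ∷ v) (a ∷ σ) ⊳ f (x ∷ v)))
      ≡⟨ ∑-cong (allVecs P j) (λ v → trans (∑-cong (allFin n) (λ x → ∑-eqVec x a v σ _)) (∑-pick a _)) ⟩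
    ∑ (allVecs P j) (λ v → eqVec P v σ ⊳ f (a ∷ v)) ≡⟨ ∑-pick-vec σ _ ⟩
    f (a ∷ σ) ∎

  insertions : ∀ {j} → Vec (Fin n) j → (ℕ → Vec (Fin n) (suc j) → ℚ) → ℚ
  insertions [] g = ∑ (allFin n) (λ x → g 0 (x ∷ []))
  insertions (a ∷ σ) g = ∑ (allFin n) (λ x → g 0 (x ∷ a ∷ σ)) ℚ.+ insertions σ (λ i τ → g (suc i) (a ∷ τ))

  insertions-cong : ∀ {j} (σ : Vec (Fin n) j) {g g′} → (∀ i τ → g i τ ≡ g′ i τ) → insertions σ g ≡ insertions σ g′
  insertions-cong [] e = ∑-cong (allFin n) (λ x → e 0 _)
  insertions-cong (a ∷ σ) e = cong₂ ℚ._+_ (∑-cong (allFin n) (λ x → e 0 _)) (insertions-cong σ (λ i τ → e (suc i) _))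

  insertions-neg : ∀ {j} (σ : Vec (Fin n) j) g → insertions σ (λ i τ → ℚ.- g i τ) ≡ ℚ.- insertions σ g
  insertions-neg [] g = ∑-neg (allFin n) _
  insertions-neg (a ∷ σ) g = trans (cong₂ ℚ._+_ (∑-neg (allFin n) _) (insertions-neg σ _)) (sym (ℚₚ.neg-distrib-+ (∑ (allFin n) (λ x → g 0 (x ∷ a ∷ σ))) (insertions σ (λ i τ → g (suc i) (a ∷ τ)))))

  -- The pairs of a vector `τ` and a position whose removal gives `σ` are the insertions into `σ`.
  -- Position 0 leaves the head of `τ` free and fixes its tail; any later position forces the head
  -- to be `a`.
  facets≡insertions : ∀ {j} (σ : Vec (Fin n) j) (g : ℕ → Vec (Fin n) (suc j) → ℚ) →
    ∑ (allVecs P (suc j)) (λ τ → ∑ (allFin (suc j)) (λ i → eqVec P (removeAt τ i) σ ⊳ g (toℕ i) τ)) ≡ insertions σ g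
  facets≡insertions {zero} [] g = begin
    _ ≡⟨ ∑-allVecs-suc 0 _ ⟩
    ∑ (allFin n) (λ x → g 0 (x ∷ []) ℚ.+ 0ℚ) ℚ.+ 0ℚ ≡⟨ trans (ℚₚ.+-identityʳ _) (∑-cong (allFin n) (λ x → ℚₚ.+-identityʳ _)) ⟩
    ∑ (allFin n) (λ x → g 0 (x ∷ [])) ∎
  facets≡insertions {suc j} (a ∷ σ) g = begin
    _ ≡⟨ trans (∑-allVecs-suc (suc j) _) (∑-cong (allVecs P (suc j)) (λ v → ∑-cong (allFin n) (λ x → ∑-allFin-suc (suc j) (λ i → eqVec P (removeAt (x ∷ v) i) (a ∷ σ) ⊳ g (toℕ i) (x ∷ v))))) ⟩
    ∑ (allVecs P (suc j)) (λ v → ∑ (allFin n) (λ x → (eqVec P v (a ∷ σ) ⊳ g 0 (x ∷ v)) ℚ.+ rest x v))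
      ≡⟨ trans (∑-cong (allVecs P (suc j)) (λ v → ∑-+ (allFin n) _ _)) (∑-+ (allVecs P (suc j)) _ _) ⟩
    ∑ (allVecs P (suc j)) (λ v → ∑ (allFin n) (λ x → eqVec P v (a ∷ σ) ⊳ g 0 (x ∷ v))) ℚ.+ ∑ (allVecs P (suc j)) (λ v → ∑ (allFin n) (λ x → rest x v))
      ≡⟨ cong₂ ℚ._+_
           (trans (∑-cong (allVecs P (suc j)) (λ v → ∑-⊳ (allFin n) (eqVec P v (a ∷ σ)) _)) (∑-pick-vec (a ∷ σ) _))
           (trans (∑-cong (allVecs P (suc j)) (λ v → pull v)) (facets≡insertions σ (λ i τ → g (suc i) (a ∷ τ)))) ⟩
    insertions (a ∷ σ) g ∎
    where
    rest : Fin n → Vec (Fin n) (suc j) → ℚ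
    rest x v = ∑ (allFin (suc j)) (λ i → eqVec P (removeAt (x ∷ v) (Fin.suc i)) (a ∷ σ) ⊳ g (suc (toℕ i)) (x ∷ v))
    pull : ∀ v → ∑ (allFin n) (λ x → rest x v) ≡ ∑ (allFin (suc j)) (λ i → eqVec P (removeAt v i) σ ⊳ g (suc (toℕ i)) (a ∷ v))
    pull v@(_ ∷ _) = trans (∑-cong (allFin n) (λ x → trans (∑-cong (allFin (suc j)) (λ i → ∑-eqVec x a (removeAt v i) σ _)) (∑-⊳ (allFin (suc j)) (eqb x a) _)))
      (∑-pick a _)

  valid : Fin n → Fin n → List (Fin n) → Bool
  valid t s [] = true
  valid t s (a ∷ σ) = between everything s t a ∧ valid t a σ

  valid⁻ : ∀ t s σ → T (valid t s σ) → Valid everything t s σ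
  valid⁻ t s [] p = tt
  valid⁻ t s (a ∷ σ) p = let (x , y) = T-∧⁻ {between everything s t a} p in x , valid⁻ t a σ y

  valid⁺ : ∀ t s σ → Valid everything t s σ → T (valid t s σ)
  valid⁺ t s [] v = tt
  valid⁺ t s (a ∷ σ) (p , v) = T-∧⁺ p (valid⁺ t a σ v)

  simplex⁻ : ∀ {j} s t (v : Vec (Fin n) j) → T (simplex P s t v) → Valid everything t s (toList v)
  simplex⁻ s t [] p = tt
  simplex⁻ s t (a ∷ v) p = let (q , i) = T-∧⁻ {allIn P s t (a ∷ v)} p ; (q₁ , q₂) = T-∧⁻ {inOpen P s t a} q
                               (sa , at) = T-∧⁻ {lt s a} q₁ in
      T-∧⁺ sa (T-∧⁺ at tt) , go a v q₂ i
    where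
    go : ∀ {j} a (v : Vec (Fin n) j) → T (allIn P s t v) → T (increasing P (a ∷ v)) → Valid everything t a (toList v)
    go a [] q i = tt
    go a (b ∷ v) q i = let (q₁ , q₂) = T-∧⁻ {inOpen P s t b} q ; (_ , bt) = T-∧⁻ {lt s b} q₁ ; (ab , i′) = T-∧⁻ {lt a b} i in
      T-∧⁺ ab (T-∧⁺ bt tt) , go b v q₂ i′

  simplex⁺ : ∀ {j} s t (v : Vec (Fin n) j) → Valid everything t s (toList v) → T (simplex P s t v)
  simplex⁺ s t v w = T-∧⁺ (allIn⁺ s id v w) (inc s v w)
    where
    allIn⁺ : ∀ {j} a → (∀ {b} → T (lt a b) → T (lt s b)) → (v : Vec (Fin n) j) → Valid everything t a (toList v) → T (allIn P s t v)
    allIn⁺ a f [] w = tt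
    allIn⁺ a f (b ∷ v) (p , w) = let (ab , q) = T-∧⁻ {lt a b} p ; (bt , _) = T-∧⁻ {lt b t} q in
      T-∧⁺ (T-∧⁺ (f ab) bt) (allIn⁺ b (λ bc → f (lt-trans ab bc)) v w)
    inc : ∀ {j} a (v : Vec (Fin n) j) → Valid everything t a (toList v) → T (increasing P v)
    inc a [] w = tt
    inc a (b ∷ []) w = tt
    inc a (b ∷ c ∷ v) (_ , p , w) = T-∧⁺ (proj₁ (T-∧⁻ {lt b c} p)) (inc b (c ∷ v) (p , w))

  simplex≡valid : ∀ {j} s t (v : Vec (Fin n) j) → simplex P s t v ≡ valid t s (toList v)
  simplex≡valid s t v = T-ext (λ p → valid⁺ t s (toList v) (simplex⁻ s t v p)) (λ p → simplex⁺ s t v (valid⁻ t s (toList v) p))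

  -- Insertions that are not simplices weigh 0. In a valid chain an inserted vertex need only be
  -- compared with its two neighbours, which are the guards of `D`.
  insertions≡D : ∀ {j} t s (σ : Vec (Fin n) j) (f : Chain → ℚ) → Valid everything t s (toList σ) →
    insertions σ (λ i τ → sgn P i ℚ.* (valid t s (toList τ) ⊳ f (toList τ))) ≡ D everything t s f (toList σ)
  insertions≡D t s [] f v = ∑-cong (allFin n) (λ x → trans (ℚₚ.*-identityˡ _) (cong (_⊳ f (x ∷ [])) (T-ext (proj₁ ∘ T-∧⁻ {between everything s t x}) (λ p → T-∧⁺ p tt))))
  insertions≡D t s (a ∷ σ) f (p , v) = cong₂ ℚ._+_
    (∑-cong (allFin n) (λ x → trans (ℚₚ.*-identityˡ _) (cong (_⊳ f (x ∷ a ∷ toList σ)) (first x))))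
    (begin
      insertions σ (λ i τ → (ℚ.- sgn P i) ℚ.* (valid t s (a ∷ toList τ) ⊳ f (a ∷ toList τ)))
        ≡⟨ insertions-cong σ (λ i τ → trans (sym (ℚₚ.neg-distribˡ-* (sgn P i) _)) (cong (λ b → ℚ.- (sgn P i ℚ.* (b ⊳ f (a ∷ toList τ)))) (later (toList τ)))) ⟩
      insertions σ (λ i τ → ℚ.- (sgn P i ℚ.* (valid t a (toList τ) ⊳ f (a ∷ toList τ)))) ≡⟨ insertions-neg σ _ ⟩
      ℚ.- insertions σ (λ i τ → sgn P i ℚ.* (valid t a (toList τ) ⊳ f (a ∷ toList τ))) ≡⟨ cong ℚ.-_ (insertions≡D t a σ (λ τ → f (a ∷ τ)) v) ⟩
      ℚ.- D everything t a (λ τ → f (a ∷ τ)) (toList σ) ∎)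
    where
    at = proj₁ (T-∧⁻ {lt a t} (proj₂ (T-∧⁻ {lt s a} p)))
    first : ∀ x → valid t s (x ∷ a ∷ toList σ) ≡ between everything s a x
    first x = T-ext
      (λ q → let (q₁ , q₂) = T-∧⁻ {between everything s t x} q ; (sx , _) = T-∧⁻ {lt s x} q₁
                 (q₃ , _) = T-∧⁻ {between everything x t a} q₂ ; (xa , _) = T-∧⁻ {lt x a} q₃ in T-∧⁺ sx (T-∧⁺ xa tt))
      (λ q → let (sx , q₁) = T-∧⁻ {lt s x} q ; (xa , _) = T-∧⁻ {lt x a} q₁ in
        T-∧⁺ (T-∧⁺ sx (T-∧⁺ (lt-trans xa at) tt)) (T-∧⁺ (T-∧⁺ xa (T-∧⁺ at tt)) (valid⁺ t a (toList σ) v)))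
    later : ∀ τ → valid t s (a ∷ τ) ≡ valid t a τ
    later τ = T-ext (proj₂ ∘ T-∧⁻ {between everything s t a}) (T-∧⁺ p)

  ∂≡D : ∀ {j} s t (c : Vec (Fin n) (suc j) → ℚ) (f : Chain → ℚ) → (∀ τ → f (toList τ) ≡ c τ) →
    (σ : Vec (Fin n) j) → T (simplex P s t σ) → ∂ P s t j c σ ≡ D everything t s f (toList σ)
  ∂≡D {j} s t c f agree σ p = begin
    ∂ P s t j c σ ≡⟨ sumℚ-map (allVecs P (suc j)) _ ⟩
    ∑ (allVecs P (suc j)) (λ τ → simplex P s t τ ⊳ sumℚ P (map (λ i → eqVec P (removeAt τ i) σ ⊳ (sgn P (toℕ i) ℚ.* c τ)) (allFin (suc j))))
      ≡⟨ ∑-cong (allVecs P (suc j)) (λ τ → trans (cong (simplex P s t τ ⊳_) (sumℚ-map (allFin (suc j)) (λ i → eqVec P (removeAt τ i) σ ⊳ (sgn P (toℕ i) ℚ.* c τ))))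
           (trans (sym (∑-⊳ (allFin (suc j)) (simplex P s t τ) _)) (∑-cong (allFin (suc j)) (λ i → inner τ i)))) ⟩
    ∑ (allVecs P (suc j)) (λ τ → ∑ (allFin (suc j)) (λ i → eqVec P (removeAt τ i) σ ⊳ (sgn P (toℕ i) ℚ.* (valid t s (toList τ) ⊳ f (toList τ)))))
      ≡⟨ facets≡insertions σ (λ i τ → sgn P i ℚ.* (valid t s (toList τ) ⊳ f (toList τ))) ⟩
    insertions σ (λ i τ → sgn P i ℚ.* (valid t s (toList τ) ⊳ f (toList τ))) ≡⟨ insertions≡D t s σ f (simplex⁻ s t σ p) ⟩
    D everything t s f (toList σ) ∎
    where
    ⊳-comm : ∀ a b x → a ⊳ b ⊳ x ≡ b ⊳ a ⊳ x
    ⊳-comm true b x = refl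
    ⊳-comm false true x = refl
    ⊳-comm false false x = refl
    inner : ∀ τ i → simplex P s t τ ⊳ eqVec P (removeAt τ i) σ ⊳ (sgn P (toℕ i) ℚ.* c τ)
                  ≡ eqVec P (removeAt τ i) σ ⊳ (sgn P (toℕ i) ℚ.* (valid t s (toList τ) ⊳ f (toList τ)))
    inner τ i = trans (⊳-comm (simplex P s t τ) (eqVec P (removeAt τ i) σ) (sgn P (toℕ i) ℚ.* c τ)) (cong (eqVec P (removeAt τ i) σ ⊳_)
      (trans (sym (⊳-* (simplex P s t τ) (sgn P (toℕ i)) (c τ))) (cong (sgn P (toℕ i) ℚ.*_) (cong₂ _⊳_ (simplex≡valid s t τ) (sym (agree τ))))))

  -- The value 0 on lists of the wrong length is a default: a filling is evaluated in a single
  -- degree.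
  onLists : ∀ {j} → (Vec (Fin n) j → ℚ) → Chain → ℚ
  onLists {zero} d [] = d []
  onLists {suc j} d (a ∷ σ) = onLists (λ v → d (a ∷ v)) σ
  onLists d _ = 0ℚ

  onLists-toList : ∀ {j} (d : Vec (Fin n) j → ℚ) τ → onLists d (toList τ) ≡ d τ
  onLists-toList d [] = refl
  onLists-toList d (a ∷ τ) = onLists-toList (λ v → d (a ∷ v)) τ

  vanishing : ∀ s t j → ReducedHomologyVanishes P s t j → ∀ c →
    (∀ σ → Valid everything t s σ → suc (length σ) ≡ j → D everything t s c σ ≡ 0ℚ) →
    ∃[ d ] (∀ σ → Valid everything t s σ → length σ ≡ j → D everything t s d σ ≡ c σ)
  vanishing s t j van c cycle with van (c ∘ toList) (is-cycle j cycle)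
    where
    is-cycle : ∀ j → (∀ σ → Valid everything t s σ → suc (length σ) ≡ j → D everything t s c σ ≡ 0ℚ) → Cycle P s t j (c ∘ toList)
    is-cycle zero cycle = tt
    is-cycle (suc j) cycle σ p = trans (∂≡D s t _ c (λ _ → refl) σ p)
      (cycle (toList σ) (simplex⁻ s t σ p) (cong suc (Vecₚ.length-toList σ)))
  ... | d , Hd = onLists d , filled
    where
    filled : ∀ σ → Valid everything t s σ → length σ ≡ j → D everything t s (onLists d) σ ≡ c σ
    filled σ v refl = subst (λ τ → D everything t s (onLists d) τ ≡ c τ) (Vecₚ.toList∘fromList σ)
      (trans (sym (∂≡D s t d (onLists d) (onLists-toList d) (fromList σ) p)) (Hd (fromList σ) p))
      where p = simplex⁺ s t (fromList σ) (subst (Valid everything t s) (sym (Vecₚ.toList∘fromList σ)) v)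

-- Counting and monotonicity of the rank

boolToℕ : Bool → ℕ
boolToℕ b = if b then 1 else 0

boolToℕ-mono : ∀ b d → (T b → T d) → boolToℕ b ≤ boolToℕ d
boolToℕ-mono false d i = z≤n
boolToℕ-mono true true i = ℕₚ.≤-refl
boolToℕ-mono true false i = ⊥-elim (i tt)

module Counting {a} {A : Set a} where

  number : (A → Bool) → List A → ℕ
  number f [] = 0
  number f (x ∷ xs) = boolToℕ (f x) ℕ.+ number f xs

  number-mono : ∀ {f g} → (∀ x → T (f x) → T (g x)) → ∀ xs → number f xs ≤ number g xs
  number-mono e [] = z≤n
  number-mono {f} {g} e (x ∷ xs) = ℕₚ.+-mono-≤ (boolToℕ-mono (f x) (g x) (e x)) (number-mono e xs)

  number-mono-< : ∀ {f g} → (∀ x → T (f x) → T (g x)) → ∀ {c} → T (g c) → ¬ T (f c) → ∀ {xs} → c ∈ xs →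
    number f xs < number g xs
  number-mono-< {f} {g} e {c} gc ¬fc {_ ∷ xs} (here refl) with f c | g c
  ... | false | true = s≤s (number-mono e xs)
  ... | true | _ = ⊥-elim (¬fc tt)
  number-mono-< {f} {g} e gc ¬fc {x ∷ xs} (there c∈) =
    ℕₚ.+-mono-≤-< (boolToℕ-mono (f x) (g x) (e x)) (number-mono-< e gc ¬fc c∈)

module Rank {n} (P : GradedBoundedPoset n) where
  open GradedBoundedPoset P
  open PosetOrder P
  open Counting {A = Fin n}

  inside : Fin n → Fin n → Fin n → Bool
  inside a b c = lt a c ∧ lt c b

  -- The rank is controlled only along covers, so the induction is on the number of elements
  -- strictly inside the interval. An inner `c` splits it into two intervals that no longer contain
  -- `c`.
  ρ-mono-< : ∀ {a b} → T (lt a b) → ρ a < ρ b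
  ρ-mono-< {a} {b} = go (suc (number (inside a b) (allFin n))) a b ℕₚ.≤-refl
    where
    go : ∀ fuel a b → number (inside a b) (allFin n) < fuel → T (lt a b) → ρ a < ρ b
    go (suc fuel) a b l ab with Finₚ.any? (λ c → T? (inside a b c))
    ... | no none = ℕₚ.≤-reflexive (sym (ρ-cover a b (ab , λ c (ac , cb) → none (c , T-∧⁺ ac cb))))
    ... | yes (c , p) = let (ac , cb) = T-∧⁻ {lt a c} p in
      ℕₚ.<-trans (go fuel a c (shrink (λ x q → let (ax , xc) = T-∧⁻ {lt a x} q in T-∧⁺ ax (lt-trans xc cb))
                                      p (λ q → lt-irrefl (proj₂ (T-∧⁻ {lt a c} q)))) ac)
                 (go fuel c b (shrink (λ x q → let (cx , xb) = T-∧⁻ {lt c x} q in T-∧⁺ (lt-trans ac cx) xb)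
                                      p (λ q → lt-irrefl (proj₁ (T-∧⁻ {lt c c} q)))) cb)
      where
      shrink : ∀ {f} → (∀ x → T (f x) → T (inside a b x)) → T (inside a b c) → ¬ T (f c) → number f (allFin n) < fuel
      shrink e p ¬fc = ℕₚ.<-≤-trans (number-mono-< e {c} p ¬fc (∈-allFin c)) (ℕ.s≤s⁻¹ l)

-- Flag h-numbers

bit : List Bool → ℕ → Bool
bit [] i = false
bit (b ∷ bs) zero = b
bit (b ∷ bs) (suc i) = bit bs i

trues : List Bool → ℕ
trues [] = 0
trues (b ∷ bs) = boolToℕ b ℕ.+ trues bs

truesUpTo : List Bool → ℕ → ℕ
truesUpTo bs zero = 0
truesUpTo bs (suc i) = boolToℕ (bit bs i) ℕ.+ truesUpTo bs i

truesUpTo-∷ : ∀ b bs i → truesUpTo (b ∷ bs) (suc i) ≡ boolToℕ b ℕ.+ truesUpTo bs i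
truesUpTo-∷ b bs zero = refl
truesUpTo-∷ b bs (suc i) = trans (cong (boolToℕ (bit bs i) ℕ.+_) (truesUpTo-∷ b bs i))
  (trans (sym (ℕₚ.+-assoc (boolToℕ (bit bs i)) _ _)) (trans (cong (ℕ._+ truesUpTo bs i) (ℕₚ.+-comm (boolToℕ (bit bs i)) (boolToℕ b))) (ℕₚ.+-assoc (boolToℕ b) _ _)))

truesUpTo-length : ∀ bs → truesUpTo bs (length bs) ≡ trues bs
truesUpTo-length [] = refl
truesUpTo-length (b ∷ bs) = trans (truesUpTo-∷ b bs (length bs)) (cong (boolToℕ b ℕ.+_) (truesUpTo-length bs))

-- β l s bs is the flag h-number of the interval (s , top) for the set of ranks l + i with bit bs i true.
module FlagNumbers {c ℓ} (R : CommutativeRing c ℓ) {n} (P : GradedBoundedPoset n) where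
  open GradedBoundedPoset P
  open CommutativeRing R using (Carrier; _-_; 1#)
  open Sums R

  atRank : Fin n → ℕ → Fin n → Bool
  atRank s l x = lt s x ∧ (ρ x ≡ᵇ l)

  β : ℕ → Fin n → List Bool → Carrier
  β l s [] = 1#
  β l s (false ∷ bs) = β (suc l) s bs
  -- Inclusion-exclusion over subsets of the rank set, sorted by whether they contain the lowest
  -- rank `l`: chains then start at some `x` of that rank, or the rank is omitted at the cost of a
  -- sign.
  β l s (true ∷ bs) = ∑ (allFin n) (λ x → atRank s l x ⊳ β (suc l) x bs) - β (suc l) s bs

module FlagNumbers-fromℤ {c ℓ} (R : CommutativeRing c ℓ) {n} (P : GradedBoundedPoset n) where
  open GradedBoundedPoset P
  open CommutativeRing R hiding (sym; trans; refl)
  module R = CommutativeRing R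
  open ℤ-Solver R
  private
    module Z = Sums ℤₚ.+-*-commutativeRing
    module S = Sums R
  module Zβ = FlagNumbers ℤₚ.+-*-commutativeRing P
  module Rβ = FlagNumbers R P

  fromℤ-∑ : ∀ {i} {I : Set i} (xs : List I) f → fromℤ (Z.∑ xs f) ≈ S.∑ xs (λ x → fromℤ (f x))
  fromℤ-∑ [] f = R.refl
  fromℤ-∑ (x ∷ xs) f = R.trans (fromℤ-+ (f x) (Z.∑ xs f)) (+-congˡ (fromℤ-∑ xs f))

  fromℤ-⊳ : ∀ b i → fromℤ (b Z.⊳ i) ≈ b S.⊳ fromℤ i
  fromℤ-⊳ true i = R.refl
  fromℤ-⊳ false i = R.refl

  ⊳-cong′ : ∀ b {x y} → x ≈ y → b S.⊳ x ≈ b S.⊳ y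
  ⊳-cong′ b e = S.⊳-cong b (λ _ → e)

  -- Carries nonnegativity from ℚ to ℤ, and the integers to the coefficients of the Chow polynomial.
  fromℤ-β : ∀ l s bs → fromℤ (Zβ.β l s bs) ≈ Rβ.β l s bs
  fromℤ-β l s [] = R.refl
  fromℤ-β l s (false ∷ bs) = fromℤ-β (suc l) s bs
  fromℤ-β l s (true ∷ bs) = R.trans (fromℤ-+ (Z.∑ (allFin n) _) (ℤ.- Zβ.β (suc l) s bs))
    (+-cong (R.trans (fromℤ-∑ (allFin n) _) (S.∑-cong (allFin n) (λ x →
              R.trans (fromℤ-⊳ (Zβ.atRank s l x) (Zβ.β (suc l) x bs)) (⊳-cong′ (Zβ.atRank s l x) (fromℤ-β (suc l) x bs)))))
            (R.trans (fromℤ-neg (Zβ.β (suc l) s bs)) (-‿cong (fromℤ-β (suc l) s bs))))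

-- Flag h-numbers as Euler characteristics

module FlagEuler {r} {R : Set r} {plus times : R → R → R} {neg : R → R} {0# 1# : R}
    (isCommutativeRing : IsCommutativeRing _≡_ plus times neg 0# 1#)
    {n} (P : GradedBoundedPoset n) where
  open GradedBoundedPoset P
  open PosetOrder P
  open Rank P
  open ChainComplex isCommutativeRing lt lt-trans
  open Join isCommutativeRing lt lt-trans using (sign)
  open RankSelection isCommutativeRing lt lt-trans using (between⁻; between⁺; module EulerCharacteristic)
  open CommutativeRing ring using (_+_; _*_; -_; _-_)
  open Sums ring
  open ℤ-Solver ring
  open ≡-Reasoning
  open FlagNumbers ring P

  module _ (A : Fin n → Bool) where
    open EulerCharacteristic A using (count; alternating)

    count-suc : ∀ s j → count s top (suc j) ≡ S A s top (λ x → count x top j)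
    count-suc s j = ∑-chains j s _

    -- Nonempty chains are sorted by their lowest vertex, which contributes one sign and leaves one
    -- vertex fewer above it.
    alternating-suc : ∀ s N → alternating s top (suc N) ≡ 1# - S A s top (λ x → alternating x top N)
    alternating-suc s zero = begin
      (1# + 0#) + - 1# * count s top 1 ≡⟨ cong (λ m → (1# + 0#) + - 1# * m) (count-suc s 0) ⟩
      (1# + 0#) + - 1# * S A s top (λ x → count x top 0)
        ≡⟨ solve 1 (λ x → (con ℤ.1ℤ :+ con ℤ.0ℤ) :+ (:- con ℤ.1ℤ) :* x := con ℤ.1ℤ :- x) refl _ ⟩
      1# - S A s top (λ x → count x top 0) ∎
    alternating-suc s (suc N) = begin
      alternating s top (suc N) + sign (suc (suc N)) * count s top (suc (suc N))
        ≡⟨ cong₂ (λ p q → p + sign (suc (suc N)) * q) (alternating-suc s N) (count-suc s (suc N)) ⟩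
      (1# - X) + - sign (suc N) * Y ≡⟨ solve 3 (λ x g y → (con ℤ.1ℤ :- x) :+ (:- g) :* y := con ℤ.1ℤ :- (x :+ g :* y)) refl X (sign (suc N)) Y ⟩
      1# - (X + sign (suc N) * Y) ≡⟨ cong (λ m → 1# - m) (trans (cong (X +_) (sym (S-* _ _))) (sym (S-+ _ _))) ⟩
      1# - S A s top (λ x → alternating x top (suc N)) ∎
      where
      X = S A s top (λ x → alternating x top N)
      Y = S A s top (λ x → count x top (suc N))

    -- The contribution of chains above a chosen lowest vertex; it is 0 for bound 0, when not even
    -- that vertex is allowed. So `alternating-later` holds for every bound.
    later : ℕ → Fin n → R
    later zero x = 0#
    later (suc N) x = alternating x top N

    alternating-later : ∀ s N → alternating s top N ≡ 1# - S A s top (later N)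
    alternating-later s zero = trans (solve 0 (con ℤ.1ℤ :+ con ℤ.0ℤ := con ℤ.1ℤ :- con ℤ.0ℤ) refl)
      (cong (λ m → 1# - m) (sym (S-zero (λ _ _ → refl))))
    alternating-later s (suc N) = alternating-suc s N

    from : Fin n → ℕ → Fin n → Bool
    from s l x = between A s top x ∧ (l ≤ᵇ ρ x)

    from⁻ : ∀ {s l x} → T (from s l x) → T (lt s x) × T (lt x top) × T (A x) × l ≤ ρ x
    from⁻ {s} {l} {x} p = let (q , m) = T-∧⁻ {between A s top x} p ; (a , b , c) = between⁻ A {s} {top} {x} q in
      a , b , c , ℕₚ.≤ᵇ⇒≤ l (ρ x) m

    from⁺ : ∀ {s l x} → T (lt s x) → T (lt x top) → T (A x) → l ≤ ρ x → T (from s l x)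
    from⁺ a b c d = T-∧⁺ (between⁺ A a b c) (ℕₚ.≤⇒≤ᵇ d)

    from-all : ∀ s l N → l ≤ suc (ρ s) → 1# - ∑ (allFin n) (λ x → from s l x ⊳ later N x) ≡ alternating s top N
    from-all s l N l≤ = trans (cong (λ m → 1# - m) (∑-cong (allFin n) (λ x → cong (_⊳ later N x)
        (T-ext (proj₁ ∘ T-∧⁻ {between A s top x})
               (λ p → let (a , b , c) = between⁻ A {s} {top} {x} p in from⁺ a b c (ℕₚ.≤-trans l≤ (ρ-mono-< a)))))))
      (sym (alternating-later s N))

    -- The right side counts, by lowest vertex and with signs, the chains whose ranks are selected
    -- and at least `l`. The truncation at `N` loses nothing, as such chains have at most `trues bs`
    -- vertices.
    β-euler : ∀ bs l s N → l ℕ.+ length bs ≡ rank P → trues bs ≤ N →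
      (∀ x → l ≤ ρ x → ρ x < rank P → A x ≡ bit bs (ρ x ∸ l)) →
      sign (trues bs) * β l s bs ≡ 1# - ∑ (allFin n) (λ x → from s l x ⊳ later N x)
    β-euler [] l s N len _ hA = begin
      1# * 1# ≡⟨ solve 0 (con ℤ.1ℤ :* con ℤ.1ℤ := con ℤ.1ℤ :- con ℤ.0ℤ) refl ⟩
      1# - 0# ≡⟨ cong (λ m → 1# - m) (sym (trans (∑-cong (allFin n) (λ x → ⊳-zero (from s l x) (λ p → ⊥-elim (none p)))) (∑-zero (allFin n)))) ⟩
      1# - ∑ (allFin n) (λ x → from s l x ⊳ later N x) ∎
      where
      none : ∀ {x} → T (from s l x) → ⊥
      none {x} p = let (_ , xt , _ , l≤) = from⁻ {s} {l} {x} p in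
        ℕₚ.<-irrefl refl (ℕₚ.<-≤-trans (ρ-mono-< xt) (subst (_≤ ρ x) (trans (sym (ℕₚ.+-identityʳ l)) len) l≤))
    β-euler (b ∷ bs) l s N len tr hA = step b N tr (λ x e → trans (hA x (ℕₚ.≤-reflexive (sym e)) (subst (_< rank P) (sym e) l<r))
                                          (cong (bit (b ∷ bs)) (trans (cong (_∸ l) e) (ℕₚ.n∸n≡0 l))))
      where
      len′ : suc l ℕ.+ length bs ≡ rank P
      len′ = trans (sym (ℕₚ.+-suc l (length bs))) len
      l<r : l < rank P
      l<r = subst (l <_) len (subst (l <_) (sym (ℕₚ.+-suc l (length bs))) (s≤s (ℕₚ.m≤m+n l _)))
      hA′ : ∀ x → suc l ≤ ρ x → ρ x < rank P → A x ≡ bit bs (ρ x ∸ suc l)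
      hA′ x l≤ <r = trans (hA x (ℕₚ.<⇒≤ l≤) <r) (cong (bit (b ∷ bs)) (lemma l (ρ x) l≤))
        where
        lemma : ∀ l m → suc l ≤ m → m ∸ l ≡ suc (m ∸ suc l)
        lemma zero (suc m) _ = refl
        lemma (suc l) (suc m) (s≤s p) = lemma l m p
      below-top : ∀ {x} → ρ x ≡ l → T (lt x top)
      below-top {x} e = lt⁺ (le-top x) (λ { refl → ℕₚ.<⇒≢ l<r (sym e) })
      step : ∀ b N → boolToℕ b ℕ.+ trues bs ≤ N → (∀ x → ρ x ≡ l → A x ≡ b) →
        sign (trues (b ∷ bs)) * β l s (b ∷ bs) ≡ 1# - ∑ (allFin n) (λ x → from s l x ⊳ later N x)
      -- No element of rank `l` lies in `A`, so starting at `l` or at `suc l` selects the same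
      -- vertices.
      step false N tr hl = trans (β-euler bs (suc l) s N len′ tr hA′) (cong (λ m → 1# - m) (∑-cong (allFin n) (λ x → cong (_⊳ later N x) (T-ext
        (λ p → let (a , d , e , f) = from⁻ {s} {suc l} {x} p in from⁺ a d e (ℕₚ.<⇒≤ f))
        (λ p → let (a , d , e , f) = from⁻ {s} {l} {x} p in
          from⁺ a d e (ℕₚ.≤∧≢⇒< f (λ eq → subst T (hl x (sym eq)) e)))))))
      -- The vertices of rank `l` are split off. Above such an `x` the induction applies with bound
      -- `N`, one vertex being used up, and there the restriction to ranks from `suc l` on is
      -- automatic.
      step true (suc N) (s≤s tr) hl = begin
        - g * (∑ (allFin n) (λ x → atRank s l x ⊳ β (suc l) x bs) - β (suc l) s bs)
          ≡⟨ solve 3 (λ g x y → (:- g) :* (x :- y) := g :* y :- g :* x) refl g _ _ ⟩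
        g * β (suc l) s bs - g * ∑ (allFin n) (λ x → atRank s l x ⊳ β (suc l) x bs)
          ≡⟨ cong₂ _-_ (β-euler bs (suc l) s (suc N) len′ (ℕₚ.m≤n⇒m≤1+n tr) hA′)
               (trans (sym (∑-*ˡ (allFin n) g _)) (∑-cong (allFin n) (λ x → trans (⊳-* (atRank s l x) g _) (⊳-cong (atRank s l x) (λ p → level x (level-rank p)))))) ⟩
        (1# - ∑ (allFin n) (λ x → from s (suc l) x ⊳ later (suc N) x)) - ∑ (allFin n) (λ x → atRank s l x ⊳ later (suc N) x)
          ≡⟨ solve 2 (λ x y → (con ℤ.1ℤ :- x) :- y := con ℤ.1ℤ :- (x :+ y)) refl _ _ ⟩
        1# - (∑ (allFin n) (λ x → from s (suc l) x ⊳ later (suc N) x) + ∑ (allFin n) (λ x → atRank s l x ⊳ later (suc N) x))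
          ≡⟨ cong (λ m → 1# - m) (trans (sym (∑-+ (allFin n) _ _)) (∑-cong (allFin n) (λ x → merge x))) ⟩
        1# - ∑ (allFin n) (λ x → from s l x ⊳ later (suc N) x) ∎
        where
        g = sign (trues bs)
        level-rank : ∀ {x} → T (atRank s l x) → ρ x ≡ l
        level-rank {x} p = ℕₚ.≡ᵇ⇒≡ (ρ x) l (proj₂ (T-∧⁻ {lt s x} p))
        level : ∀ x → ρ x ≡ l → g * β (suc l) x bs ≡ later (suc N) x
        level x e = trans (β-euler bs (suc l) x N len′ tr hA′) (from-all x (suc l) N (s≤s (ℕₚ.≤-reflexive (sym e))))
        merge : ∀ x → (from s (suc l) x ⊳ later (suc N) x) + (atRank s l x ⊳ later (suc N) x) ≡ from s l x ⊳ later (suc N) x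
        merge x = ⊳-exclusive {from s (suc l) x} {atRank s l x} {from s l x} (later (suc N) x)
          (λ p → let (a , d , e , f) = from⁻ {s} {suc l} {x} p in from⁺ a d e (ℕₚ.<⇒≤ f))
          (λ p → let e = level-rank p in from⁺ (proj₁ (T-∧⁻ {lt s x} p)) (below-top e) (subst T (sym (hl x e)) tt) (ℕₚ.≤-reflexive (sym e)))
          (λ p → let (a , d , e , f) = from⁻ {s} {l} {x} p in choose a d e f (l ℕ.≟ ρ x))
          (λ p q → let (_ , _ , _ , f) = from⁻ {s} {suc l} {x} p in ℕₚ.<⇒≢ f (sym (level-rank q)))
          where
          choose : T (lt s x) → T (lt x top) → T (A x) → l ≤ ρ x → Dec (l ≡ ρ x) → T (from s (suc l) x) ⊎ T (atRank s l x)
          choose a d e f (yes eq) = inj₂ (T-∧⁺ a (ℕₚ.≡⇒≡ᵇ (ρ x) l (sym eq)))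
          choose a d e f (no ne) = inj₁ (from⁺ a d e (ℕₚ.≤∧≢⇒< f ne))

-- Nonnegativity of flag h-numbers

module RationalNonnegativity where

  0≤-+ : ∀ {x y} → 0ℚ ℚ.≤ x → 0ℚ ℚ.≤ y → 0ℚ ℚ.≤ x ℚ.+ y
  0≤-+ p q = ℚₚ.≤-trans (ℚₚ.≤-reflexive (sym (ℚₚ.+-identityˡ 0ℚ))) (ℚₚ.+-mono-≤ p q)

  0≤² : ∀ x → 0ℚ ℚ.≤ x ℚ.* x
  0≤² x with ℚₚ.≤-total 0ℚ x
  ... | inj₁ p = ℚₚ.≤-trans (ℚₚ.≤-reflexive (sym (ℚₚ.*-zeroʳ x))) (ℚₚ.*-monoˡ-≤-nonNeg x {{ℚ.nonNegative p}} p)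
  ... | inj₂ p = ℚₚ.≤-trans (ℚₚ.≤-reflexive (sym (ℚₚ.*-zeroʳ x))) (ℚₚ.*-monoˡ-≤-nonPos x {{ℚ.nonPositive p}} p)

  0≤-+-zero : ∀ {x y} → 0ℚ ℚ.≤ x → 0ℚ ℚ.≤ y → x ℚ.+ y ≡ 0ℚ → x ≡ 0ℚ × y ≡ 0ℚ
  0≤-+-zero {x} {y} p q e = left p q e , left q p (trans (ℚₚ.+-comm y x) e)
    where
    left : ∀ {x y} → 0ℚ ℚ.≤ x → 0ℚ ℚ.≤ y → x ℚ.+ y ≡ 0ℚ → x ≡ 0ℚ
    left {x} {y} p q e = ℚₚ.≤-antisym (ℚₚ.≤-trans (ℚₚ.≤-reflexive (sym (ℚₚ.+-identityʳ x)))
      (ℚₚ.≤-trans (ℚₚ.+-monoʳ-≤ x q) (ℚₚ.≤-reflexive e))) p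

  inverse : ∀ x → x ≢ 0ℚ → ∃[ y ] x ℚ.* y ≡ 1ℚ
  inverse x x≢0 = ℚ.1/_ x {{ℚ.≢-nonZero x≢0}} , ℚₚ.*-inverseʳ x {{ℚ.≢-nonZero x≢0}}

  ²-zero : ∀ x → x ℚ.* x ≡ 0ℚ → x ≡ 0ℚ
  ²-zero x e with x ℚₚ.≟ 0ℚ
  ... | yes x≡0 = x≡0
  ... | no x≢0 = let (y , xy≡1) = inverse x x≢0 in
    trans (sym (ℚₚ.*-identityʳ x)) (trans (cong (x ℚ.*_) (sym xy≡1)) (trans (sym (ℚₚ.*-assoc x x y)) (trans (cong (ℚ._* y) e) (ℚₚ.*-zeroˡ y))))

  open ℤ-Solver ℚₚ.+-*-commutativeRing using (fromℤ; fromℤ-+)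

  fromℤ-nonneg : ∀ m → 0ℚ ℚ.≤ fromℤ (ℤ.+ m)
  fromℤ-nonneg zero = ℚₚ.≤-refl
  fromℤ-nonneg (suc m) = ℚₚ.≤-trans (0≤-+ (0≤² 1ℚ) (fromℤ-nonneg m)) (ℚₚ.≤-reflexive (sym (fromℤ-+ (ℤ.+ 1) (ℤ.+ m))))

  -- If the image of -(m + 1) were nonnegative, 1 + (m - (m + 1)) = 0 would be a sum of nonnegative
  -- terms, forcing 1 = 0.
  fromℤ-reflects-nonneg : ∀ i → 0ℚ ℚ.≤ fromℤ i → ℤ.0ℤ ℤ.≤ i
  fromℤ-reflects-nonneg (ℤ.+ m) p = ℤ.+≤+ z≤n
  fromℤ-reflects-nonneg ℤ.-[1+ m ] p = ⊥-elim (1≢0 (proj₁ (0≤-+-zero (0≤² 1ℚ) (0≤-+ (fromℤ-nonneg m) p) (begin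
      1ℚ ℚ.+ (fromℤ (ℤ.+ m) ℚ.+ fromℤ ℤ.-[1+ m ]) ≡⟨ sym (ℚₚ.+-assoc 1ℚ (fromℤ (ℤ.+ m)) (fromℤ ℤ.-[1+ m ])) ⟩
      (1ℚ ℚ.+ fromℤ (ℤ.+ m)) ℚ.+ fromℤ ℤ.-[1+ m ] ≡⟨ cong (ℚ._+ fromℤ ℤ.-[1+ m ]) (sym (fromℤ-+ (ℤ.+ 1) (ℤ.+ m))) ⟩
      fromℤ (ℤ.+ suc m) ℚ.+ ℚ.- fromℤ (ℤ.+ suc m) ≡⟨ ℚₚ.+-inverseʳ (fromℤ (ℤ.+ suc m)) ⟩
      0ℚ ∎))))
    where
    open ≡-Reasoning
    1≢0 : 1ℚ ℚ.* 1ℚ ≢ 0ℚ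
    1≢0 ()

module FlagNonnegativity {n} (P : GradedBoundedPoset n) (cm : CohenMacaulay P) where
  open GradedBoundedPoset P
  open PosetOrder P
  open Rank P
  open RationalNonnegativity
  open HomologyOfIntervals P using (everything; vanishing)
  open ChainComplex ℚₚ.+-*-isCommutativeRing lt lt-trans using (ring; chains; chains-valid)
  open Acyclicity ℚₚ.+-*-isCommutativeRing lt lt-trans
  open Join ℚₚ.+-*-isCommutativeRing lt lt-trans using (sign; sign²)
  open RankSelection ℚₚ.+-*-isCommutativeRing lt lt-trans
  open Sums ring using (∑)
  open FlagEuler ℚₚ.+-*-isCommutativeRing P
  open ≡-Reasoning

  interval-vanishing : ∀ s t → T (lt s t) → Vanishing everything s t (ρ t ∸ ρ s ∸ 1)
  interval-vanishing s t st j j< = vanishing s t j (cm s t st j (ℕₚ.<⇒≢ j<))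

  bot-lt : ∀ {t i} → suc i ≤ ρ t → T (lt bot t)
  bot-lt {t} l = lt⁺ (bot-le t) (λ { refl → ℕₚ.<⇒≢ (ℕₚ.≤-trans (s≤s z≤n) l) (sym ρ-bot) })

  module _ (bs : List Bool) where

    -- Ranks below i are selected by bs, whose i-th entry stands for rank i + 1; the others are kept.
    selected : ℕ → Fin n → Bool
    selected i x = if ρ x <ᵇ i then bit bs (ρ x ∸ 1) else true

    selected-below : ∀ {i x} → ρ x < i → selected i x ≡ bit bs (ρ x ∸ 1)
    selected-below {i} {x} l with ρ x <ᵇ i in eq
    ... | true = refl
    ... | false = ⊥-elim (subst T eq (ℕₚ.<⇒<ᵇ l))

    selected-above : ∀ {i x} → i ≤ ρ x → selected i x ≡ true
    selected-above {i} {x} l with ρ x <ᵇ i in eq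
    ... | false = refl
    ... | true = ⊥-elim (ℕₚ.<⇒≱ (ℕₚ.<ᵇ⇒< (ρ x) i (subst T (sym eq) tt)) l)

    selected-step : ∀ {i x} → ρ x ≢ i → selected i x ≡ selected (suc i) x
    selected-step {i} {x} ne with ℕₚ.<-cmp (ρ x) i
    ... | tri< l _ _ = trans (selected-below {i} {x} l) (sym (selected-below {suc i} {x} (ℕₚ.m<n⇒m<1+n l)))
    ... | tri≈ _ e _ = ⊥-elim (ne e)
    ... | tri> _ _ g = trans (selected-above {i} {x} (ℕₚ.<⇒≤ g)) (sym (selected-above {suc i} {x} g))

    selected-at : ∀ {i x} → ρ x ≡ suc i → selected (suc (suc i)) x ≡ bit bs i
    selected-at {i} {x} e = trans (selected-below {suc (suc i)} {x} (s≤s (ℕₚ.≤-reflexive e))) (cong (λ m → bit bs (m ∸ 1)) e)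

    ∸-step : ∀ {m i} → suc i ≤ m → m ∸ i ≡ suc (m ∸ suc i)
    ∸-step {suc m} {zero} _ = refl
    ∸-step {suc m} {suc i} (s≤s l) = ∸-step l

    -- The bound is the number of ranks left strictly between `bot` and `t`: the selected ones up to
    -- `i` and all from `suc i` on. The upper end varies because the deletion step calls the
    -- induction for `(bot , x)`.
    selected-vanishing : ∀ i t → suc i ≤ ρ t → Vanishing (selected (suc i)) bot t (truesUpTo bs i ℕ.+ (ρ t ∸ suc i))
    selected-vanishing zero t l = Vanishing-agree (λ x bx _ → sym (selected-above {1} {x} (ℕₚ.≤-trans (s≤s z≤n) (ρ-mono-< bx))))
      (subst (Vanishing everything bot t) (trans (ℕₚ.∸-+-assoc (ρ t) (ρ bot) 1) (cong (λ m → ρ t ∸ (m ℕ.+ 1)) ρ-bot)) (interval-vanishing bot t (bot-lt l)))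
    selected-vanishing (suc i) t l = step (bit bs i) refl
      where
      ih : Vanishing (selected (suc i)) bot t (truesUpTo bs i ℕ.+ suc (ρ t ∸ suc (suc i)))
      ih = subst (λ m → Vanishing (selected (suc i)) bot t (truesUpTo bs i ℕ.+ m)) (∸-step l) (selected-vanishing i t (ℕₚ.<⇒≤ l))

      step : ∀ b → bit bs i ≡ b → Vanishing (selected (suc (suc i))) bot t (boolToℕ (bit bs i) ℕ.+ truesUpTo bs i ℕ.+ (ρ t ∸ suc (suc i)))
      step true e = subst (λ b → Vanishing (selected (suc (suc i))) bot t (boolToℕ b ℕ.+ truesUpTo bs i ℕ.+ (ρ t ∸ suc (suc i)))) (sym e)
        (Vanishing-agree agree (subst (Vanishing (selected (suc i)) bot t) (ℕₚ.+-suc (truesUpTo bs i) _) ih))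
        where
        agree : ∀ x → T (lt bot x) → T (lt x t) → selected (suc i) x ≡ selected (suc (suc i)) x
        agree x _ _ with ρ x ℕ.≟ suc i
        ... | no ne = selected-step {suc i} {x} ne
        ... | yes eq = trans (selected-above {suc i} {x} (ℕₚ.≤-reflexive (sym eq))) (trans (sym e) (sym (selected-at {i} {x} eq)))
      -- Deleting rank `suc i` lowers the bound by one, so both the larger complex and the links are
      -- needed only up to the lowered bound.
      step false e = subst (λ b → Vanishing (selected (suc (suc i))) bot t (boolToℕ b ℕ.+ truesUpTo bs i ℕ.+ (ρ t ∸ suc (suc i)))) (sym e)
        (removal A K B K⊆A B⊆A cover disjoint antichain bot t (truesUpTo bs i ℕ.+ (ρ t ∸ suc (suc i)))
          (Vanishing-≤ (ℕₚ.+-monoʳ-≤ (truesUpTo bs i) (ℕₚ.n≤1+n _)) ih) link)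
        where
        A K B : Fin n → Bool
        A = selected (suc i)
        K = selected (suc (suc i))
        B x = ρ x ≡ᵇ suc i
        B-rank : ∀ {x} → T (B x) → ρ x ≡ suc i
        B-rank {x} = ℕₚ.≡ᵇ⇒≡ (ρ x) (suc i)
        disjoint : ∀ x → T (K x) → T (B x) → ⊥
        disjoint x Kx Bx = subst T (trans (selected-at {i} {x} (B-rank Bx)) e) Kx
        K⊆A : ∀ x → T (K x) → T (A x)
        K⊆A x Kx with ρ x ℕ.≟ suc i
        ... | no ne = subst T (sym (selected-step {suc i} {x} ne)) Kx
        ... | yes eq = ⊥-elim (disjoint x Kx (ℕₚ.≡⇒≡ᵇ (ρ x) (suc i) eq))
        B⊆A : ∀ x → T (B x) → T (A x)
        B⊆A x Bx = subst T (sym (selected-above {suc i} {x} (ℕₚ.≤-reflexive (sym (B-rank Bx))))) tt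
        cover : ∀ x → T (A x) → T (K x) ⊎ T (B x)
        cover x Ax with ρ x ℕ.≟ suc i
        ... | no ne = inj₁ (subst T (selected-step {suc i} {x} ne) Ax)
        ... | yes eq = inj₂ (ℕₚ.≡⇒≡ᵇ (ρ x) (suc i) eq)
        antichain : ∀ x y → T (B x) → T (B y) → T (lt x y) → ⊥
        antichain x y Bx By xy = ℕₚ.<⇒≢ (ρ-mono-< xy) (trans (B-rank Bx) (sym (B-rank By)))
        link : ∀ x → T (B x) → T (lt bot x) → T (lt x t) → ∃[ p ] ∃[ q ] (Vanishing K bot x p × Vanishing K x t q
          × truesUpTo bs i ℕ.+ (ρ t ∸ suc (suc i)) ≤ p ℕ.+ q)
        -- As `ρ x` is `suc i`, the summand `ρ x ∸ suc i` is 0 and the two bounds add up exactly to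
        -- the required one.
        link x Bx bx xt = truesUpTo bs i ℕ.+ (ρ x ∸ suc i) , ρ t ∸ ρ x ∸ 1 ,
          Vanishing-agree (λ y _ yx → selected-step {suc i} {y} (λ eq → ℕₚ.<⇒≢ (ρ-mono-< yx) (trans eq (sym (B-rank Bx)))))
            (selected-vanishing i x (ℕₚ.≤-reflexive (sym (B-rank Bx)))) ,
          Vanishing-agree (λ y xy _ → sym (selected-above {suc (suc i)} {y} (subst (λ m → suc m ≤ ρ y) (B-rank Bx) (ρ-mono-< xy)))) (interval-vanishing x t xt) ,
          ℕₚ.+-mono-≤ (ℕₚ.m≤m+n _ _) (ℕₚ.≤-reflexive (sym (trans (ℕₚ.∸-+-assoc (ρ t) (ρ x) 1) (cong (ρ t ∸_) (trans (ℕₚ.+-comm (ρ x) 1) (cong suc (B-rank Bx)))))))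

    module _ (len : suc (length bs) ≡ rank P) where

      private
        A = selected (suc (length bs))
        k = trues bs
        module ℚβ = FlagNumbers ring P
        module ℤβ = FlagNumbers ℤₚ.+-*-commutativeRing P
        open EulerCharacteristic A bot top

        -- Once all ranks below the top are treated, no complete level remains and the bound is the
        -- number `k` of selected ranks.
        homotopy : ∃[ b ] IsHomotopy A bot top k b
        homotopy = vanishing⇒homotopy k (subst (Vanishing A bot top)
          (trans (cong₂ ℕ._+_ (truesUpTo-length bs) (trans (cong (ρ top ∸_) len) (ℕₚ.n∸n≡0 (ρ top)))) (ℕₚ.+-identityʳ k))
          (selected-vanishing (length bs) top (ℕₚ.≤-reflexive len)))

        trace : ℚ
        trace = ∑ (chains A top k bot) (λ σ → projection (proj₂ homotopy) σ σ)

        trace-≥0 : 0ℚ ℚ.≤ trace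
        trace-≥0 = IdempotentTrace.trace-nonneg ℚₚ.+-*-isCommutativeRing (ℚₚ._≟ 0ℚ) inverse (0ℚ ℚ.≤_) ℚₚ.≤-refl 0≤-+ 0≤² 0≤-+-zero ²-zero
          (chains A top k bot) (projection (proj₂ homotopy))
          (λ σ τ σ∈ → let (v , l) = All.lookup (chains-valid A top k bot) σ∈ in projection-idempotent (proj₂ homotopy) σ τ v l)

        β≡trace : ℚβ.β 1 bot bs ≡ trace
        β≡trace = begin
          ℚβ.β 1 bot bs ≡⟨ sym (ℚₚ.*-identityˡ _) ⟩
          1ℚ ℚ.* ℚβ.β 1 bot bs ≡⟨ cong (ℚ._* ℚβ.β 1 bot bs) (sym (sign² k)) ⟩
          (sign k ℚ.* sign k) ℚ.* ℚβ.β 1 bot bs ≡⟨ ℚₚ.*-assoc (sign k) (sign k) _ ⟩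
          sign k ℚ.* (sign k ℚ.* ℚβ.β 1 bot bs) ≡⟨ cong (sign k ℚ.*_) (begin
            sign k ℚ.* ℚβ.β 1 bot bs
              ≡⟨ β-euler A bs 1 bot k len ℕₚ.≤-refl (λ x _ x<r → selected-below {suc (length bs)} {x} (subst (ρ x <_) (sym len) x<r)) ⟩
            _ ≡⟨ from-all A bot 1 k (s≤s z≤n) ⟩
            alternating k ≡⟨ alternating-trace (proj₂ homotopy) ⟩
            sign k ℚ.* trace ∎) ⟩
          sign k ℚ.* (sign k ℚ.* trace) ≡⟨ sym (ℚₚ.*-assoc (sign k) (sign k) trace) ⟩
          (sign k ℚ.* sign k) ℚ.* trace ≡⟨ cong (ℚ._* trace) (sign² k) ⟩
          1ℚ ℚ.* trace ≡⟨ ℚₚ.*-identityˡ trace ⟩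
          trace ∎

      β-nonneg : ℤ.0ℤ ℤ.≤ ℤβ.β 1 bot bs
      β-nonneg = fromℤ-reflects-nonneg _ (subst (0ℚ ℚ.≤_) (sym (trans (FlagNumbers-fromℤ.fromℤ-β ring P 1 bot bs) β≡trace)) trace-≥0)

-- The ring of integer polynomials

module PolynomialRing where
  open ℤ-Solver ℤₚ.+-*-commutativeRing using (solve; _:=_; _:+_; _:*_; :-_; con)

  infix 4 _≈ₚ_
  -- Coefficientwise equality identifies lists differing by trailing zeros. The record keeps both
  -- polynomials visible to unification, which could not recover them from their coefficients.
  record _≈ₚ_ (p q : Poly) : Set where
    constructor mk≈
    field at : ∀ k → coeff p k ≡ coeff q k
  open _≈ₚ_ public

  coeff-+ : ∀ p q k → coeff (p +ₚ q) k ≡ coeff p k ℤ.+ coeff q k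
  coeff-+ [] q k = sym (ℤₚ.+-identityˡ _)
  coeff-+ (a ∷ p) [] k = sym (ℤₚ.+-identityʳ _)
  coeff-+ (a ∷ p) (b ∷ q) zero = refl
  coeff-+ (a ∷ p) (b ∷ q) (suc k) = coeff-+ p q k

  coeff-scale : ∀ c p k → coeff (scaleₚ c p) k ≡ c ℤ.* coeff p k
  coeff-scale c [] k = sym (ℤₚ.*-zeroʳ c)
  coeff-scale c (a ∷ p) zero = refl
  coeff-scale c (a ∷ p) (suc k) = coeff-scale c p k

  coeff-∷* : ∀ a p q k → coeff ((a ∷ p) *ₚ q) k ≡ a ℤ.* coeff q k ℤ.+ coeff (ℤ.0ℤ ∷ p *ₚ q) k
  coeff-∷* a p q k = trans (coeff-+ (scaleₚ a q) _ k) (cong (ℤ._+ coeff (ℤ.0ℤ ∷ p *ₚ q) k) (coeff-scale a q k))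

  ∷-cong : ∀ {a b p q} → a ≡ b → p ≈ₚ q → a ∷ p ≈ₚ b ∷ q
  ∷-cong refl e .at zero = refl
  ∷-cong refl e .at (suc k) = e .at k

  0∷[] : ℤ.0ℤ ∷ [] ≈ₚ []
  0∷[] .at zero = refl
  0∷[] .at (suc k) = refl

  ≈-refl : ∀ {p} → p ≈ₚ p
  ≈-refl .at k = refl

  ≈-sym : ∀ {p q} → p ≈ₚ q → q ≈ₚ p
  ≈-sym e .at k = sym (e .at k)

  ≈-trans : ∀ {p q r} → p ≈ₚ q → q ≈ₚ r → p ≈ₚ r
  ≈-trans e f .at k = trans (e .at k) (f .at k)

  +ₚ-cong : ∀ {p p′ q q′} → p ≈ₚ p′ → q ≈ₚ q′ → p +ₚ q ≈ₚ p′ +ₚ q′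
  +ₚ-cong {p} {p′} {q} {q′} e f .at k = trans (coeff-+ p q k) (trans (cong₂ ℤ._+_ (e .at k) (f .at k)) (sym (coeff-+ p′ q′ k)))

  +ₚ-assoc : ∀ p q r → (p +ₚ q) +ₚ r ≈ₚ p +ₚ (q +ₚ r)
  +ₚ-assoc p q r .at k rewrite coeff-+ (p +ₚ q) r k | coeff-+ p q k | coeff-+ p (q +ₚ r) k | coeff-+ q r k = ℤₚ.+-assoc (coeff p k) (coeff q k) (coeff r k)

  +ₚ-comm : ∀ p q → p +ₚ q ≈ₚ q +ₚ p
  +ₚ-comm p q .at k rewrite coeff-+ p q k | coeff-+ q p k = ℤₚ.+-comm (coeff p k) (coeff q k)

  +ₚ-identityʳ : ∀ p → p +ₚ [] ≈ₚ p
  +ₚ-identityʳ p .at k = trans (coeff-+ p [] k) (ℤₚ.+-identityʳ _)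

  negₚ-cong : ∀ {p q} → p ≈ₚ q → negₚ p ≈ₚ negₚ q
  negₚ-cong {p} {q} e .at k = trans (coeff-scale ℤ.-1ℤ p k) (trans (cong (ℤ.-1ℤ ℤ.*_) (e .at k)) (sym (coeff-scale ℤ.-1ℤ q k)))

  +ₚ-inverseʳ : ∀ p → p +ₚ negₚ p ≈ₚ []
  +ₚ-inverseʳ p .at k rewrite coeff-+ p (negₚ p) k | coeff-scale ℤ.-1ℤ p k =
    solve 1 (λ x → x :+ (:- con ℤ.1ℤ) :* x := con ℤ.0ℤ) refl (coeff p k)

  scaleₚ-cong : ∀ c {p q} → p ≈ₚ q → scaleₚ c p ≈ₚ scaleₚ c q
  scaleₚ-cong c {p} {q} e .at k = trans (coeff-scale c p k) (trans (cong (c ℤ.*_) (e .at k)) (sym (coeff-scale c q k)))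

  scaleₚ-+ : ∀ c p q → scaleₚ c (p +ₚ q) ≈ₚ scaleₚ c p +ₚ scaleₚ c q
  scaleₚ-+ c p q .at k rewrite coeff-scale c (p +ₚ q) k | coeff-+ p q k | coeff-+ (scaleₚ c p) (scaleₚ c q) k
    | coeff-scale c p k | coeff-scale c q k = ℤₚ.*-distribˡ-+ c (coeff p k) (coeff q k)

  scaleₚ-scaleₚ : ∀ c d p → scaleₚ c (scaleₚ d p) ≈ₚ scaleₚ (c ℤ.* d) p
  scaleₚ-scaleₚ c d p .at k rewrite coeff-scale c (scaleₚ d p) k | coeff-scale d p k | coeff-scale (c ℤ.* d) p k = sym (ℤₚ.*-assoc c d (coeff p k))

  scaleₚ-0 : ∀ p → scaleₚ ℤ.0ℤ p ≈ₚ []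
  scaleₚ-0 p .at k = trans (coeff-scale ℤ.0ℤ p k) (ℤₚ.*-zeroˡ (coeff p k))

  scaleₚ-1 : ∀ p → scaleₚ ℤ.1ℤ p ≈ₚ p
  scaleₚ-1 p .at k = trans (coeff-scale ℤ.1ℤ p k) (ℤₚ.*-identityˡ (coeff p k))

  +ₚ-interchange : ∀ p q r s → (p +ₚ q) +ₚ (r +ₚ s) ≈ₚ (p +ₚ r) +ₚ (q +ₚ s)
  +ₚ-interchange p q r s .at k rewrite coeff-+ (p +ₚ q) (r +ₚ s) k | coeff-+ p q k | coeff-+ r s k
    | coeff-+ (p +ₚ r) (q +ₚ s) k | coeff-+ p r k | coeff-+ q s k =
    solve 4 (λ a b c d → (a :+ b) :+ (c :+ d) := (a :+ c) :+ (b :+ d)) refl (coeff p k) (coeff q k) (coeff r k) (coeff s k)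

  *ₚ-congʳ : ∀ p {q q′} → q ≈ₚ q′ → p *ₚ q ≈ₚ p *ₚ q′
  *ₚ-congʳ [] e = ≈-refl
  *ₚ-congʳ (a ∷ p) e = +ₚ-cong (scaleₚ-cong a e) (∷-cong refl (*ₚ-congʳ p e))

  *ₚ-zeroʳ : ∀ p → p *ₚ [] ≈ₚ []
  *ₚ-zeroʳ [] = ≈-refl
  *ₚ-zeroʳ (a ∷ p) = ≈-trans (∷-cong refl (*ₚ-zeroʳ p)) 0∷[]

  *ₚ-∷ : ∀ p b q → p *ₚ (b ∷ q) ≈ₚ scaleₚ b p +ₚ (ℤ.0ℤ ∷ p *ₚ q)
  *ₚ-∷ [] b q = ≈-sym 0∷[]
  *ₚ-∷ (a ∷ p) b q = ∷-cong (trans (ℤₚ.+-identityʳ _) (trans (ℤₚ.*-comm a b) (sym (ℤₚ.+-identityʳ _)))) (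
    ≈-trans (+ₚ-cong (≈-refl {scaleₚ a q}) (*ₚ-∷ p b q))
    (≈-trans (≈-sym (+ₚ-assoc (scaleₚ a q) (scaleₚ b p) _))
    (≈-trans (+ₚ-cong (+ₚ-comm (scaleₚ a q) (scaleₚ b p)) ≈-refl) (+ₚ-assoc (scaleₚ b p) (scaleₚ a q) _))))

  *ₚ-comm : ∀ p q → p *ₚ q ≈ₚ q *ₚ p
  *ₚ-comm [] q = ≈-sym (*ₚ-zeroʳ q)
  *ₚ-comm (a ∷ p) q = ≈-trans (+ₚ-cong ≈-refl (∷-cong refl (*ₚ-comm p q))) (≈-sym (*ₚ-∷ q a p))

  *ₚ-cong : ∀ {p p′ q q′} → p ≈ₚ p′ → q ≈ₚ q′ → p *ₚ q ≈ₚ p′ *ₚ q′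
  *ₚ-cong {p} {p′} {q} {q′} e f = ≈-trans (*ₚ-congʳ p f) (≈-trans (*ₚ-comm p q′) (≈-trans (*ₚ-congʳ q′ e) (*ₚ-comm q′ p′)))

  *ₚ-distribˡ-+ₚ : ∀ p q r → p *ₚ (q +ₚ r) ≈ₚ p *ₚ q +ₚ p *ₚ r
  *ₚ-distribˡ-+ₚ [] q r = ≈-refl
  *ₚ-distribˡ-+ₚ (a ∷ p) q r = ≈-trans (+ₚ-cong (scaleₚ-+ a q r) (∷-cong refl (*ₚ-distribˡ-+ₚ p q r)))
    (+ₚ-interchange (scaleₚ a q) (scaleₚ a r) (ℤ.0ℤ ∷ p *ₚ q) (ℤ.0ℤ ∷ p *ₚ r))

  *ₚ-distribʳ-+ₚ : ∀ p q r → (q +ₚ r) *ₚ p ≈ₚ q *ₚ p +ₚ r *ₚ p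
  *ₚ-distribʳ-+ₚ p q r = ≈-trans (*ₚ-comm (q +ₚ r) p) (≈-trans (*ₚ-distribˡ-+ₚ p q r) (+ₚ-cong (*ₚ-comm p q) (*ₚ-comm p r)))

  scaleₚ-*ₚ : ∀ c p q → scaleₚ c (p *ₚ q) ≈ₚ scaleₚ c p *ₚ q
  scaleₚ-*ₚ c [] q = ≈-refl
  scaleₚ-*ₚ c (a ∷ p) q = ≈-trans (scaleₚ-+ c (scaleₚ a q) _) (+ₚ-cong (scaleₚ-scaleₚ c a q) (∷-cong (ℤₚ.*-zeroʳ c) (scaleₚ-*ₚ c p q)))

  0∷-*ₚ : ∀ p q → (ℤ.0ℤ ∷ p) *ₚ q ≈ₚ ℤ.0ℤ ∷ p *ₚ q
  0∷-*ₚ p q = +ₚ-cong (scaleₚ-0 q) ≈-refl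

  *ₚ-assoc : ∀ p q r → (p *ₚ q) *ₚ r ≈ₚ p *ₚ (q *ₚ r)
  *ₚ-assoc [] q r = ≈-refl
  *ₚ-assoc (a ∷ p) q r = ≈-trans (*ₚ-distribʳ-+ₚ r (scaleₚ a q) _)
    (+ₚ-cong (≈-sym (scaleₚ-*ₚ a q r)) (≈-trans (0∷-*ₚ (p *ₚ q) r) (∷-cong refl (*ₚ-assoc p q r))))

  *ₚ-identityˡ : ∀ p → constₚ ℤ.1ℤ *ₚ p ≈ₚ p
  *ₚ-identityˡ p = ≈-trans (+ₚ-cong (scaleₚ-1 p) 0∷[]) (+ₚ-identityʳ p)

  commutativeRing : CommutativeRing _ _
  commutativeRing = record
    { Carrier = Poly ; _≈_ = _≈ₚ_ ; _+_ = _+ₚ_ ; _*_ = _*ₚ_ ; -_ = negₚ ; 0# = [] ; 1# = constₚ ℤ.1ℤ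
    ; isCommutativeRing = record
      { isRing = record
        { +-isAbelianGroup = record
          { isGroup = record
            { isMonoid = record
              { isSemigroup = record
                { isMagma = record { isEquivalence = record { refl = ≈-refl ; sym = ≈-sym ; trans = ≈-trans } ; ∙-cong = +ₚ-cong }
                ; assoc = +ₚ-assoc }
              ; identity = (λ _ → ≈-refl) , +ₚ-identityʳ }
            ; inverse = (λ p → ≈-trans (+ₚ-comm (negₚ p) p) (+ₚ-inverseʳ p)) , +ₚ-inverseʳ
            ; ⁻¹-cong = negₚ-cong }
          ; comm = +ₚ-comm }
        ; *-cong = *ₚ-cong
        ; *-assoc = *ₚ-assoc
        ; *-identity = *ₚ-identityˡ , (λ p → ≈-trans (*ₚ-comm p _) (*ₚ-identityˡ p))
        ; distrib = *ₚ-distribˡ-+ₚ , *ₚ-distribʳ-+ₚ }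
      ; *-comm = *ₚ-comm } }

  open ℤ-Solver commutativeRing using (fromℤ; fromℤ-+)

  constₚ-neg : ∀ i → constₚ (ℤ.- i) ≈ₚ negₚ (constₚ i)
  constₚ-neg i = ∷-cong (sym (ℤₚ.-1*i≡-i i)) ≈-refl

  constₚ≈fromℤ : ∀ i → constₚ i ≈ₚ fromℤ i
  constₚ≈fromℤ (ℤ.+ n) = pos n
    where
    pos : ∀ n → constₚ (ℤ.+ n) ≈ₚ fromℤ (ℤ.+ n)
    pos zero = 0∷[]
    pos (suc n) = ≈-trans (+ₚ-cong (≈-refl {constₚ ℤ.1ℤ}) (pos n)) (≈-sym (fromℤ-+ (ℤ.+ 1) (ℤ.+ n)))
  constₚ≈fromℤ ℤ.-[1+ n ] = ≈-trans (constₚ-neg (ℤ.+ suc n)) (negₚ-cong (constₚ≈fromℤ (ℤ.+ suc n)))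

  X : Poly
  X = monoₚ 1

  X* : ∀ p → X *ₚ p ≈ₚ ℤ.0ℤ ∷ p
  X* p = ≈-trans (0∷-*ₚ (constₚ ℤ.1ℤ) p) (∷-cong refl (*ₚ-identityˡ p))

  monoₚ-suc : ∀ k → monoₚ (suc k) ≈ₚ X *ₚ monoₚ k
  monoₚ-suc k = ≈-sym (X* (monoₚ k))

  scaleₚ≈constₚ* : ∀ c p → scaleₚ c p ≈ₚ constₚ c *ₚ p
  scaleₚ≈constₚ* c p = ≈-sym (≈-trans (+ₚ-cong ≈-refl 0∷[]) (+ₚ-identityʳ _))

  evalAt1 : Poly → ℤ
  evalAt1 [] = ℤ.0ℤ
  evalAt1 (a ∷ p) = a ℤ.+ evalAt1 p

  evalAt1-+ : ∀ p q → evalAt1 (p +ₚ q) ≡ evalAt1 p ℤ.+ evalAt1 q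
  evalAt1-+ [] q = sym (ℤₚ.+-identityˡ _)
  evalAt1-+ (a ∷ p) [] = sym (ℤₚ.+-identityʳ _)
  evalAt1-+ (a ∷ p) (b ∷ q) = trans (cong (λ z → a ℤ.+ b ℤ.+ z) (evalAt1-+ p q))
    (solve 4 (λ a b x y → (a :+ b) :+ (x :+ y) := (a :+ x) :+ (b :+ y)) refl a b (evalAt1 p) (evalAt1 q))

  evalAt1-scale : ∀ c p → evalAt1 (scaleₚ c p) ≡ c ℤ.* evalAt1 p
  evalAt1-scale c [] = sym (ℤₚ.*-zeroʳ c)
  evalAt1-scale c (a ∷ p) = trans (cong (λ z → c ℤ.* a ℤ.+ z) (evalAt1-scale c p)) (sym (ℤₚ.*-distribˡ-+ c a (evalAt1 p)))

  evalAt1-mono : ∀ k → evalAt1 (monoₚ k) ≡ ℤ.1ℤ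
  evalAt1-mono zero = refl
  evalAt1-mono (suc k) = trans (ℤₚ.+-identityˡ _) (evalAt1-mono k)

  X-1 : Poly
  X-1 = X +ₚ negₚ (constₚ ℤ.1ℤ)

  X-1*-zero : ∀ p → coeff (X-1 *ₚ p) 0 ≡ ℤ.- coeff p 0
  X-1*-zero p = trans (coeff-∷* ℤ.-1ℤ (constₚ ℤ.1ℤ) p 0) (trans (ℤₚ.+-identityʳ _) (ℤₚ.-1*i≡-i _))

  X-1*-suc : ∀ p k → coeff (X-1 *ₚ p) (suc k) ≡ coeff p k ℤ.- coeff p (suc k)
  X-1*-suc p k = trans (coeff-∷* ℤ.-1ℤ (constₚ ℤ.1ℤ) p (suc k)) (trans (cong₂ ℤ._+_ (ℤₚ.-1*i≡-i (coeff p (suc k))) (*ₚ-identityˡ p .at k)) (ℤₚ.+-comm _ (coeff p k)))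

  divX-1-head : ∀ c p → coeff (divX-1 (c ∷ p)) 0 ≡ ℤ.- c
  divX-1-head c p = cong ℤ.-_ (ℤₚ.+-identityˡ c)

  -- The accumulator of `divX-1` can be moved into the leading coefficient, so its local worker need
  -- not be named.
  divX-1-tail : ∀ c a p k → coeff (divX-1 (c ∷ a ∷ p)) (suc k) ≡ coeff (divX-1 (c ℤ.+ a ∷ p)) k
  divX-1-tail c a p k rewrite ℤₚ.+-identityˡ c | ℤₚ.+-identityˡ (c ℤ.+ a) = refl

  -- The quotient has the negated partial sums as coefficients, with `c` the sum so far. The
  -- hypothesis acts at the end of the list, where the next coefficient is read as 0.
  divX-1-diff : ∀ c p → c ℤ.+ evalAt1 p ≡ ℤ.0ℤ → ∀ k →
    coeff (divX-1 (c ∷ p)) k ℤ.- coeff (divX-1 (c ∷ p)) (suc k) ≡ coeff p k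
  divX-1-diff c [] e zero = trans (ℤₚ.+-identityʳ _) (trans (divX-1-head c []) (cong ℤ.-_ (trans (sym (ℤₚ.+-identityʳ c)) e)))
  divX-1-diff c [] e (suc k) = refl
  divX-1-diff c (a ∷ p) e zero = trans (cong₂ ℤ._-_ (divX-1-head c (a ∷ p)) (trans (divX-1-tail c a p 0) (divX-1-head (c ℤ.+ a) p)))
    (solve 2 (λ c a → (:- c) :+ (:- (:- (c :+ a))) := a) refl c a)
  divX-1-diff c (a ∷ p) e (suc k) = trans (cong₂ ℤ._-_ (divX-1-tail c a p k) (divX-1-tail c a p (suc k)))
    (divX-1-diff (c ℤ.+ a) p (trans (ℤₚ.+-assoc c a _) e) k)

  X-1*divX-1 : ∀ p → evalAt1 p ≡ ℤ.0ℤ → X-1 *ₚ divX-1 p ≈ₚ p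
  X-1*divX-1 [] e = *ₚ-zeroʳ X-1
  X-1*divX-1 (c ∷ p) e .at zero = trans (X-1*-zero (divX-1 (c ∷ p))) (trans (cong ℤ.-_ (divX-1-head c p)) (ℤₚ.neg-involutive c))
  X-1*divX-1 (c ∷ p) e .at (suc k) = trans (X-1*-suc (divX-1 (c ∷ p)) k) (divX-1-diff c p e k)

  -- The constant term vanishes, and each later coefficient equals the one before it.
  X-1*-cancel : ∀ p → X-1 *ₚ p ≈ₚ [] → p ≈ₚ []
  X-1*-cancel p e .at zero = trans (sym (ℤₚ.neg-involutive _)) (cong ℤ.-_ (trans (sym (X-1*-zero p)) (e .at zero)))
  X-1*-cancel p e .at (suc k) = ℤₚ.neg-injective (begin
    ℤ.- coeff p (suc k) ≡⟨ sym (ℤₚ.+-identityˡ _) ⟩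
    ℤ.0ℤ ℤ.- coeff p (suc k) ≡⟨ cong (ℤ._- coeff p (suc k)) (sym (X-1*-cancel p e .at k)) ⟩
    coeff p k ℤ.- coeff p (suc k) ≡⟨ trans (sym (X-1*-suc p k)) (e .at (suc k)) ⟩
    ℤ.0ℤ ∎)
    where open ≡-Reasoning

-- The recursion for the Chow function

module IntervalOrder {n} (P : GradedBoundedPoset n) where
  open GradedBoundedPoset P
  open PosetOrder P

  ¬T⇒false : ∀ {b} → ¬ T b → b ≡ false
  ¬T⇒false {true} n = ⊥-elim (n tt)
  ¬T⇒false {false} n = refl

  T⇒true : ∀ {b} → T b → b ≡ true
  T⇒true {true} _ = refl

  eqb-refl : ∀ s → eqb s s ≡ true
  eqb-refl s = T⇒true (eqb⁺ refl)

  data Position (s t : Fin n) : Set where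
    equal : s ≡ t → Position s t
    less : T (lt s t) → Position s t
    outside : ¬ T (le s t) → Position s t

  position : ∀ s t → Position s t
  position s t with s Fin.≟ t | T? (le s t)
  ... | yes e | _ = equal e
  ... | no ne | yes l = less (lt⁺ l ne)
  ... | no _ | no n = outside n

  le-split : ∀ u t → T (le u t) → T (eqb u t) ⊎ T (lt u t)
  le-split u t l with u Fin.≟ t
  ... | yes _ = inj₁ tt
  ... | no _ = inj₂ (T-∧⁺ l tt)

  module Split {c ℓ} (R : CommutativeRing c ℓ) where
    private
      module R = CommutativeRing R
      module S = Sums R

    ∑-le : ∀ (g : Fin n → Bool) t (f : Fin n → R.Carrier) → T (g t) →
      S.∑ (allFin n) (λ u → (g u ∧ le u t) S.⊳ f u) R.≈ f t R.+ S.∑ (allFin n) (λ u → (g u ∧ lt u t) S.⊳ f u)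
    ∑-le g t f gt = R.trans (S.∑-cong (allFin n) (λ u → R.sym (S.⊳-exclusive {eqb u t} {g u ∧ lt u t} {g u ∧ le u t} (f u)
        (λ e → subst (λ z → T (g z ∧ le z t)) (sym (eqb⁻ e)) (T-∧⁺ gt (le-refl t)))
        (λ p → let (a , b) = T-∧⁻ {g u} p in T-∧⁺ a (proj₁ (lt⁻ b)))
        (λ p → let (a , b) = T-∧⁻ {g u} p in choose a (le-split u t b))
        (λ e p → proj₂ (lt⁻ (proj₂ (T-∧⁻ {g u} p))) (eqb⁻ e)))))
      (R.trans (S.∑-+ (allFin n) _ _) (R.+-congʳ (S.∑-pick t f)))
      where
      choose : ∀ {u} → T (g u) → T (eqb u t) ⊎ T (lt u t) → T (eqb u t) ⊎ T (g u ∧ lt u t)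
      choose a (inj₁ e) = inj₁ e
      choose a (inj₂ l) = inj₂ (T-∧⁺ a l)


module ChowRecursion {c ℓ} (R : CommutativeRing c ℓ) {n} (P : GradedBoundedPoset n) (X : CommutativeRing.Carrier R) where
  open GradedBoundedPoset P
  open PosetOrder P
  open IntervalOrder P
  open Rank P using (ρ-mono-<)
  open CommutativeRing R
    using (Carrier; _≈_; _+_; _*_; -_; _-_; 0#; 1#; +-cong; +-congˡ; +-congʳ; *-congˡ; *-congʳ; -‿cong; +-identityˡ; *-assoc; *-identityˡ; *-identityʳ; zeroʳ; setoid; reflexive)
    renaming (refl to ≈-refl; sym to ≈-sym; trans to ≈-trans)
  open Sums R
  open ℤ-Solver R
  open Relation.Binary.Reasoning.Setoid setoid

  X-1 : Carrier
  X-1 = X - 1#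

  pow : ℕ → Carrier
  pow zero = 1#
  pow (suc k) = X * pow k

  e : Fin n → Carrier
  e t = eqb bot t ⊳ 1#

  ∑≤ : (Fin n → Carrier) → Fin n → Carrier
  ∑≤ f t = ∑ (allFin n) (λ u → le u t ⊳ f u)

  ∑< : (Fin n → Carrier) → Fin n → Carrier
  ∑< f t = ∑ (allFin n) (λ u → lt u t ⊳ f u)

  ∑≤-split : ∀ f t → ∑≤ f t ≈ f t + ∑< f t
  ∑≤-split f t = Split.∑-le R (λ _ → true) t f tt

  q : ℕ → Carrier
  q zero = 0#
  q (suc d) = 1# + X * q d

  X-1*q : ∀ d → X-1 * q d ≈ pow d - 1#
  X-1*q zero = ≈-trans (zeroʳ X-1) (solve 0 (con ℤ.0ℤ := con ℤ.1ℤ :- con ℤ.1ℤ) ≈-refl)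
  X-1*q (suc d) = begin
    X-1 * (1# + X * q d) ≈⟨ solve 2 (λ x y → (x :- con ℤ.1ℤ) :* (con ℤ.1ℤ :+ x :* y) := (x :- con ℤ.1ℤ) :+ x :* ((x :- con ℤ.1ℤ) :* y)) ≈-refl X (q d) ⟩
    (X - 1#) + X * (X-1 * q d) ≈⟨ +-congˡ (*-congˡ (X-1*q d)) ⟩
    (X - 1#) + X * (pow d - 1#) ≈⟨ solve 2 (λ x y → (x :- con ℤ.1ℤ) :+ x :* (y :- con ℤ.1ℤ) := x :* y :- con ℤ.1ℤ) ≈-refl X (pow d) ⟩
    X * pow d - 1# ≈⟨ +-congʳ (≈-refl) ⟩
    pow (suc d) - 1# ∎

  -- Chosen so that ζʳᵉᵛ - X ζ = (1 - X) (1 - M).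
  M : Fin n → Fin n → Carrier
  M u t = X * q (ρ t ∸ ρ u ∸ 1)

  -- Strict monotonicity makes the rank difference a successor, so the subtraction of 1 in `M` does
  -- not truncate.
  X-1*M : ∀ {u t} → T (lt u t) → X-1 * M u t ≈ pow (ρ t ∸ ρ u) - X
  X-1*M {u} {t} ut with ρ t ∸ ρ u | ℕₚ.m<n⇒0<n∸m (ρ-mono-< ut)
  ... | suc d | _ = begin
    X-1 * (X * q d) ≈⟨ solve 3 (λ a b c → a :* (b :* c) := b :* (a :* c)) ≈-refl X-1 X (q d) ⟩
    X * (X-1 * q d) ≈⟨ *-congˡ (X-1*q d) ⟩
    X * (pow d - 1#) ≈⟨ solve 2 (λ x y → x :* (y :- con ℤ.1ℤ) := x :* y :- x) ≈-refl X (pow d) ⟩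
    X * pow d - X ≈⟨ +-congʳ (≈-refl) ⟩
    pow (suc d) - X ∎

  -- The facts about the incidence algebra that enter the argument. `h` is the row of H at `bot`,
  -- and division by x - 1 appears only as cancellation.
  record ChowData : Set (c Level.⊔ ℓ) where
    field
      X-1-cancel : ∀ p → X-1 * p ≈ 0# → p ≈ 0#
      h : Fin n → Carrier
      χᴿ χ̄ᴿ μᴿ : Fin n → Fin n → Carrier
      χ-expand : ∀ s t → χᴿ s t ≈ ∑ (allFin n) (λ w → (le s w ∧ le w t) ⊳ μᴿ s w * pow (ρ t ∸ ρ w))
      μζ : ∀ s t → ∑ (allFin n) (λ w → (le s w ∧ le w t) ⊳ μᴿ s w * 1#) ≈ eqb s t ⊳ 1#
      χ-diag : ∀ s → χᴿ s s ≈ 1#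
      χ̄-less : ∀ {s t} → T (lt s t) → X-1 * χ̄ᴿ s t ≈ χᴿ s t
      h-bot : h bot ≈ 1#
      h-rec : ∀ {t} → T (lt bot t) → h t ≈ ∑ (allFin n) (λ w → lt w t ⊳ h w * χ̄ᴿ w t)

  module _ (chow : ChowData) where
    open ChowData chow

    -- This is H χ = x H + (1 - x) in the row of `bot`. Above `bot` the terms below `t` give (x - 1)
    -- `h t` by `h-rec`, and the diagonal adds `h t`; `e` corrects the value at `bot`.
    hχ : ∀ t → ∑≤ (λ w → h w * χᴿ w t) t ≈ X * h t + (1# - X) * e t
    hχ t = ≈-trans (∑≤-split _ t) (≈-trans (+-congʳ (≈-trans (*-congˡ (χ-diag t)) (*-identityʳ _))) (case t (position bot t)))
      where
      case : ∀ t → Position bot t → h t + ∑< (λ w → h w * χᴿ w t) t ≈ X * h t + (1# - X) * e t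
      case t (outside o) = ⊥-elim (o (bot-le t))
      case _ (equal refl) = ≈-trans (+-congˡ (≈-trans (∑-cong (allFin n) (λ w → ⊳-zero (lt w bot) (λ wb → ⊥-elim (lt-irrefl (le-lt-trans (bot-le w) wb))))) (∑-zero (allFin n))))
        (≈-trans (+-congʳ h-bot) (≈-trans (solve 1 (λ x → con ℤ.1ℤ :+ con ℤ.0ℤ := x :* con ℤ.1ℤ :+ (con ℤ.1ℤ :- x) :* con ℤ.1ℤ) ≈-refl X)
          (≈-sym (+-cong (*-congˡ h-bot) (*-congˡ (reflexive (cong (_⊳ 1#) (eqb-refl bot))))))))
      case t (less bt) = ≈-trans (+-congˡ (begin
          ∑< (λ w → h w * χᴿ w t) t ≈⟨ ∑-cong (allFin n) (λ w → ≈-trans (⊳-cong (lt w t) (λ wt → ≈-trans (*-congˡ (≈-sym (χ̄-less wt)))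
                (solve 3 (λ a b c → a :* (b :* c) := b :* (a :* c)) ≈-refl (h w) X-1 (χ̄ᴿ w t)))) (≈-sym (⊳-* (lt w t) X-1 _))) ⟩
          ∑ (allFin n) (λ w → X-1 * (lt w t ⊳ h w * χ̄ᴿ w t)) ≈⟨ ∑-*ˡ (allFin n) X-1 _ ⟩
          X-1 * ∑< (λ w → h w * χ̄ᴿ w t) t ≈⟨ *-congˡ (≈-sym (h-rec bt)) ⟩
          X-1 * h t ∎))
        (≈-trans (solve 2 (λ x y → y :+ (x :+ :- con ℤ.1ℤ) :* y := x :* y :+ (con ℤ.1ℤ :- x) :* con ℤ.0ℤ) ≈-refl X (h t))
          (+-congˡ (*-congˡ (reflexive (cong (_⊳ 1#) (sym (¬T⇒false {eqb bot t} (λ e → proj₂ (lt⁻ bt) (eqb⁻ e)))))))))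

    J : Fin n → Carrier
    J u = ∑≤ (λ w → h w * μᴿ w u) u

    ∑J : ∀ (f : Fin n → Carrier) t → ∑≤ (λ u → J u * f u) t ≈ ∑≤ (λ w → h w * ∑ (allFin n) (λ u → (le w u ∧ le u t) ⊳ μᴿ w u * f u)) t
    ∑J f t = begin
      ∑ (allFin n) (λ u → le u t ⊳ J u * f u)
        ≈⟨ ∑-cong (allFin n) (λ u → ⊳-cong (le u t) (λ _ → ≈-trans (≈-sym (∑-*ʳ (allFin n) (f u) _)) (∑-cong (allFin n) (λ w → ⊳-*ʳ (le w u) (f u) _)))) ⟩
      ∑ (allFin n) (λ u → le u t ⊳ ∑ (allFin n) (λ w → le w u ⊳ h w * μᴿ w u * f u))
        ≈⟨ ∑-cong (allFin n) (λ u → ≈-trans (≈-sym (∑-⊳ (allFin n) (le u t) _)) (∑-cong (allFin n) (λ w → ⊳-∧ (le u t) (le w u) _))) ⟩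
      ∑ (allFin n) (λ u → ∑ (allFin n) (λ w → (le u t ∧ le w u) ⊳ h w * μᴿ w u * f u)) ≈⟨ ∑-swap (allFin n) (allFin n) _ ⟩
      ∑ (allFin n) (λ w → ∑ (allFin n) (λ u → (le u t ∧ le w u) ⊳ h w * μᴿ w u * f u))
        ≈⟨ ∑-cong (allFin n) (λ w → ∑-cong (allFin n) (λ u → ≈-trans (reflexive (cong (_⊳ h w * μᴿ w u * f u) (guard w u)))
             (≈-trans (≈-sym (⊳-∧ (le w t) (le w u ∧ le u t) _)) (⊳-cong (le w t) (λ _ → ≈-trans (⊳-cong (le w u ∧ le u t) (λ _ → *-assoc _ _ _)) (≈-sym (⊳-* (le w u ∧ le u t) (h w) _))))))) ⟩
      ∑ (allFin n) (λ w → ∑ (allFin n) (λ u → le w t ⊳ h w * ((le w u ∧ le u t) ⊳ μᴿ w u * f u)))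
        ≈⟨ ∑-cong (allFin n) (λ w → ≈-trans (∑-⊳ (allFin n) (le w t) _) (⊳-cong (le w t) (λ _ → ∑-*ˡ (allFin n) (h w) _))) ⟩
      ∑ (allFin n) (λ w → le w t ⊳ h w * ∑ (allFin n) (λ u → (le w u ∧ le u t) ⊳ μᴿ w u * f u)) ∎
      where
      guard : ∀ w u → le u t ∧ le w u ≡ le w t ∧ (le w u ∧ le u t)
      guard w u = T-ext (λ p → let (a , b) = T-∧⁻ {le u t} p in T-∧⁺ (le-trans w u t b a) (T-∧⁺ b a))
                        (λ p → let (_ , q) = T-∧⁻ {le w t} p ; (b , a) = T-∧⁻ {le w u} q in T-∧⁺ a b)

    Jζ : ∀ t → ∑≤ J t ≈ h t
    Jζ t = begin
      ∑≤ J t ≈⟨ ∑-cong (allFin n) (λ u → ⊳-cong (le u t) (λ _ → ≈-sym (*-identityʳ _))) ⟩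
      ∑≤ (λ u → J u * 1#) t ≈⟨ ∑J (λ _ → 1#) t ⟩
      ∑≤ (λ w → h w * ∑ (allFin n) (λ u → (le w u ∧ le u t) ⊳ μᴿ w u * 1#)) t
        ≈⟨ ∑-cong (allFin n) (λ w → ⊳-cong (le w t) (λ _ → ≈-trans (*-congˡ (μζ w t)) (≈-trans (⊳-* (eqb w t) (h w) 1#) (⊳-cong (eqb w t) (λ _ → *-identityʳ _))))) ⟩
      ∑ (allFin n) (λ w → le w t ⊳ eqb w t ⊳ h w)
        ≈⟨ ∑-cong (allFin n) (λ w → ≈-trans (⊳-∧ (le w t) (eqb w t) _) (reflexive (cong (_⊳ h w) (T-ext (proj₂ ∘ T-∧⁻ {le w t})
             (λ q → T-∧⁺ (subst (λ z → T (le w z)) (eqb⁻ q) (le-refl w)) q))))) ⟩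
      ∑ (allFin n) (λ w → eqb w t ⊳ h w) ≈⟨ ∑-pick t h ⟩
      h t ∎

    Jζʳᵉᵛ : ∀ t → ∑≤ (λ u → J u * pow (ρ t ∸ ρ u)) t ≈ X * h t + (1# - X) * e t
    Jζʳᵉᵛ t = ≈-trans (∑J (λ u → pow (ρ t ∸ ρ u)) t) (≈-trans (∑-cong (allFin n) (λ w → ⊳-cong (le w t) (λ _ → *-congˡ
      (≈-sym (χ-expand w t))))) (hχ t))

    -- The difference of the two sides is cancelled after multiplication by x - 1, where `total`, a
    -- comparison of J ζʳᵉᵛ with x J ζ, makes it vanish.
    J-rec : ∀ t → J t ≈ e t + ∑< (λ u → J u * M u t) t
    J-rec t = begin
      J t ≈⟨ solve 3 (λ a b c → a := (a :- (b :+ c)) :+ (b :+ c)) ≈-refl (J t) (e t) S ⟩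
      (J t - (e t + S)) + (e t + S) ≈⟨ +-congʳ (X-1-cancel _ vanish) ⟩
      0# + (e t + S) ≈⟨ +-identityˡ _ ⟩
      e t + S ∎
      where
      S S₁ S₀ : Carrier
      S = ∑< (λ u → J u * M u t) t
      S₁ = ∑< (λ u → J u * pow (ρ t ∸ ρ u)) t
      S₀ = ∑< J t
      X-1*S : X-1 * S ≈ S₁ - X * S₀
      X-1*S = begin
        X-1 * S ≈⟨ ≈-sym (∑-*ˡ (allFin n) X-1 _) ⟩
        ∑ (allFin n) (λ u → X-1 * (lt u t ⊳ J u * M u t))
          ≈⟨ ∑-cong (allFin n) (λ u → ≈-trans (⊳-* (lt u t) X-1 _) (≈-trans (⊳-cong (lt u t) (λ ut →
               ≈-trans (solve 3 (λ a b c → a :* (b :* c) := b :* (a :* c)) ≈-refl X-1 (J u) (M u t)) (≈-trans (*-congˡ (X-1*M ut))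
                 (solve 3 (λ j m x → j :* (m :- x) := j :* m :+ (:- x) :* j) ≈-refl (J u) (pow (ρ t ∸ ρ u)) X))))
               (≈-trans (⊳-+ (lt u t) _ _) (+-congˡ (≈-sym (⊳-* (lt u t) (- X) _)))))) ⟩
        ∑ (allFin n) (λ u → (lt u t ⊳ J u * pow (ρ t ∸ ρ u)) + (- X) * (lt u t ⊳ J u)) ≈⟨ ∑-+ (allFin n) _ _ ⟩
        S₁ + ∑ (allFin n) (λ u → (- X) * (lt u t ⊳ J u)) ≈⟨ +-congˡ (∑-*ˡ (allFin n) (- X) _) ⟩
        S₁ + (- X) * S₀ ≈⟨ solve 3 (λ a x b → a :+ (:- x) :* b := a :- x :* b) ≈-refl S₁ X S₀ ⟩
        S₁ - X * S₀ ∎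
      total : J t + S₁ ≈ X * (J t + S₀) + (1# - X) * e t
      total = begin
        J t + S₁ ≈⟨ +-congʳ (≈-sym (≈-trans (*-congˡ (reflexive (cong pow (ℕₚ.n∸n≡0 (ρ t))))) (*-identityʳ _))) ⟩
        J t * pow (ρ t ∸ ρ t) + S₁ ≈⟨ ≈-sym (∑≤-split _ t) ⟩
        ∑≤ (λ u → J u * pow (ρ t ∸ ρ u)) t ≈⟨ Jζʳᵉᵛ t ⟩
        X * h t + (1# - X) * e t ≈⟨ +-congʳ (*-congˡ (≈-sym (≈-trans (≈-sym (∑≤-split J t)) (Jζ t)))) ⟩
        X * (J t + S₀) + (1# - X) * e t ∎
      vanish : X-1 * (J t - (e t + S)) ≈ 0#
      vanish = begin
        X-1 * (J t - (e t + S)) ≈⟨ solve 4 (λ y j e s → y :* (j :- (e :+ s)) := (y :* j :- y :* e) :- y :* s) ≈-refl X-1 (J t) (e t) S ⟩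
        (X-1 * J t - X-1 * e t) - X-1 * S ≈⟨ +-congˡ (-‿cong X-1*S) ⟩
        (X-1 * J t - X-1 * e t) - (S₁ - X * S₀)
          ≈⟨ solve 5 (λ x j e s₁ s₀ → ((x :+ :- con ℤ.1ℤ) :* j :- (x :+ :- con ℤ.1ℤ) :* e) :- (s₁ :- x :* s₀)
                                    := (x :* (j :+ s₀) :+ (con ℤ.1ℤ :- x) :* e) :- (j :+ s₁)) ≈-refl X (J t) (e t) S₁ S₀ ⟩
        (X * (J t + S₀) + (1# - X) * e t) - (J t + S₁) ≈⟨ +-congʳ (≈-sym total) ⟩
        (J t + S₁) - (J t + S₁) ≈⟨ solve 1 (λ a → a :- a := con ℤ.0ℤ) ≈-refl _ ⟩
        0# ∎

    -- (1 - M) v = 1 and J (1 - M) = e give h top = J 1 = J (1 - M) v = v bot.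
    chow-unique : ∀ (v : Fin n → Carrier) → (∀ s → v s ≈ 1# + ∑ (allFin n) (λ w → lt s w ⊳ M s w * v w)) → h top ≈ v bot
    chow-unique v v-rec = begin
      h top ≈⟨ ≈-sym (Jζ top) ⟩
      ∑≤ J top ≈⟨ ∑-cong (allFin n) (λ u → reflexive (cong (_⊳ J u) (T⇒true (le-top u)))) ⟩
      ∑ (allFin n) J ≈⟨ ∑-cong (allFin n) (λ u → ≈-trans (solve 2 (λ j r → j := j :* (con ℤ.1ℤ :+ r) :+ (:- (j :* r))) ≈-refl (J u) (N u))
                          (+-congʳ (*-congˡ (≈-sym (v-rec u))))) ⟩
      ∑ (allFin n) (λ u → J u * v u + - (J u * N u)) ≈⟨ ≈-trans (∑-+ (allFin n) _ _) (+-congˡ (∑-neg (allFin n) _)) ⟩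
      ∑ (allFin n) (λ u → J u * v u) - ∑ (allFin n) (λ u → J u * N u) ≈⟨ +-cong (∑-cong (allFin n) (λ t → *-congʳ (J-rec t))) (-‿cong exchange) ⟩
      ∑ (allFin n) (λ t → (e t + K t) * v t) - ∑ (allFin n) (λ t → K t * v t)
        ≈⟨ +-congʳ (≈-trans (∑-cong (allFin n) (λ t → solve 3 (λ a b c → (a :+ b) :* c := a :* c :+ b :* c) ≈-refl (e t) (K t) (v t))) (∑-+ (allFin n) _ _)) ⟩
      (∑ (allFin n) (λ t → e t * v t) + ∑ (allFin n) (λ t → K t * v t)) - ∑ (allFin n) (λ t → K t * v t)
        ≈⟨ solve 2 (λ a b → (a :+ b) :- b := a) ≈-refl _ _ ⟩
      ∑ (allFin n) (λ t → e t * v t) ≈⟨ ∑-cong (allFin n) (λ t → ≈-trans (⊳-*ʳ (eqb bot t) (v t) 1#)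
           (≈-trans (⊳-cong (eqb bot t) (λ _ → *-identityˡ _)) (reflexive (cong (_⊳ v t) (T-ext (λ p → eqb⁺ (sym (eqb⁻ p))) (λ p → eqb⁺ (sym (eqb⁻ p)))))))) ⟩
      ∑ (allFin n) (λ t → eqb t bot ⊳ v t) ≈⟨ ∑-pick bot v ⟩
      v bot ∎
      where
      N K : Fin n → Carrier
      N u = ∑ (allFin n) (λ t → lt u t ⊳ M u t * v t)
      K t = ∑< (λ u → J u * M u t) t
      exchange : ∑ (allFin n) (λ u → J u * N u) ≈ ∑ (allFin n) (λ t → K t * v t)
      exchange = begin
        ∑ (allFin n) (λ u → J u * N u) ≈⟨ ∑-cong (allFin n) (λ u → ≈-trans (≈-sym (∑-*ˡ (allFin n) (J u) _)) (∑-cong (allFin n) (λ t →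
              ≈-trans (⊳-* (lt u t) (J u) _) (≈-trans (⊳-cong (lt u t) (λ _ → ≈-sym (*-assoc _ _ _))) (≈-sym (⊳-*ʳ (lt u t) (v t) _)))))) ⟩
        ∑ (allFin n) (λ u → ∑ (allFin n) (λ t → (lt u t ⊳ J u * M u t) * v t)) ≈⟨ ∑-swap (allFin n) (allFin n) _ ⟩
        ∑ (allFin n) (λ t → ∑ (allFin n) (λ u → (lt u t ⊳ J u * M u t) * v t)) ≈⟨ ∑-cong (allFin n) (λ t → ∑-*ʳ (allFin n) (v t) _) ⟩
        ∑ (allFin n) (λ t → K t * v t) ∎


-- Möbius, characteristic and Chow functions

module IncidenceAlgebra {n} (P : GradedBoundedPoset n) where
  open GradedBoundedPoset P
  open PosetOrder P
  open IntervalOrder P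
  open Rank P
  open Counting {A = Fin n}
  open PolynomialRing hiding (≈-refl; ≈-sym; ≈-trans)
  open CommutativeRing commutativeRing
    using (_≈_; _+_; _*_; -_; _-_; 1#; +-cong; +-congˡ; *-congˡ; *-congʳ; -‿cong; +-identityˡ; +-identityʳ; *-identityʳ; reflexive)
    renaming (refl to ≈-refl; sym to ≈-sym; trans to ≈-trans)
  open Sums commutativeRing
  open ℤ-Solver commutativeRing
  private module ZS = Sums ℤₚ.+-*-commutativeRing
  open ZS using () renaming (_⊳_ to _⊳ᶻ_; ∑ to ∑ᶻ)

  below : Fin n → Fin n → Fin n → Bool
  below s t w = le s w ∧ lt w t

  -- The fuel that suffices for recursions ending at `t`: it drops at every strict step down and
  -- stays below `n`.
  height : Fin n → ℕ
  height t = number (λ x → lt x t) (allFin n)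

  height-mono : ∀ {w t} → T (lt w t) → height w < height t
  height-mono {w} wt = number-mono-< (λ x xw → lt-trans xw wt) {w} wt lt-irrefl (∈-allFin w)

  height<n : ∀ t → height t < n
  height<n t = subst (height t <_) (trans (number-true (allFin n)) (Listₚ.length-tabulate id))
    (number-mono-< {g = λ _ → true} (λ _ _ → tt) {t} tt lt-irrefl (∈-allFin t))
    where
    number-true : ∀ xs → number (λ _ → true) xs ≡ length xs
    number-true [] = refl
    number-true (x ∷ xs) = cong suc (number-true xs)

  suc-n : Fin n → ∃[ k ] n ≡ suc k
  suc-n Fin.zero = _ , refl
  suc-n (Fin.suc _) = _ , refl

  sumℤ-over≡∑ : ∀ pr f → sumℤ-over P pr f ≡ ∑ᶻ (allFin n) (λ w → pr w ⊳ᶻ f w)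
  sumℤ-over≡∑ pr f = go (allFin n)
    where
    go : ∀ xs → foldr (λ w acc → if pr w then f w ℤ.+ acc else acc) ℤ.0ℤ xs ≡ ∑ᶻ xs (λ w → pr w ⊳ᶻ f w)
    go [] = refl
    go (x ∷ xs) with pr x
    ... | true = cong (λ z → f x ℤ.+ z) (go xs)
    ... | false = trans (go xs) (sym (ℤₚ.+-identityˡ _))

  sumₚ-over≈∑ : ∀ pr f → sumₚ-over P pr f ≈ ∑ (allFin n) (λ w → pr w ⊳ f w)
  sumₚ-over≈∑ pr f = go (allFin n)
    where
    go : ∀ xs → sumₚ (map f (List.filterᵇ pr xs)) ≈ ∑ xs (λ w → pr w ⊳ f w)
    go [] = ≈-refl
    go (x ∷ xs) with pr x
    ... | true = +-congˡ (go xs)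
    ... | false = go xs

  μF-suc : ∀ k {s t} → T (le s t) → s ≢ t → μF P (suc k) s t ≡ ℤ.- sumℤ-over P (below s t) (μF P k s)
  μF-suc k {s} {t} st s≢t with eqb s t in e | le s t
  ... | true | _ = ⊥-elim (s≢t (eqb⁻ (subst T (sym e) tt)))
  ... | false | false = ⊥-elim st
  ... | false | true = refl

  μF-outside : ∀ k {s t} → ¬ T (le s t) → μF P k s t ≡ ℤ.0ℤ
  μF-outside k {s} {t} n with eqb s t in e | le s t in l
  ... | true | _ = ⊥-elim (n (subst T l (subst (λ z → T (le s z)) (eqb⁻ (subst T (sym e) tt)) (le-refl s))))
  ... | false | false = refl
  ... | false | true = ⊥-elim (n tt)

  μF-diag : ∀ k s → μF P k s s ≡ ℤ.1ℤ
  μF-diag k s with eqb s s in e | le s s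
  ... | true | _ = refl
  ... | false | _ = ⊥-elim (subst T (trans (sym (eqb-refl s)) e) tt)

  -- Above the height of `t` the value no longer depends on the fuel, so the defining recursion,
  -- which consumes one unit, holds with fuel `n` on both sides.
  μF-stable : ∀ k k′ s t → height t ≤ k → height t ≤ k′ → μF P k s t ≡ μF P k′ s t
  μF-stable k k′ s t p q with position s t
  ... | equal refl = trans (μF-diag k s) (sym (μF-diag k′ s))
  ... | outside o = trans (μF-outside k o) (sym (μF-outside k′ o))
  μF-stable zero k′ s t p q | less st = ⊥-elim (ℕₚ.n≮0 (ℕₚ.<-≤-trans (height-mono st) p))
  μF-stable (suc k) zero s t p q | less st = ⊥-elim (ℕₚ.n≮0 (ℕₚ.<-≤-trans (height-mono st) q))
  μF-stable (suc k) (suc k′) s t p q | less st = trans (μF-suc k (proj₁ (lt⁻ st)) (proj₂ (lt⁻ st))) (trans (cong ℤ.-_ (trans (sumℤ-over≡∑ (below s t) (μF P k s)) (trans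
    (ZS.∑-cong (allFin n) (λ w → ZS.⊳-cong (below s t w) (λ b → let wt = proj₂ (T-∧⁻ {le s w} b) in
      μF-stable k k′ s w (ℕ.s≤s⁻¹ (ℕₚ.<-≤-trans (height-mono wt) p)) (ℕ.s≤s⁻¹ (ℕₚ.<-≤-trans (height-mono wt) q)))))
    (sym (sumℤ-over≡∑ (below s t) (μF P k′ s)))))) (sym (μF-suc k′ (proj₁ (lt⁻ st)) (proj₂ (lt⁻ st)))))

  μ-rec : ∀ {s t} → T (lt s t) → μ P s t ≡ ℤ.- ∑ᶻ (allFin n) (λ w → below s t w ⊳ᶻ μ P s w)
  μ-rec {s} {t} st with suc-n t
  ... | k , e = trans (μF-stable n (suc k) s t (ℕₚ.<⇒≤ (height<n t)) (subst (height t ≤_) e (ℕₚ.<⇒≤ (height<n t))))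
    (trans (μF-suc k (proj₁ (lt⁻ st)) (proj₂ (lt⁻ st))) (cong ℤ.-_ (trans (sumℤ-over≡∑ (below s t) (μF P k s)) (ZS.∑-cong (allFin n) (λ w → ZS.⊳-cong (below s t w)
      (λ b → μF-stable k n s w (ℕ.s≤s⁻¹ (ℕₚ.<-≤-trans (height-mono (proj₂ (T-∧⁻ {le s w} b))) (subst (height t ≤_) e (ℕₚ.<⇒≤ (height<n t)))))
        (ℕₚ.<⇒≤ (height<n w))))))))

  χ̄invF-suc : ∀ k {s t} → T (le s t) → s ≢ t → χ̄invF P (suc k) s t ≡ sumₚ-over P (below s t) (λ w → χ̄invF P k s w *ₚ χ̄ P w t)
  χ̄invF-suc k {s} {t} st s≢t with eqb s t in e | le s t
  ... | true | _ = ⊥-elim (s≢t (eqb⁻ (subst T (sym e) tt)))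
  ... | false | false = ⊥-elim st
  ... | false | true = refl

  χ̄invF-outside : ∀ k {s t} → ¬ T (le s t) → χ̄invF P k s t ≡ []
  χ̄invF-outside k {s} {t} n with eqb s t in e | le s t in l
  ... | true | _ = ⊥-elim (n (subst T l (subst (λ z → T (le s z)) (eqb⁻ (subst T (sym e) tt)) (le-refl s))))
  ... | false | false = refl
  ... | false | true = ⊥-elim (n tt)

  χ̄invF-diag : ∀ k s → χ̄invF P k s s ≡ constₚ (ℤ.- ℤ.1ℤ)
  χ̄invF-diag k s with eqb s s in e | le s s
  ... | true | _ = refl
  ... | false | _ = ⊥-elim (subst T (trans (sym (eqb-refl s)) e) tt)

  χ̄invF-stable : ∀ k k′ s t → height t ≤ k → height t ≤ k′ → χ̄invF P k s t ≈ χ̄invF P k′ s t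
  χ̄invF-stable k k′ s t p q with position s t
  ... | equal refl = reflexive (trans (χ̄invF-diag k s) (sym (χ̄invF-diag k′ s)))
  ... | outside o = reflexive (trans (χ̄invF-outside k o) (sym (χ̄invF-outside k′ o)))
  χ̄invF-stable zero k′ s t p q | less st = ⊥-elim (ℕₚ.n≮0 (ℕₚ.<-≤-trans (height-mono st) p))
  χ̄invF-stable (suc k) zero s t p q | less st = ⊥-elim (ℕₚ.n≮0 (ℕₚ.<-≤-trans (height-mono st) q))
  χ̄invF-stable (suc k) (suc k′) s t p q | less st = ≈-trans (reflexive (χ̄invF-suc k (proj₁ (lt⁻ st)) (proj₂ (lt⁻ st)))) (≈-trans (sumₚ-over≈∑ _ _) (≈-trans
    (∑-cong (allFin n) (λ w → ⊳-cong (below s t w) (λ b → let wt = proj₂ (T-∧⁻ {le s w} b) in *-congʳ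
      (χ̄invF-stable k k′ s w (ℕ.s≤s⁻¹ (ℕₚ.<-≤-trans (height-mono wt) p)) (ℕ.s≤s⁻¹ (ℕₚ.<-≤-trans (height-mono wt) q))))))
    (≈-trans (≈-sym (sumₚ-over≈∑ _ _)) (reflexive (sym (χ̄invF-suc k′ (proj₁ (lt⁻ st)) (proj₂ (lt⁻ st))))))))

  χ̄inv-rec : ∀ {s t} → T (lt s t) → χ̄inv P s t ≈ ∑ (allFin n) (λ w → below s t w ⊳ χ̄inv P s w * χ̄ P w t)
  χ̄inv-rec {s} {t} st with suc-n t
  ... | k , e = ≈-trans (χ̄invF-stable n (suc k) s t (ℕₚ.<⇒≤ (height<n t)) (subst (height t ≤_) e (ℕₚ.<⇒≤ (height<n t))))
    (≈-trans (reflexive (χ̄invF-suc k (proj₁ (lt⁻ st)) (proj₂ (lt⁻ st)))) (≈-trans (sumₚ-over≈∑ _ _) (∑-cong (allFin n) (λ w → ⊳-cong (below s t w)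
      (λ b → *-congʳ (χ̄invF-stable k n s w (ℕ.s≤s⁻¹ (ℕₚ.<-≤-trans (height-mono (proj₂ (T-∧⁻ {le s w} b))) (subst (height t ≤_) e (ℕₚ.<⇒≤ (height<n t)))))
        (ℕₚ.<⇒≤ (height<n w))))))))

  μζ : ∀ s t → ∑ᶻ (allFin n) (λ w → (le s w ∧ le w t) ⊳ᶻ μ P s w) ≡ (if eqb s t then ℤ.1ℤ else ℤ.0ℤ)
  μζ s t with position s t
  ... | equal refl = trans (Split.∑-le ℤₚ.+-*-commutativeRing (le s) s (μ P s) (le-refl s))
    (trans (cong₂ ℤ._+_ (μF-diag n s) (trans (ZS.∑-cong (allFin n) (λ w → ZS.⊳-zero (below s s w)
        (λ b → let (sw , ws) = T-∧⁻ {le s w} b in ⊥-elim (lt-irrefl (le-lt-trans sw ws))))) (ZS.∑-zero (allFin n))))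
      (sym (cong (λ b → if b then ℤ.1ℤ else ℤ.0ℤ) (eqb-refl s))))
  ... | less st = trans (Split.∑-le ℤₚ.+-*-commutativeRing (le s) t (μ P s) (proj₁ (lt⁻ st)))
    (trans (cong (λ z → z ℤ.+ ∑ᶻ (allFin n) (λ w → below s t w ⊳ᶻ μ P s w)) (μ-rec st)) (trans (ℤₚ.+-inverseˡ (∑ᶻ (allFin n) (λ w → below s t w ⊳ᶻ μ P s w)))
      (sym (cong (λ b → if b then ℤ.1ℤ else ℤ.0ℤ) (¬T⇒false {eqb s t} (λ e → proj₂ (lt⁻ st) (eqb⁻ e)))))))
  ... | outside o = trans (ZS.∑-cong (allFin n) (λ w → ZS.⊳-zero (le s w ∧ le w t) (λ b → let (sw , wt) = T-∧⁻ {le s w} b in ⊥-elim (o (le-trans s w t sw wt)))))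
    (trans (ZS.∑-zero (allFin n)) (sym (cong (λ b → if b then ℤ.1ℤ else ℤ.0ℤ) (¬T⇒false {eqb s t} (λ e → o (subst (λ z → T (le s z)) (eqb⁻ e) (le-refl s)))))))

  evalAt1-∑ : ∀ {i} {I : Set i} (xs : List I) f → evalAt1 (∑ xs f) ≡ ∑ᶻ xs (λ x → evalAt1 (f x))
  evalAt1-∑ [] f = refl
  evalAt1-∑ (x ∷ xs) f = trans (evalAt1-+ (f x) (∑ xs f)) (cong (λ z → evalAt1 (f x) ℤ.+ z) (evalAt1-∑ xs f))

  evalAt1-cong : ∀ {p q} → p ≈ q → evalAt1 p ≡ evalAt1 q
  evalAt1-cong {p} {q} e = go p q (λ k → e .at k)
    where
    zero-eval : ∀ q → (∀ k → ℤ.0ℤ ≡ coeff q k) → ℤ.0ℤ ≡ evalAt1 q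
    zero-eval [] e = refl
    zero-eval (b ∷ q) e = trans (sym (ℤₚ.+-identityˡ ℤ.0ℤ)) (cong₂ ℤ._+_ (e 0) (zero-eval q (λ k → e (suc k))))
    go : ∀ p q → (∀ k → coeff p k ≡ coeff q k) → evalAt1 p ≡ evalAt1 q
    go [] q e = zero-eval q e
    go (a ∷ p) [] e = sym (zero-eval (a ∷ p) (λ k → sym (e k)))
    go (a ∷ p) (b ∷ q) e = cong₂ ℤ._+_ (e 0) (go p q (λ k → e (suc k)))

  χ-term : Fin n → Fin n → Fin n → Poly
  χ-term s t w = scaleₚ (μ P s w) (monoₚ (ρ t ∸ ρ w))

  χ≈∑ : ∀ s t → χ P s t ≈ ∑ (allFin n) (λ w → (le s w ∧ le w t) ⊳ χ-term s t w)
  χ≈∑ s t = sumₚ-over≈∑ _ _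

  -- At 1 all powers become 1 and the Möbius sum over the interval remains. This is the divisibility
  -- that makes `divX-1` exact.
  evalAt1-χ : ∀ {s t} → T (lt s t) → evalAt1 (χ P s t) ≡ ℤ.0ℤ
  evalAt1-χ {s} {t} st = trans (evalAt1-cong (χ≈∑ s t)) (trans (evalAt1-∑ (allFin n) _) (trans
    (ZS.∑-cong (allFin n) (λ w → trans (guard (le s w ∧ le w t) w) (cong ((le s w ∧ le w t) ⊳ᶻ_)
      (trans (evalAt1-scale (μ P s w) (monoₚ (ρ t ∸ ρ w))) (trans (cong (λ z → μ P s w ℤ.* z) (evalAt1-mono (ρ t ∸ ρ w))) (ℤₚ.*-identityʳ _))))))
    (trans (μζ s t) (cong (λ b → if b then ℤ.1ℤ else ℤ.0ℤ) (¬T⇒false {eqb s t} (λ e → proj₂ (lt⁻ st) (eqb⁻ e)))))))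
    where
    guard : ∀ b w → evalAt1 (b ⊳ χ-term s t w) ≡ b ⊳ᶻ evalAt1 (χ-term s t w)
    guard true w = refl
    guard false w = refl

  χ̄-less : ∀ {s t} → T (lt s t) → X-1 * χ̄ P s t ≈ χ P s t
  χ̄-less {s} {t} st = ≈-trans (*-congˡ {X-1} (reflexive (cong (λ b → if b then constₚ (ℤ.- ℤ.1ℤ) else divX-1 (χ P s t))
    (¬T⇒false {eqb s t} (λ e → proj₂ (lt⁻ st) (eqb⁻ e)))))) (X-1*divX-1 (χ P s t) (evalAt1-χ st))

  χ-diag : ∀ s → χ P s s ≈ 1#
  χ-diag s = ≈-trans (χ≈∑ s s) (≈-trans (Split.∑-le commutativeRing (le s) s (χ-term s s) (le-refl s))
    (≈-trans (+-cong (reflexive (cong₂ (λ i k → scaleₚ i (monoₚ k)) (μF-diag n s) (ℕₚ.n∸n≡0 (ρ s))))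
      (≈-trans (∑-cong (allFin n) (λ w → ⊳-zero (below s s w) (λ b → let (sw , ws) = T-∧⁻ {le s w} b in ⊥-elim (lt-irrefl (le-lt-trans sw ws))))) (∑-zero (allFin n))))
      (+-identityʳ _)))

  h : Fin n → Poly
  h t = H P bot t

  h-bot : h bot ≈ 1#
  h-bot = reflexive (cong negₚ (χ̄invF-diag n bot))

  h-rec : ∀ {t} → T (lt bot t) → h t ≈ ∑ (allFin n) (λ w → lt w t ⊳ h w * χ̄ P w t)
  h-rec {t} bt = ≈-trans (-‿cong (χ̄inv-rec bt)) (≈-trans (≈-sym (∑-neg (allFin n) _)) (∑-cong (allFin n) (λ w →
    ≈-trans (reflexive (cong (λ b → - (b ⊳ χ̄inv P bot w * χ̄ P w t)) (cong (_∧ lt w t) (T⇒true (bot-le w)))))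
      (guard (lt w t) w))))
    where
    guard : ∀ b w → - (b ⊳ χ̄inv P bot w * χ̄ P w t) ≈ b ⊳ h w * χ̄ P w t
    guard true w = solve 2 (λ x y → :- (x :* y) := (:- x) :* y) ≈-refl (χ̄inv P bot w) (χ̄ P w t)
    guard false w = ≈-refl

  μₚ : Fin n → Fin n → Poly
  μₚ w u = constₚ (μ P w u)

  μₚζ : ∀ w t → ∑ (allFin n) (λ u → (le w u ∧ le u t) ⊳ μₚ w u * 1#) ≈ eqb w t ⊳ 1#
  μₚζ w t = ≈-trans (∑-cong (allFin n) (λ u → ≈-trans (⊳-cong (le w u ∧ le u t) (λ _ → *-identityʳ _)) (const-⊳ (le w u ∧ le u t) (μ P w u))))
    (≈-trans (const-∑ (allFin n) _) (≈-trans (∷-cong (μζ w t) ≈-refl) (const-if (eqb w t))))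
    where
    const-⊳ : ∀ b i → b ⊳ constₚ i ≈ constₚ (b ⊳ᶻ i)
    const-⊳ true i = ≈-refl
    const-⊳ false i = ≈-sym 0∷[]
    const-if : ∀ b → constₚ (if b then ℤ.1ℤ else ℤ.0ℤ) ≈ b ⊳ 1#
    const-if true = ≈-refl
    const-if false = 0∷[]
    const-∑ : ∀ xs f → ∑ xs (λ u → constₚ (f u)) ≈ constₚ (∑ᶻ xs f)
    const-∑ [] f = ≈-sym 0∷[]
    const-∑ (x ∷ xs) f = +-congˡ {constₚ (f x)} (const-∑ xs f)

-- Solving the recursion by flag h-numbers

module ChowSolution {c ℓ} (R : CommutativeRing c ℓ) {n} (P : GradedBoundedPoset n) (X : CommutativeRing.Carrier R) where
  open GradedBoundedPoset P
  open PosetOrder P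
  open IntervalOrder P
  open Rank P using (ρ-mono-<)
  open CommutativeRing R
    using (Carrier; _≈_; _+_; _*_; -_; _-_; 0#; 1#; +-cong; +-congˡ; +-congʳ; *-cong; *-congˡ; *-congʳ; -‿cong; +-identityˡ; +-identityʳ; *-identityˡ; *-identityʳ; zeroˡ; zeroʳ; setoid; reflexive)
    renaming (refl to ≈-refl; sym to ≈-sym; trans to ≈-trans)
  open Sums R
  open ℤ-Solver R
  open ChowRecursion R P X
  open FlagNumbers R P
  open Relation.Binary.Reasoning.Setoid setoid

  -- With `m` ranks left from `l` on, `a` is the weighted sum over all tilings of them. `b` is the
  -- same with rank `l` forced to be selected, its difference being the recursion of `β` at a true
  -- bit; it is 0 when no rank is left.
  a b : ℕ → ℕ → Fin n → Carrier
  a zero l s = 1#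
  a (suc m) l s = (1# + X) * a m (suc l) s + X * b m (suc l) s
  b zero l s = 0#
  b (suc m) l s = ∑ (allFin n) (λ x → atRank s l x ⊳ a m (suc l) x) - a m (suc l) s

  v : Fin n → Carrier
  v s = a (rank P ∸ 1 ∸ ρ s) (suc (ρ s)) s

  aboveRank : Fin n → ℕ → Fin n → Bool
  aboveRank s l w = lt s w ∧ (l ≤ᵇ ρ w)

  aboveRank⁻ : ∀ {s l w} → T (aboveRank s l w) → T (lt s w) × l ≤ ρ w
  aboveRank⁻ {s} {l} {w} p = let (x , y) = T-∧⁻ {lt s w} p in x , ℕₚ.≤ᵇ⇒≤ l (ρ w) y

  aboveRank⁺ : ∀ {s l w} → T (lt s w) → l ≤ ρ w → T (aboveRank s l w)
  aboveRank⁺ x y = T-∧⁺ x (ℕₚ.≤⇒≤ᵇ y)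

  atRank⁻ : ∀ {s l w} → T (atRank s l w) → T (lt s w) × ρ w ≡ l
  atRank⁻ {s} {l} {w} p = let (x , y) = T-∧⁻ {lt s w} p in x , ℕₚ.≡ᵇ⇒≡ (ρ w) l y

  gap : ∀ {s d l} → ρ s ℕ.+ suc d ≡ l → l ∸ ρ s ∸ 1 ≡ d
  gap {s} {d} refl = cong (_∸ 1) (ℕₚ.m+n∸m≡n (ρ s) (suc d))

  v-top : v top ≈ 1#
  v-top = reflexive (cong (λ m → a m (suc (ρ top)) top) (ℕₚ.m≤n⇒m∸n≡0 (ℕₚ.m∸n≤m (rank P) 1)))

  -- The part of the recursion sum over ranks ≥ l = ρ s + d + 1 is a combination of a and b,
  -- because q (d + 2) = (1 + X) q (d + 1) - X q d.
  tail-sum : ∀ m l s d → l ℕ.+ m ≡ rank P → ρ s ℕ.+ suc d ≡ l →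
    1# + ∑ (allFin n) (λ w → aboveRank s l w ⊳ M s w * v w) ≈ q (suc d) * a m l s + X * q d * b m l s
  tail-sum zero l s d l≡r s≡l = begin
    1# + ∑ (allFin n) (λ w → aboveRank s l w ⊳ M s w * v w)
      -- When `l` is the rank of the poset, only `top` is left.
      ≈⟨ +-congˡ (≈-trans (∑-cong (allFin n) (λ w → reflexive (cong (_⊳ M s w * v w) (T-ext (to w) (from w))))) (∑-pick top _)) ⟩
    1# + M s top * v top ≈⟨ +-congˡ (≈-trans (*-congˡ v-top) (*-identityʳ _)) ⟩
    1# + X * q (ρ top ∸ ρ s ∸ 1) ≈⟨ +-congˡ (*-congˡ (reflexive (cong q (gap {s} (trans s≡l l≡rank))))) ⟩
    1# + X * q d ≈⟨ solve 2 (λ x y → con ℤ.1ℤ :+ x :* y := (con ℤ.1ℤ :+ x :* y) :* con ℤ.1ℤ :+ x :* y :* con ℤ.0ℤ) ≈-refl X (q d) ⟩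
    q (suc d) * 1# + X * q d * 0# ∎
    where
    l≡rank : l ≡ rank P
    l≡rank = trans (sym (ℕₚ.+-identityʳ l)) l≡r
    s<top : ρ s < ρ top
    s<top = subst (ρ s <_) (trans s≡l l≡rank) (ℕₚ.m<m+n (ρ s) (s≤s z≤n))
    to : ∀ w → T (aboveRank s l w) → T (eqb w top)
    to w p with w Fin.≟ top
    ... | yes _ = tt
    ... | no ne = ℕₚ.<⇒≱ (ρ-mono-< (lt⁺ (le-top w) ne)) (subst (_≤ ρ w) l≡rank (proj₂ (aboveRank⁻ {s} {l} {w} p)))
    from : ∀ w → T (eqb w top) → T (aboveRank s l w)
    from w e with eqb⁻ e
    ... | refl = aboveRank⁺ (lt⁺ (le-top s) (λ { refl → ℕₚ.<-irrefl refl s<top })) (ℕₚ.≤-reflexive l≡rank)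
  tail-sum (suc m) l s d l≡r s≡l = begin
    1# + ∑ (allFin n) (λ w → aboveRank s l w ⊳ M s w * v w)
      ≈⟨ +-congˡ (≈-trans (∑-cong (allFin n) (λ w → ≈-sym (⊳-exclusive {atRank s l w} {aboveRank s (suc l) w} {aboveRank s l w} (M s w * v w)
           (λ p → let (x , y) = atRank⁻ {s} {l} {w} p in aboveRank⁺ x (ℕₚ.≤-reflexive (sym y)))
           (λ p → let (x , y) = aboveRank⁻ {s} {suc l} {w} p in aboveRank⁺ x (ℕₚ.<⇒≤ y))
           (λ p → let (x , y) = aboveRank⁻ {s} {l} {w} p in choose w x y (l ℕ.≟ ρ w))
           (λ p p′ → ℕₚ.<⇒≢ (proj₂ (aboveRank⁻ {s} {suc l} {w} p′)) (sym (proj₂ (atRank⁻ {s} {l} {w} p)))))))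
         (∑-+ (allFin n) _ _)) ⟩
    1# + (∑ (allFin n) (λ w → atRank s l w ⊳ M s w * v w) + ∑ (allFin n) (λ w → aboveRank s (suc l) w ⊳ M s w * v w))
      ≈⟨ +-congˡ (+-congʳ (≈-trans (∑-cong (allFin n) (λ w → ≈-trans (⊳-cong (atRank s l w) (λ p → level w (proj₂ (atRank⁻ {s} {l} {w} p))))
           (≈-sym (⊳-* (atRank s l w) (X * q d) _)))) (∑-*ˡ (allFin n) (X * q d) _))) ⟩
    1# + (X * q d * Z + ∑ (allFin n) (λ w → aboveRank s (suc l) w ⊳ M s w * v w))
      ≈⟨ solve 2 (λ y z → con ℤ.1ℤ :+ (y :+ z) := y :+ (con ℤ.1ℤ :+ z)) ≈-refl _ _ ⟩
    X * q d * Z + (1# + ∑ (allFin n) (λ w → aboveRank s (suc l) w ⊳ M s w * v w))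
      ≈⟨ +-congˡ (tail-sum m (suc l) s (suc d) l≡r′ (trans (ℕₚ.+-suc (ρ s) (suc d)) (cong suc s≡l))) ⟩
    X * q d * Z + (q (suc (suc d)) * a′ + X * q (suc d) * b′)
      ≈⟨ solve 5 (λ x y z a b → x :* y :* z :+ ((con ℤ.1ℤ :+ x :* (con ℤ.1ℤ :+ x :* y)) :* a :+ x :* (con ℤ.1ℤ :+ x :* y) :* b)
                   := (con ℤ.1ℤ :+ x :* y) :* ((con ℤ.1ℤ :+ x) :* a :+ x :* b) :+ x :* y :* (z :- a)) ≈-refl X (q d) Z a′ b′ ⟩
    q (suc d) * a (suc m) l s + X * q d * b (suc m) l s ∎
    where
    Z a′ b′ : Carrier
    Z = ∑ (allFin n) (λ x → atRank s l x ⊳ a m (suc l) x)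
    a′ = a m (suc l) s
    b′ = b m (suc l) s
    l≡r′ : suc l ℕ.+ m ≡ rank P
    l≡r′ = trans (sym (ℕₚ.+-suc l m)) l≡r
    choose : ∀ w → T (lt s w) → l ≤ ρ w → Dec (l ≡ ρ w) → T (atRank s l w) ⊎ T (aboveRank s (suc l) w)
    choose w x y (yes e) = inj₁ (T-∧⁺ x (ℕₚ.≡⇒≡ᵇ (ρ w) l (sym e)))
    choose w x y (no ne) = inj₂ (aboveRank⁺ x (ℕₚ.≤∧≢⇒< y ne))
    level : ∀ w → ρ w ≡ l → M s w * v w ≈ X * q d * a m (suc l) w
    level w e = *-cong (*-congˡ (reflexive (cong q (trans (cong (λ i → i ∸ ρ s ∸ 1) e) (gap {s} s≡l)))))
      (reflexive (cong₂ (λ i j → a i (suc j) w) (trans (cong₂ (λ i j → i ∸ 1 ∸ j) (sym l≡r′) e) (ℕₚ.m+n∸m≡n l m)) e))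

  v-rec : ∀ s → v s ≈ 1# + ∑ (allFin n) (λ w → lt s w ⊳ M s w * v w)
  v-rec s with s Fin.≟ top
  ... | yes refl = ≈-trans v-top (≈-sym (≈-trans (+-congˡ (≈-trans (∑-cong (allFin n) (λ w → ⊳-zero (lt top w)
          (λ p → ⊥-elim (lt-irrefl (lt-le-trans p (le-top w)))))) (∑-zero (allFin n)))) (+-identityʳ _)))
  ... | no ne = ≈-sym (begin
    1# + ∑ (allFin n) (λ w → lt s w ⊳ M s w * v w)
      ≈⟨ +-congˡ (∑-cong (allFin n) (λ w → reflexive (cong (_⊳ M s w * v w) (T-ext (λ p → aboveRank⁺ p (ρ-mono-< p)) (λ p → proj₁ (aboveRank⁻ {s} {suc (ρ s)} {w} p)))))) ⟩
    -- Starting just above `s` means d = 0, where q(1) = 1 and q(0) = 0, so the term with `b` drops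
    -- out.
    1# + ∑ (allFin n) (λ w → aboveRank s (suc (ρ s)) w ⊳ M s w * v w) ≈⟨ tail-sum (rank P ∸ 1 ∸ ρ s) (suc (ρ s)) s 0 total (ℕₚ.+-comm (ρ s) 1) ⟩
    (1# + X * 0#) * v s + X * 0# * b (rank P ∸ 1 ∸ ρ s) (suc (ρ s)) s
      ≈⟨ solve 3 (λ x a b → (con ℤ.1ℤ :+ x :* con ℤ.0ℤ) :* a :+ x :* con ℤ.0ℤ :* b := a) ≈-refl X (v s) _ ⟩
    v s ∎)
    where
    total : suc (ρ s) ℕ.+ (rank P ∸ 1 ∸ ρ s) ≡ rank P
    total = trans (cong (suc (ρ s) ℕ.+_) (ℕₚ.∸-+-assoc (rank P) 1 (ρ s))) (ℕₚ.m+[n∸m]≡n (ρ-mono-< (lt⁺ (le-top s) ne)))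

  -- The linear functional of flag h-vectors computing a: bits are consumed by tiles false, of
  -- weight 1 + X, and false ∷ true, of weight X.
  A B : ℕ → (List Bool → Carrier) → Carrier
  A zero ψ = ψ []
  A (suc m) ψ = (1# + X) * A m (ψ ∘ (false ∷_)) + X * B m (ψ ∘ (false ∷_))
  B zero ψ = 0#
  B (suc m) ψ = A m (ψ ∘ (true ∷_))

  A-cong : ∀ m {ψ φ} → (∀ bs → ψ bs ≈ φ bs) → A m ψ ≈ A m φ
  B-cong : ∀ m {ψ φ} → (∀ bs → ψ bs ≈ φ bs) → B m ψ ≈ B m φ
  A-cong zero e = e []
  A-cong (suc m) e = +-cong (*-congˡ (A-cong m (λ bs → e _))) (*-congˡ (B-cong m (λ bs → e _)))
  B-cong zero e = ≈-refl
  B-cong (suc m) e = A-cong m (λ bs → e _)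

  A-- : ∀ m ψ φ → A m (λ bs → ψ bs - φ bs) ≈ A m ψ - A m φ
  B-- : ∀ m ψ φ → B m (λ bs → ψ bs - φ bs) ≈ B m ψ - B m φ
  A-- zero ψ φ = ≈-refl
  A-- (suc m) ψ φ = ≈-trans (+-cong (*-congˡ (A-- m _ _)) (*-congˡ (B-- m _ _)))
    (solve 5 (λ x a c b d → (con ℤ.1ℤ :+ x) :* (a :- c) :+ x :* (b :- d) := ((con ℤ.1ℤ :+ x) :* a :+ x :* b) :- ((con ℤ.1ℤ :+ x) :* c :+ x :* d)) ≈-refl X _ _ _ _)
  B-- zero ψ φ = solve 0 (con ℤ.0ℤ := con ℤ.0ℤ :- con ℤ.0ℤ) ≈-refl
  B-- (suc m) ψ φ = A-- m _ _

  A-∑ : ∀ m {i} {I : Set i} (xs : List I) (ψ : I → List Bool → Carrier) → A m (λ bs → ∑ xs (λ i → ψ i bs)) ≈ ∑ xs (λ i → A m (ψ i))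
  B-∑ : ∀ m {i} {I : Set i} (xs : List I) (ψ : I → List Bool → Carrier) → B m (λ bs → ∑ xs (λ i → ψ i bs)) ≈ ∑ xs (λ i → B m (ψ i))
  A-∑ zero xs ψ = ≈-refl
  A-∑ (suc m) xs ψ = ≈-trans (+-cong (*-congˡ (A-∑ m xs _)) (*-congˡ (B-∑ m xs _)))
    (≈-sym (≈-trans (∑-+ xs _ _) (+-cong (∑-*ˡ xs (1# + X) _) (∑-*ˡ xs X _))))
  B-∑ zero xs ψ = ≈-sym (∑-zero xs)
  B-∑ (suc m) xs ψ = A-∑ m xs _

  -- The zero function is an empty sum, whatever its index type.
  A-0 : ∀ m → A m (λ _ → 0#) ≈ 0#
  A-0 m = A-∑ m {I = ℕ} [] (λ _ _ → 0#)

  A-⊳ : ∀ m d ψ → A m (λ bs → d ⊳ ψ bs) ≈ d ⊳ A m ψ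
  A-⊳ m true ψ = ≈-refl
  A-⊳ m false ψ = A-0 m

  -- A true bit expands `β` into the difference that defines `b`, and linearity lets the functional
  -- pass through it. So `a` depends on the poset only through flag h-numbers, with nonnegative
  -- weights.
  a≈A : ∀ m l s → a m l s ≈ A m (β l s)
  b≈B : ∀ m l s → b m l s ≈ B m (β l s)
  a≈A zero l s = ≈-refl
  a≈A (suc m) l s = +-cong (*-congˡ (a≈A m (suc l) s)) (*-congˡ (b≈B m (suc l) s))
  b≈B zero l s = ≈-refl
  b≈B (suc m) l s = ≈-sym (≈-trans (A-- m _ _) (+-cong
    (≈-trans (A-∑ m (allFin n) _) (∑-cong (allFin n) (λ x → ≈-trans (A-⊳ m (atRank s l x) _) (⊳-cong (atRank s l x) (λ _ → ≈-sym (a≈A m (suc l) x))))))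
    (-‿cong (≈-sym (a≈A m (suc l) s)))))

  -- Gamma-positive polynomials

  pow₁ : ℕ → Carrier
  pow₁ zero = 1#
  pow₁ (suc k) = (1# + X) * pow₁ k

  gammaTerm : ℕ → (ℕ → ℕ) → ℕ → Carrier
  gammaTerm m γ i = fromℤ (ℤ.+ γ i) * (pow i * pow₁ (m ∸ 2 ℕ.* i))

  gammaSum : ℕ → (ℕ → ℕ) → Carrier
  gammaSum m γ = ∑ (upTo (suc ⌊ m /2⌋)) (gammaTerm m γ)

  GammaPositive : ℕ → Carrier → Set ℓ
  GammaPositive m p = ∃[ γ ] p ≈ gammaSum m γ

  γ-cong : ∀ {m p p′} → p ≈ p′ → GammaPositive m p → GammaPositive m p′
  γ-cong e (γ , f) = γ , ≈-trans (≈-sym e) f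

  γ-const : ∀ i → ℤ.0ℤ ℤ.≤ i → GammaPositive 0 (fromℤ i)
  γ-const (ℤ.+ c) _ = (λ _ → c) , ≈-sym (≈-trans (+-identityʳ _) (≈-trans (*-congˡ (*-identityˡ _)) (*-identityʳ _)))

  γ-0 : ∀ m → GammaPositive m 0#
  γ-0 m = (λ _ → 0) , ≈-sym (≈-trans (∑-cong (upTo (suc ⌊ m /2⌋)) (λ i → zeroˡ _)) (∑-zero (upTo (suc ⌊ m /2⌋))))

  γ-+ : ∀ {m p p′} → GammaPositive m p → GammaPositive m p′ → GammaPositive m (p + p′)
  γ-+ {m} (γ , e) (γ′ , e′) = (λ i → γ i ℕ.+ γ′ i) , ≈-trans (+-cong e e′) (≈-trans (≈-sym (∑-+ (upTo (suc ⌊ m /2⌋)) _ _))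
    (∑-cong (upTo (suc ⌊ m /2⌋)) (λ i → ≈-sym (≈-trans (*-congʳ (fromℤ-+ (ℤ.+ γ i) (ℤ.+ γ′ i)))
      (solve 3 (λ x y z → (x :+ y) :* z := x :* z :+ y :* z) ≈-refl _ _ _)))))

  ∑-upTo-∷ʳ : ∀ N f → ∑ (upTo (suc N)) f ≈ ∑ (upTo N) f + f N
  ∑-upTo-∷ʳ N f = ≈-trans (reflexive (cong (λ xs → ∑ xs f) (sym (Listₚ.upTo-∷ʳ N)))) (≈-trans (∑-++ (upTo N) _ f) (+-congˡ (+-identityʳ _)))

  ∑-upTo-suc : ∀ N f → ∑ (upTo (suc N)) f ≈ f 0 + ∑ (upTo N) (f ∘ suc)
  ∑-upTo-suc N f = +-congˡ (≈-trans (reflexive (cong (λ xs → ∑ xs f) (sym (Listₚ.map-upTo suc N)))) (∑-map (upTo N) suc f))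

  ∑-upTo-cong : ∀ N {f g} → (∀ i → i < N → f i ≈ g i) → ∑ (upTo N) f ≈ ∑ (upTo N) g
  ∑-upTo-cong zero e = ≈-refl
  ∑-upTo-cong (suc N) e = ≈-trans (∑-upTo-∷ʳ N _) (≈-trans (+-cong (∑-upTo-cong N (λ i l → e i (ℕₚ.m<n⇒m<1+n l))) (e N ℕₚ.≤-refl)) (≈-sym (∑-upTo-∷ʳ N _)))

  half : ∀ m → (⌊ suc m /2⌋ ≡ ⌊ m /2⌋) ⊎ (⌊ suc m /2⌋ ≡ suc ⌊ m /2⌋ × m < 2 ℕ.* suc ⌊ m /2⌋)
  half zero = inj₁ refl
  half (suc zero) = inj₂ (refl , s≤s (s≤s z≤n))
  half (suc (suc m)) with half m
  ... | inj₁ e = inj₁ (cong suc e)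
  ... | inj₂ (e , l) = inj₂ (cong suc e , subst (suc (suc m) <_) (sym (ℕₚ.*-suc 2 (suc ⌊ m /2⌋))) (s≤s (s≤s l)))

  2*half : ∀ m → 2 ℕ.* ⌊ m /2⌋ ≤ m
  2*half zero = z≤n
  2*half (suc zero) = z≤n
  2*half (suc (suc m)) = subst (_≤ suc (suc m)) (sym (ℕₚ.*-suc 2 ⌊ m /2⌋)) (s≤s (s≤s (2*half m)))

  -- Each term gains a factor 1 + x, legitimately since 2i ≤ m keeps the subtraction exact. If the
  -- summation range grows, the new index receives coefficient 0, which is why `γ′` cuts off at `m`.
  γ-1+X : ∀ {m p} → GammaPositive m p → GammaPositive (suc m) ((1# + X) * p)
  γ-1+X {m} {p} (γ , e) = γ′ , ≈-trans (*-congˡ e) (≈-trans (≈-sym (∑-*ˡ (upTo (suc ⌊ m /2⌋)) (1# + X) _)) (≈-trans (∑-upTo-cong (suc ⌊ m /2⌋) terms) extend))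
    where
    γ′ : ℕ → ℕ
    γ′ i = if 2 ℕ.* i ≤ᵇ m then γ i else 0
    γ′-low : ∀ {i} → 2 ℕ.* i ≤ m → γ′ i ≡ γ i
    γ′-low {i} l = cong (λ d → if d then γ i else 0) (T⇒true (ℕₚ.≤⇒≤ᵇ l))
    γ′-high : ∀ {i} → m < 2 ℕ.* i → γ′ i ≡ 0
    γ′-high {i} l = cong (λ d → if d then γ i else 0) (¬T⇒false (λ t → ℕₚ.<⇒≱ l (ℕₚ.≤ᵇ⇒≤ (2 ℕ.* i) m t)))
    terms : ∀ i → i < suc ⌊ m /2⌋ → (1# + X) * gammaTerm m γ i ≈ gammaTerm (suc m) γ′ i
    terms i (s≤s l) = begin
      (1# + X) * (fromℤ (ℤ.+ γ i) * (pow i * pow₁ (m ∸ 2 ℕ.* i)))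
        ≈⟨ solve 4 (λ x g p r → (con ℤ.1ℤ :+ x) :* (g :* (p :* r)) := g :* (p :* ((con ℤ.1ℤ :+ x) :* r))) ≈-refl X _ _ _ ⟩
      fromℤ (ℤ.+ γ i) * (pow i * pow₁ (suc (m ∸ 2 ℕ.* i)))
        ≈⟨ reflexive (cong₂ (λ g k → fromℤ (ℤ.+ g) * (pow i * pow₁ k)) (sym (γ′-low {i} 2i≤m)) (sym (ℕₚ.+-∸-assoc 1 2i≤m))) ⟩
      gammaTerm (suc m) γ′ i ∎
      where
      2i≤m : 2 ℕ.* i ≤ m
      2i≤m = ℕₚ.≤-trans (ℕₚ.*-monoʳ-≤ 2 l) (2*half m)
    extend : ∑ (upTo (suc ⌊ m /2⌋)) (gammaTerm (suc m) γ′) ≈ gammaSum (suc m) γ′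
    extend with half m
    ... | inj₁ e = reflexive (cong (λ N → ∑ (upTo (suc N)) (gammaTerm (suc m) γ′)) (sym e))
    ... | inj₂ (e , l) = ≈-sym (≈-trans (reflexive (cong (λ N → ∑ (upTo (suc N)) (gammaTerm (suc m) γ′)) e))
      (≈-trans (∑-upTo-∷ʳ (suc ⌊ m /2⌋) _) (≈-trans (+-congˡ (≈-trans (*-congʳ (reflexive (cong (λ g → fromℤ (ℤ.+ g)) (γ′-high {suc ⌊ m /2⌋} l)))) (zeroˡ _))) (+-identityʳ _))))

  -- Raising both the index by 1 and `m` by 2 leaves the exponent of 1 + x unchanged.
  γ-X : ∀ {m p} → GammaPositive m p → GammaPositive (suc (suc m)) (X * p)
  γ-X {m} {p} (γ , e) = γ′ , ≈-trans (*-congˡ e) (≈-trans (≈-sym (∑-*ˡ (upTo (suc ⌊ m /2⌋)) X _))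
    (≈-sym (≈-trans (∑-upTo-suc (suc ⌊ m /2⌋) _) (≈-trans (+-congʳ (zeroˡ _)) (≈-trans (+-identityˡ _) (∑-cong (upTo (suc ⌊ m /2⌋)) terms))))))
    where
    γ′ : ℕ → ℕ
    γ′ zero = 0
    γ′ (suc i) = γ i
    terms : ∀ i → gammaTerm (suc (suc m)) γ′ (suc i) ≈ X * gammaTerm m γ i
    terms i = ≈-trans (*-congˡ (*-congˡ (reflexive (cong (λ k → pow₁ (suc (suc m) ∸ k)) (ℕₚ.*-suc 2 i)))))
      (solve 4 (λ x g p r → g :* ((x :* p) :* r) := x :* (g :* (p :* r))) ≈-refl X _ _ _)

  -- Each tile preserves gamma-positivity and raises the degree by its length: 1 for the weight 1 +
  -- x, 2 for the weight x. A pair that would run past the last rank contributes 0.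
  A-γ : ∀ m (ψ : List Bool → ℤ) → (∀ bs → length bs ≡ m → ℤ.0ℤ ℤ.≤ ψ bs) → GammaPositive m (A m (fromℤ ∘ ψ))
  XB-γ : ∀ m (ψ : List Bool → ℤ) → (∀ bs → length bs ≡ m → ℤ.0ℤ ℤ.≤ ψ bs) → GammaPositive (suc m) (X * B m (fromℤ ∘ ψ))
  A-γ zero ψ nonneg = γ-const (ψ []) (nonneg [] refl)
  A-γ (suc m) ψ nonneg = γ-+ {suc m} (γ-1+X {m} (A-γ m (ψ ∘ (false ∷_)) (λ bs e → nonneg (false ∷ bs) (cong suc e))))
                                     (XB-γ m (ψ ∘ (false ∷_)) (λ bs e → nonneg (false ∷ bs) (cong suc e)))
  XB-γ zero ψ nonneg = γ-cong {1} (≈-sym (zeroʳ X)) (γ-0 1)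
  XB-γ (suc m) ψ nonneg = γ-X {m} (A-γ m (ψ ∘ (true ∷_)) (λ bs e → nonneg (true ∷ bs) (cong suc e)))

  a-γ : ∀ m → (∀ bs → length bs ≡ m → ℤ.0ℤ ℤ.≤ FlagNumbers.β ℤₚ.+-*-commutativeRing P 1 bot bs) → GammaPositive m (a m 1 bot)
  a-γ m nonneg = γ-cong {m} (≈-trans (A-cong m (FlagNumbers-fromℤ.fromℤ-β R P 1 bot)) (≈-sym (a≈A m 1 bot))) (A-γ m _ nonneg)

-- Gamma-positivity of the Chow polynomial

module ChowPolynomial {n} (P : GradedBoundedPoset n) where
  open GradedBoundedPoset P
  open PolynomialRing
  open CommutativeRing commutativeRing using (reflexive)
  open Sums commutativeRing using (∑)
  open ChowRecursion commutativeRing P X using (pow; ChowData; chow-unique)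
  open ChowSolution commutativeRing P X
  open IncidenceAlgebra P

  monoₚ≈pow : ∀ k → monoₚ k ≈ₚ pow k
  monoₚ≈pow zero = ≈-refl
  monoₚ≈pow (suc k) = ≈-trans (monoₚ-suc k) (*ₚ-congʳ X (monoₚ≈pow k))

  powₚ≈pow₁ : ∀ k → powₚ (ℤ.1ℤ ∷ ℤ.1ℤ ∷ []) k ≈ₚ pow₁ k
  powₚ≈pow₁ zero = ≈-refl
  powₚ≈pow₁ (suc k) = *ₚ-congʳ (ℤ.1ℤ ∷ ℤ.1ℤ ∷ []) (powₚ≈pow₁ k)

  gammaExpansion≈gammaSum : ∀ γ → gammaExpansion (rank P) γ ≈ₚ gammaSum (rank P ∸ 1) γ
  gammaExpansion≈gammaSum γ = go (upTo (suc ⌊ rank P ∸ 1 /2⌋))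
    where
    go : ∀ xs → sumₚ (map (λ i → scaleₚ (ℤ.+ γ i) (monoₚ i *ₚ powₚ (ℤ.1ℤ ∷ ℤ.1ℤ ∷ []) (rank P ∸ 1 ∸ 2 ℕ.* i))) xs) ≈ₚ ∑ xs (gammaTerm (rank P ∸ 1) γ)
    go [] = ≈-refl
    go (i ∷ xs) = +ₚ-cong (≈-trans (scaleₚ≈constₚ* (ℤ.+ γ i) _)
      (*ₚ-cong (constₚ≈fromℤ (ℤ.+ γ i)) (*ₚ-cong (monoₚ≈pow i) (powₚ≈pow₁ (rank P ∸ 1 ∸ 2 ℕ.* i))))) (go xs)

  chowData : ChowData
  chowData = record
    { X-1-cancel = X-1*-cancel ; h = h ; χᴿ = χ P ; χ̄ᴿ = χ̄ P ; μᴿ = μₚ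
    ; χ-expand = λ s t → ≈-trans (χ≈∑ s t) (Sums.∑-cong commutativeRing (allFin n) (λ w → Sums.⊳-cong commutativeRing (le s w ∧ le w t)
        (λ _ → ≈-trans (scaleₚ≈constₚ* (μ P s w) _) (*ₚ-congʳ (μₚ s w) (monoₚ≈pow (ρ t ∸ ρ w))))))
    ; μζ = μₚζ ; χ-diag = χ-diag ; χ̄-less = χ̄-less ; h-bot = h-bot ; h-rec = h-rec }

  chowPoly≈a : chowPoly P ≈ₚ a (rank P ∸ 1) 1 bot
  chowPoly≈a = ≈-trans (chow-unique chowData v v-rec) (reflexive (cong (λ i → a (rank P ∸ 1 ∸ i) (suc i) bot) ρ-bot))

  chowPoly-γ : CohenMacaulay P → 1 ≤ rank P → ∃[ γ ] chowPoly P ≈ₚ gammaExpansion (rank P) γ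
  chowPoly-γ cm 1≤r = proj₁ positive , ≈-trans (proj₂ positive) (≈-sym (gammaExpansion≈gammaSum (proj₁ positive)))
    where
    positive : GammaPositive (rank P ∸ 1) (chowPoly P)
    positive = γ-cong {rank P ∸ 1} (≈-sym chowPoly≈a)
      (a-γ (rank P ∸ 1) (λ bs len → FlagNonnegativity.β-nonneg P cm bs (trans (cong suc len) (ℕₚ.m+[n∸m]≡n 1≤r))))

theorem4p20 : ∀ {n : ℕ} (P : GradedBoundedPoset n) → CohenMacaulay P → 1 ≤ rank P →
    ∃[ γ ] (∀ (k : ℕ) → coeff (chowPoly P) k ≡ coeff (gammaExpansion (rank P) γ) k)
theorem4p20 P cm 1≤r = let (γ , e) = ChowPolynomial.chowPoly-γ P cm 1≤r in γ , PolynomialRing.at e
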